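{- Let $G$ be a (theta, prism)-free graph, let $a\in V(G)$ and let $T$ be a smooth tree. Suppose that there exists a tame, substantial and rich $(T,a)$-strip-structure in $G$. Then there is a substantial and rich $(T,a)$-strip-structure $\zeta$ in $G$ for which $V(G)\setminus(\zeta^+(T)\cup\mathcal{J}_\zeta)$ is anticomplete to $\zeta^+(T)$.
   Context: Graphs are finite and simple; induced subgraphs identified with vertex sets; "path" means induced path; length = number of edges. Theta: two non-adjacent vertices joined by three internally disjoint paths of length $\geq 2$ with pairwise anticomplete interiors. Prism: two disjoint triangles $\{a_1,a_2,a_3\},\{b_1,b_2,b_3\}$ and disjoint paths $P_i$ from $a_i$ to $b_i$, with $a_ia_j,b_ib_j$ the only edges between $P_i,P_j$ ($i\ne j$). Pyramid: apex $a$, base triangle $\{b_1,b_2,b_3\}$, paths $P_i$ from $a$ to $b_i$ of length $\geq1$, otherwise disjoint, $b_ib_j$ the only edge between $P_i\setminus\{a\}$ and $P_j\setminus\{a\}$, at most one $P_i$ of length one. A vertex $p\notin\Sigma$ is a jewel for a pyramid $\Sigma$ at $b_i$ if $p$ is anticomplete to $P_i$ and $N_{P_j}(p)=N_{P_j}[b_j]$ for $j\ne i$. $a$ is trapped in an induced subgraph $H$ if all vertices at distance $\le 2$ from $a$ lie in $H$ and every neighbor of $a$ has degree two in $H$. Strip-structures: a tree $T$ is smooth if it has $\ge 3$ vertices and every vertex is a leaf or has degree $>2$ (a branch vertex). For $\eta: V(T)\cup E(T)\cup(E(T)\times V(T))\to 2^{V(G)\setminus\{a\}}$ and $S\subseteq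 V(T)$ let $\eta(S)=\bigcup_{v\in S}\eta(v)\cup\bigcup_{e\in E(T[S])}\eta(e)$, $\eta(T)=\eta(V(T))$, $\eta^+(S)=\eta(S)\cup\{a\}$; $B_\eta(v)=\bigcup_{e\ni v}\eta(e,v)$; for $e=uv$, $\eta^\circ(e)=\eta(e)\setminus(\eta(e,u)\cup\eta(e,v))$. $\eta$ is a $(T,a)$-strip-structure if: (S1) $\eta(o)$, $o\in V(T)\cup E(T)$, are pairwise disjoint; (S2) $\eta(l)=\emptyset$ for leaves $l$; (S3) $\eta(e,v)\subseteq\eta(e)$, nonempty iff $e$ is incident with $v$; (S4) for distinct $e,f$ and every $v$, $\eta(e,v)$ is complete to $\eta(f,v)$ and there are no other edges between $\eta(e),\eta(f)$; (S5) for $e=uv$, every $x\in\eta(e)$ has a path in $G[\eta(e)]$ to $\eta(e,u)$ with interior in $\eta^\circ(e)$, and likewise to $\eta(e,v)$; (S6) $\eta(v)$ is anticomplete to $\eta(e)\setminus\eta(e,v)$; (S7) every component of $G[\eta(v)]$ has a neighbor in $B_\eta(v)$; (S8) for each leaf $l$ with incident edge $e$, $a$ is complete to $\eta(e,l)$, and $a$ has no other neighbors in $\eta(T)$. For $e=uv$, an $\eta(e)$-rung is a path $P$ in $G[\eta(e)]$ such that either $|P|=1$ and $P\subseteq\eta(e,u)\cap\eta(e,v)$, or $P$ has an end in $\eta(e,u)\setminus\eta(e,v)$, an end in $\eta(e,v)\setminus\eta(e,u)$ and interior in $\eta^\circ(e)$; it is long if it has at least two vertices. $\eta$ is tame if $\eta(v)=\emptyset$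 for all $v$ and every vertex of each $\eta(e)$ lies in some $\eta(e)$-rung; substantial if for every $e$ there is a long $\eta(e)$-rung; rich if $a$ is trapped in $\eta^+(T)$ and for every leaf $l$ with incident edge $e$, $|\eta(e,l)|=1$. A seagull is $(v,e_1,e_2)$ with $e_1\ne e_2$ incident with $v$; a claw is $(v,e_1,e_2,e_3)$ with distinct $e_i$ incident with $v$. An $\eta$-pyramid at claw $(v,e_1,e_2,e_3)$ is a pyramid $\Sigma$ with apex $a$, base $b_1b_2b_3$, paths $P_1,P_2,P_3$ such that for each $i$: $b_i\in\eta(e_i,v)$, and there is a leaf $l_i$ of $T$ in the component of $T-e_i$ not containing $v$ such that, with $\Lambda_i$ the path of $T$ from $v$ to $l_i$, $P_i=\Gamma_i\cup\{a\}$ where $\Gamma_i$ is a path in $\bigcup_{e\in E(\Lambda_i)}\eta(e)$ with $\Gamma_i\cap\eta(e_i)$ a long $\eta(e_i)$-rung and $\Gamma_i\cap\eta(e)$ an $\eta(e)$-rung for every other $e\in E(\Lambda_i)$. A vertex $p\in V(G)\setminus\eta^+(T)$ is a jewel for $\eta$ at seagull $(v,e_1,e_2)$ if for some edge $e_3\notin\{e_1,e_2\}$ incident with $v$ there is an $\eta$-pyramid at $(v,e_1,e_2,e_3)$ with $b_i\in\eta(e_i,v)$ such that $p$ is a jewel for it at $b_3$. $\mathcal{J}_\eta$ is the set of all jewels for $\eta$ (at seagulls at branch vertices). -}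

module Defs where

open import Data.Nat using (ℕ; zero; suc; _≥_; _≤_)
open import Data.Fin using (Fin; toℕ)
open import Data.Fin.Subset using (Subset; _∈_; _∉_)
open import Data.Bool using (Bool; true; false)
open import Data.List using (List; []; _∷_; length; lookup; _++_; [_])
open import Data.List.Membership.Propositional renaming (_∈_ to _∈ₗ_; _∉_ to _∉ₗ_)
open import Data.Product using (Σ; ∃; ∃-syntax; _×_; _,_)
open import Data.Sum using (_⊎_)
open import Data.Empty using (⊥)
open import Data.Unit using (⊤)
open import Relation.Nullary using (¬_)
open import Relation.Binary.PropositionalEquality using (_≡_; _≢_)
open import Function.Bundles using (_⇔_)

record Graph (n : ℕ) : Set where
  field
    adj    : Fin n → Fin n → Bool
    sym    : ∀ x y → adj x y ≡ adj y x
    irrefl : ∀ x → adj x x ≡ false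

module _ {n : ℕ} (G : Graph n) where
  open Graph G

  V : Set
  V = Fin n

  E : V → V → Set
  E x y = adj x y ≡ true

  record IsPath (P : List V) : Set where
    field
      nonempty : 1 ≤ length P
      distinct : ∀ (i j : Fin (length P)) → lookup P i ≡ lookup P j → i ≡ j
      induced  : ∀ (i j : Fin (length P)) →
                 E (lookup P i) (lookup P j) ⇔ (toℕ j ≡ suc (toℕ i) ⊎ toℕ i ≡ suc (toℕ j))

  PathFT : List V → V → V → Set
  PathFT P x y = IsPath P × (∃[ Q ] P ≡ x ∷ Q) × (∃[ R ] P ≡ R ++ [ y ])

  Interior : List V → V → V → V → Set
  Interior P x y z = z ∈ₗ P × z ≢ x × z ≢ y

  IsTheta : V → V → (Fin 3 → List V) → Set
  IsTheta s t P =
      ¬ E s t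
    × (∀ i → PathFT (P i) s t × 3 ≤ length (P i))      -- length ≥ 2
    × (∀ i j → i ≢ j → ∀ z → Interior (P i) s t z → ¬ Interior (P j) s t z)
    × (∀ i j → i ≢ j → ∀ z w → Interior (P i) s t z → Interior (P j) s t w → ¬ E z w)

  ThetaFree : Set
  ThetaFree = ∀ s t P → ¬ IsTheta s t P

  IsPrism : (Fin 3 → V) → (Fin 3 → V) → (Fin 3 → List V) → Set
  IsPrism a b P =
      (∀ i j → i ≢ j → E (a i) (a j))
    × (∀ i j → i ≢ j → E (b i) (b j))
    × (∀ i j → a i ≢ b j)
    × (∀ i → PathFT (P i) (a i) (b i))
    × (∀ i j → i ≢ j → ∀ z → z ∈ₗ P i → z ∉ₗ P j)
    × (∀ i j → i ≢ j → ∀ x y → x ∈ₗ P i → y ∈ₗ P j → E x y →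
         (x ≡ a i × y ≡ a j) ⊎ (x ≡ b i × y ≡ b j))

  PrismFree : Set
  PrismFree = ∀ a b P → ¬ IsPrism a b P

  -- P i \ {a} for a path P i starting at the apex a
  Tail : List V → V → Set
  Tail [] z = ⊥
  Tail (_ ∷ Q) z = z ∈ₗ Q

  IsPyramid : V → (Fin 3 → V) → (Fin 3 → List V) → Set
  IsPyramid a b P =
      (∀ i j → i ≢ j → E (b i) (b j))
    × (∀ i → PathFT (P i) a (b i) × 2 ≤ length (P i))   -- length ≥ 1
    × (∀ i j → i ≢ j → ∀ z → Tail (P i) z → ¬ Tail (P j) z)
    × (∀ i j → i ≢ j → ∀ x y → Tail (P i) x → Tail (P j) y → E x y →
         x ≡ b i × y ≡ b j)
    × (∀ i j → i ≢ j → length (P i) ≡ 2 → length (P j) ≡ 2 → ⊥)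

  JewelPyr : V → (Fin 3 → V) → (Fin 3 → List V) → Fin 3 → V → Set
  JewelPyr a b P i p =
      (∀ j → p ∉ₗ P j)
    × (∀ x → x ∈ₗ P i → ¬ E p x)
    × (∀ j → j ≢ i → ∀ x → x ∈ₗ P j → (E p x ⇔ (x ≡ b j ⊎ E x (b j))))

  DegTwoIn : (V → Set) → V → Set
  DegTwoIn H x = Σ V λ y → Σ V λ z → y ≢ z × H y × H z × E x y × E x z
                 × (∀ w → H w → E x w → w ≡ y ⊎ w ≡ z)

  Trapped : V → (V → Set) → Set
  Trapped a H =
      H a
    × (∀ x → E a x → H x)
    × (∀ x y → E a x → E x y → H y)
    × (∀ x → E a x → DegTwoIn H x)

module _ {m : ℕ} (T : Graph m) where
  open Graph T

  WalkOK : List (Fin m) → Set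
  WalkOK [] = ⊥
  WalkOK (x ∷ []) = ⊤
  WalkOK (x ∷ y ∷ xs) = E T x y × WalkOK (y ∷ xs)

  Connected : Set
  Connected = ∀ u v → ∃[ W ] WalkOK W × (∃[ Q ] W ≡ u ∷ Q) × (∃[ R ] W ≡ R ++ [ v ])

  IsCycle : List (Fin m) → Set
  IsCycle C = 3 ≤ length C
            × (∀ (i j : Fin (length C)) → lookup C i ≡ lookup C j → i ≡ j)
            × WalkOK C
            × (∃[ x ] ∃[ y ] ∃[ R ] C ≡ x ∷ R ++ [ y ] × E T y x)

  IsTree : Set
  IsTree = Connected × (∀ C → ¬ IsCycle C)

  Leaf : Fin m → Set
  Leaf v = Σ (Fin m) λ u → E T v u × (∀ w → E T v w → w ≡ u)

  Branch : Fin m → Set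
  Branch v = Σ (Fin m) λ x → Σ (Fin m) λ y → Σ (Fin m) λ z →
             x ≢ y × y ≢ z × x ≢ z × E T v x × E T v y × E T v z

  Smooth : Set
  Smooth = IsTree × 3 ≤ m × (∀ v → Leaf v ⊎ Branch v)

  SameEdge : Fin m → Fin m → Fin m → Fin m → Set
  SameEdge u v u' v' = (u ≡ u' × v ≡ v') ⊎ (u ≡ v' × v ≡ u')

  WalkAvoid : Fin m → Fin m → List (Fin m) → Set
  WalkAvoid s t [] = ⊥
  WalkAvoid s t (x ∷ []) = ⊤
  WalkAvoid s t (x ∷ y ∷ xs) = E T x y × ¬ SameEdge x y s t × WalkAvoid s t (y ∷ xs)

  ReachAvoid : Fin m → Fin m → Fin m → Fin m → Set
  ReachAvoid s t v w = ∃[ W ] WalkAvoid s t W × (∃[ Q ] W ≡ v ∷ Q) × (∃[ R ] W ≡ R ++ [ w ])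

  Consec : List (Fin m) → Fin m → Fin m → Set
  Consec [] x y = ⊥
  Consec (_ ∷ []) x y = ⊥
  Consec (u ∷ w ∷ L) x y = (u ≡ x × w ≡ y) ⊎ Consec (w ∷ L) x y

-- the data of η : V(T) ∪ E(T) ∪ (E(T) × V(T)) → 2^V(G);
-- an edge uv of T is given by either ordered pair (u,v) or (v,u)
record StripData (n m : ℕ) : Set where
  field
    ηv  : Fin m → Subset n
    ηe  : Fin m → Fin m → Subset n
    ηev : Fin m → Fin m → Fin m → Subset n

module _ {n m : ℕ} (G : Graph n) (T : Graph m) (a : Fin n) (η : StripData n m) where
  open StripData η

  private
    EG = E G
    ET = E T

  InηT : Fin n → Set
  InηT x = (∃[ v ] x ∈ ηv v) ⊎ (∃[ u ] ∃[ v ] ET u v × x ∈ ηe u v)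

  InηT⁺ : Fin n → Set
  InηT⁺ x = x ≡ a ⊎ InηT x

  InB : Fin m → Fin n → Set
  InB v x = ∃[ u ] ET v u × x ∈ ηev v u v

  InCirc : Fin m → Fin m → Fin n → Set
  InCirc u v x = x ∈ ηe u v × x ∉ ηev u v u × x ∉ ηev u v v

  record IsStrip : Set where
    field
      ηe-sym  : ∀ u v → ET u v → ηe u v ≡ ηe v u
      ηev-sym : ∀ u v w → ET u v → ηev u v w ≡ ηev v u w
      a∉v  : ∀ v → a ∉ ηv v
      a∉e  : ∀ u v → ET u v → a ∉ ηe u v
      a∉ev : ∀ u v w → ET u v → a ∉ ηev u v w
      S1-vv : ∀ u v → u ≢ v → ∀ x → x ∈ ηv u → x ∉ ηv v
      S1-ve : ∀ w u v → ET u v → ∀ x → x ∈ ηv w → x ∉ ηe u v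
      S1-ee : ∀ u v u' v' → ET u v → ET u' v' → ¬ SameEdge T u v u' v' →
              ∀ x → x ∈ ηe u v → x ∉ ηe u' v'
      S2 : ∀ l → Leaf T l → ∀ x → x ∉ ηv l
      S3-sub : ∀ u v w → ET u v → ∀ x → x ∈ ηev u v w → x ∈ ηe u v
      S3-ne  : ∀ u v w → ET u v → (∃[ x ] x ∈ ηev u v w) ⇔ (w ≡ u ⊎ w ≡ v)
      S4-comp  : ∀ u v u' v' → ET u v → ET u' v' → ¬ SameEdge T u v u' v' →
                 ∀ w x y → x ∈ ηev u v w → y ∈ ηev u' v' w → EG x y
      S4-other : ∀ u v u' v' → ET u v → ET u' v' → ¬ SameEdge T u v u' v' →
                 ∀ x y → x ∈ ηe u v → y ∈ ηe u' v' → EG x y →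
                 ∃[ w ] x ∈ ηev u v w × y ∈ ηev u' v' w
      -- (S5) (both ends covered since u, v range over ordered pairs)
      S5 : ∀ u v → ET u v → ∀ x → x ∈ ηe u v →
           ∃[ P ] ∃[ y ] PathFT G P x y × y ∈ ηev u v u
             × (∀ z → z ∈ₗ P → z ∈ ηe u v)
             × (∀ z → Interior G P x y z → InCirc u v z)
      S6 : ∀ w u v → ET u v → ∀ x y → x ∈ ηv w → y ∈ ηe u v → y ∉ ηev u v w → ¬ EG x y
      -- (S7) the component of G[η(v)] containing x has a neighbour in B_η(v)
      S7 : ∀ v x → x ∈ ηv v →
           ∃[ P ] ∃[ y ] PathFT G P x y × (∀ z → z ∈ₗ P → z ∈ ηv v)
             × (∃[ z ] InB v z × EG y z)
      S8-comp  : ∀ l u → Leaf T l → ET l u → ∀ x → x ∈ ηev l u l → EG a x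
      S8-other : ∀ x → InηT x → EG a x →
                 ∃[ l ] ∃[ u ] Leaf T l × ET l u × x ∈ ηev l u l

  IsRung : Fin m → Fin m → (Fin n → Set) → Set
  IsRung u v S = ∃[ P ] (∀ z → S z ⇔ z ∈ₗ P) × (∀ z → z ∈ₗ P → z ∈ ηe u v) ×
      ( (∃[ x ] P ≡ [ x ] × x ∈ ηev u v u × x ∈ ηev u v v)
      ⊎ (∃[ x ] ∃[ y ] PathFT G P x y
           × x ∈ ηev u v u × x ∉ ηev u v v
           × y ∈ ηev u v v × y ∉ ηev u v u
           × (∀ z → Interior G P x y z → InCirc u v z)))

  IsLongRung : Fin m → Fin m → (Fin n → Set) → Set
  IsLongRung u v S = ∃[ P ] (∀ z → S z ⇔ z ∈ₗ P) × 2 ≤ length P × (∀ z → z ∈ₗ P → z ∈ ηe u v) ×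
      ( (∃[ x ] P ≡ [ x ] × x ∈ ηev u v u × x ∈ ηev u v v)
      ⊎ (∃[ x ] ∃[ y ] PathFT G P x y
           × x ∈ ηev u v u × x ∉ ηev u v v
           × y ∈ ηev u v v × y ∉ ηev u v u
           × (∀ z → Interior G P x y z → InCirc u v z)))

  Tame : Set
  Tame = (∀ v x → x ∉ ηv v)
       × (∀ u v → ET u v → ∀ x → x ∈ ηe u v →
            Σ (Subset n) λ S → IsRung u v (_∈ S) × x ∈ S)

  Substantial : Set
  Substantial = ∀ u v → ET u v → Σ (Subset n) λ S → IsLongRung u v (_∈ S)

  Rich : Set
  Rich = Trapped G a InηT⁺
       × (∀ l u → Leaf T l → ET l u → ∃[ x ] ∀ y → y ∈ ηev l u l ⇔ y ≡ x)

  IsηPyramid : Fin m → (Fin 3 → Fin m) → (Fin 3 → Fin n) → (Fin 3 → List (Fin n)) → Set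
  IsηPyramid v w b P =
      IsPyramid G a b P
    × (∀ i → b i ∈ ηev v (w i) v
        × ∃[ l ] Leaf T l × ¬ ReachAvoid T v (w i) v l
        × ∃[ Λ ] PathFT T Λ v l
        × ∃[ Γ ] P i ≡ a ∷ Γ
        × IsPath G Γ
        × (∀ z → z ∈ₗ Γ → ∃[ x ] ∃[ y ] Consec T Λ x y × z ∈ ηe x y)
        × IsLongRung v (w i) (λ z → z ∈ₗ Γ × z ∈ ηe v (w i))
        × (∀ x y → Consec T Λ x y → ¬ SameEdge T x y v (w i) →
             IsRung x y (λ z → z ∈ₗ Γ × z ∈ ηe x y)))

  -- p ∈ 𝒥_η : p is a jewel for η at some seagull (v, v w₀, v w₁) at a branch vertex v
  InJ : Fin n → Set
  InJ p = ¬ InηT⁺ p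
        × ∃[ v ] Branch T v
        × ∃[ w ] (∀ i → ET v (w i)) × (∀ i j → w i ≡ w j → i ≡ j)
        × ∃[ b ] ∃[ P ] IsηPyramid v w b P
        × JewelPyr G a b P (Data.Fin.suc (Data.Fin.suc Data.Fin.zero)) p

-- Call two vertices of η(T) separated at a node v of T if they lie in strips in different directions from v
-- and are not both in B(v); a set of vertices is local (inside one B(v) or one η(e)) iff it contains no
-- separated pair. Take a tame η with η(T) maximal, and a shortest path D outside η⁺(T) whose attachments
-- are not local. Routing rungs through a separated pair x, y at v gives pyramids based at v. Excluding
-- thetas and prisms there shows that either D is a single jewel, or exactly one of x, y lies in B(v) and D
-- is complete to the part of B(v) outside the strip on the side of the other. Comparing the two ends of
-- an edge of T, it follows that D (or D followed by the end of a rung) can be added to a strip as a new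
-- rung, against maximality. So a vertex outside η⁺(T) with nonlocal neighbourhood is a jewel, and every
-- component of the other vertices outside η⁺(T) has local attachments, hence fits into η(v) or η(e).
module Submission where

open import Defs
open import Data.Nat using (ℕ; zero; suc; _≤_; _<_; z≤n; s≤s)
import Data.Nat.Properties as ℕ
open import Data.Bool using (true)
import Data.Bool.Properties as Bool
open import Data.Fin using (Fin; zero; suc; toℕ)
open import Data.Fin.Properties using (_≟_; any?; all?; injective⇒≤)
open import Data.Fin.Subset using (Subset; _∈_; _∉_; _⊆_; _⊃_)
open import Data.Fin.Subset.Properties using (_∈?_; ⊆-antisym)
open import Data.Fin.Subset.Induction using (⊃-wellFounded)
open import Data.List using (List; []; _∷_; length; lookup; _++_; [_]; reverse)
open import Data.List.Properties using (++-assoc; ∷-injective; length-reverse; unfold-reverse)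
open import Data.List.Membership.Propositional using (lose) renaming (_∈_ to _∈ₗ_; _∉_ to _∉ₗ_)
open import Data.List.Membership.Propositional.Properties using (∈-++⁺ˡ; ∈-++⁺ʳ; ∈-++⁻; ∈-∃++; ∈-lookup)
open import Data.List.Relation.Unary.Any using (here; there; index) renaming (any? to anyL?)
open import Data.List.Relation.Unary.Any.Properties using (lookup-index; reverse⁻; reverse⁺)
open import Data.List.Relation.Unary.All using (All; []; _∷_; tabulate) renaming (lookup to lookupAll; all? to allL?)
open import Data.Vec using () renaming (tabulate to tabulateV)
open import Data.Vec.Properties using ([]=⇒lookup; lookup⇒[]=; lookup∘tabulate)
open import Data.Product using (Σ; ∃; ∃-syntax; _×_; _,_; proj₁; proj₂)
open import Data.Sum using (_⊎_; inj₁; inj₂; [_,_]′)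
open import Data.Empty using (⊥; ⊥-elim)
open import Data.Unit using (⊤; tt)
open import Function using (_∘_; id)
open import Function.Bundles using (_⇔_; mk⇔; Equivalence)
open import Induction.WellFounded using (Acc; acc)
open import Relation.Nullary using (¬_; Dec; yes; no; does)
open import Relation.Nullary.Decidable using (_×-dec_; _⊎-dec_; _→-dec_; ¬?; map′; dec-true; decidable-stable)
open import Relation.Unary using (Decidable)
open import Relation.Binary.PropositionalEquality using (_≡_; _≢_; refl; sym; trans; cong; subst)

abstract
  set : ∀ {n} {P : Fin n → Set} → Decidable P → Subset n
  set P? = tabulateV (does ∘ P?)

  ∈set⁺ : ∀ {n} {P : Fin n → Set} (P? : Decidable P) {x} → P x → x ∈ set P?
  ∈set⁺ P? {x} p = lookup⇒[]= x _ (trans (lookup∘tabulate _ x) (dec-true (P? x) p))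

  ∈set⁻ : ∀ {n} {P : Fin n → Set} (P? : Decidable P) {x} → x ∈ set P? → P x
  ∈set⁻ P? {x} p with P? x | trans (sym (lookup∘tabulate (does ∘ P?) x)) ([]=⇒lookup p)
  ... | yes q | _ = q

listOf? : ∀ {n} {P : List (Fin n) → Set} → Decidable P → ∀ k → Dec (∃[ L ] length L ≤ k × P L)
listOf? {n} {P} P? k with P? []
... | yes p = yes ([] , z≤n , p)
listOf? P? zero | no ¬p = no λ { ([] , _ , p) → ¬p p }
listOf? P? (suc k) | no ¬p with any? (λ x → listOf? (λ L → P? (x ∷ L)) k)
... | yes (x , L , l , p) = yes (x ∷ L , s≤s l , p)
... | no ¬q = no λ { ([] , _ , p) → ¬p p ; (x ∷ L , s≤s l , p) → ¬q (x , L , l , p) }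

list? : ∀ {n} {P : List (Fin n) → Set} → Decidable P → ∀ k → (∀ L → P L → length L ≤ k) → Dec (∃ P)
list? P? k bound =
  map′ (λ { (L , _ , p) → L , p }) (λ { (L , p) → L , bound L p , p }) (listOf? P? k)

splitFirst : {A : Set} {Q : A → Set} → Decidable Q → ∀ {x} P → x ∈ₗ P → Q x →
  ∃[ L ] ∃[ z ] ∃[ R ] P ≡ L ++ z ∷ R × Q z × (∀ y → y ∈ₗ L → ¬ Q y)
splitFirst Q? (u ∷ P) m q with Q? u
... | yes qu = [] , u , P , refl , qu , λ _ ()
splitFirst Q? (u ∷ P) (here refl) q | no ¬qu = ⊥-elim (¬qu q)
splitFirst Q? (u ∷ P) (there m) q | no ¬qu with splitFirst Q? P m q
... | L , z , R , refl , qz , none =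
  u ∷ L , z , R , refl , qz , λ { _ (here refl) → ¬qu ; y (there i) → none y i }

splitLast : {A : Set} {Q : A → Set} → Decidable Q → ∀ {x} P → x ∈ₗ P → Q x →
  ∃[ L ] ∃[ z ] ∃[ R ] P ≡ L ++ z ∷ R × Q z × (∀ y → y ∈ₗ R → ¬ Q y)
splitLast Q? (u ∷ P) m q with anyL? Q? P
... | yes an with splitLast Q? P (∈-lookup (index an)) (lookup-index an)
...   | L , z , R , refl , qz , none = u ∷ L , z , R , refl , qz , none
splitLast Q? (u ∷ P) (here refl) q | no ¬an =
  [] , u , P , refl , q , λ y i qy → ¬an (lose i qy)
splitLast Q? (u ∷ P) (there m) q | no ¬an = ⊥-elim (¬an (lose m q))

data Shape {A : Set} (Q : A → Set) : List A → Set where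
  single : ∀ L z R → Q z → (∀ y → y ∈ₗ L → ¬ Q y) → (∀ y → y ∈ₗ R → ¬ Q y) → Shape Q (L ++ z ∷ R)
  double : ∀ L z y R → Q z → Q y → (∀ y → y ∈ₗ L → ¬ Q y) → (∀ y → y ∈ₗ R → ¬ Q y) →
           Shape Q (L ++ z ∷ y ∷ R)
  wide   : ∀ L z m M y R → Q z → Q y → Shape Q (L ++ z ∷ m ∷ M ++ y ∷ R)

shape : {A : Set} {Q : A → Set} → Decidable Q → ∀ {x} P → x ∈ₗ P → Q x → Shape Q P
shape Q? P m q with splitFirst Q? P m q
... | L , z , R , refl , qz , noL with anyL? Q? R
...   | no ¬an = single L z R qz noL (λ y i qy → ¬an (lose i qy))
...   | yes an with splitLast Q? R (∈-lookup (index an)) (lookup-index an)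
...     | [] , y , R' , refl , qy , noR = double L z y R' qz qy noL noR
...     | m' ∷ M , y , R' , refl , qy , noR = wide L z m' M y R' qz qy

snoc⊆ : ∀ {A : Set} L {z R} {t : A} → t ∈ₗ L ++ [ z ] → t ∈ₗ L ++ z ∷ R
snoc⊆ L i with ∈-++⁻ L i
... | inj₁ j = ∈-++⁺ˡ j
... | inj₂ (here refl) = ∈-++⁺ʳ L (here refl)

module _ {n : ℕ} (G : Graph n) where

  E? : ∀ x y → Dec (E G x y)
  E? x y = Graph.adj G x y Bool.≟ true

  E-sym : ∀ {x y} → E G x y → E G y x
  E-sym {x} {y} e = trans (Graph.sym G y x) e

  E-irrefl : ∀ {x} → ¬ E G x x
  E-irrefl {x} e with trans (sym e) (Graph.irrefl G x)
  ... | ()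

  E⇒≢ : ∀ {x y} → E G x y → x ≢ y
  E⇒≢ e refl = E-irrefl e

  data Walk (S : Fin n → Set) : Fin n → Fin n → Set where
    stop : ∀ {x} → S x → Walk S x x
    step : ∀ {x y z} → S x → E G x y → Walk S y z → Walk S x z

  walk-map : ∀ {S S' x y} → (∀ {z} → S z → S' z) → Walk S x y → Walk S' x y
  walk-map f (stop s) = stop (f s)
  walk-map f (step s e w) = step (f s) e (walk-map f w)

  walk-start : ∀ {S x y} → Walk S x y → S x
  walk-start (stop s) = s
  walk-start (step s _ _) = s

  walk-end : ∀ {S x y} → Walk S x y → S y
  walk-end (stop s) = s
  walk-end (step _ _ w) = walk-end w

  infixr 5 _⊕_
  _⊕_ : ∀ {S x y z} → Walk S x y → Walk S y z → Walk S x z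
  stop _ ⊕ w = w
  step s e v ⊕ w = step s e (v ⊕ w)

  snoc : ∀ {S x y z} → Walk S x y → E G y z → S z → Walk S x z
  snoc w e s = w ⊕ step (walk-end w) e (stop s)

  walk-reverse : ∀ {S x y} → Walk S x y → Walk S y x
  walk-reverse (stop s) = stop s
  walk-reverse (step s e w) = snoc (walk-reverse w) (E-sym e) s

  walk-reach : ∀ {S x y z} → Walk S x y → Walk S y z → Walk (Walk S x) y z
  walk-reach v (stop s) = stop v
  walk-reach v (step s e w) = step v e (walk-reach (snoc v e (walk-start w)) w)

  Far : Fin n → Fin n → Set
  Far x y = x ≢ y × ¬ E G x y

  far-sym : ∀ {x y} → Far x y → Far y x
  far-sym (p , q) = p ∘ sym , q ∘ E-sym

  data IP : Fin n → Fin n → List (Fin n) → Set where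
    one  : ∀ {x} → IP x x (x ∷ [])
    more : ∀ {x y z Q} → E G x y → All (Far x) Q → IP y z (y ∷ Q) → IP x z (x ∷ y ∷ Q)

  ip-head : ∀ {x z y Q} → IP x z (y ∷ Q) → y ≡ x
  ip-head one = refl
  ip-head (more _ _ _) = refl

  ip-first : ∀ {x z P} → IP x z P → ∃[ Q ] P ≡ x ∷ Q
  ip-first one = [] , refl
  ip-first (more _ _ _) = _ , refl

  ip-last : ∀ {x z P} → IP x z P → ∃[ R ] P ≡ R ++ [ z ]
  ip-last one = [] , refl
  ip-last (more {x = x} _ _ p) with ip-last p
  ... | R , eq = x ∷ R , cong (x ∷_) eq

  ip-first∈ : ∀ {x z P} → IP x z P → x ∈ₗ P
  ip-first∈ one = here refl
  ip-first∈ (more _ _ _) = here refl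

  ip-last∈ : ∀ {x z P} → IP x z P → z ∈ₗ P
  ip-last∈ one = here refl
  ip-last∈ (more _ _ p) = there (ip-last∈ p)

  ip-walk : ∀ {x z P} → IP x z P → Walk (_∈ₗ P) x z
  ip-walk one = stop (here refl)
  ip-walk (more e _ p) = step (here refl) e (walk-map there (ip-walk p))

  ip-++ : ∀ {x y y' z P Q} → IP x y P → IP y' z Q → E G y y' →
    (∀ {p q} → p ∈ₗ P → q ∈ₗ Q → p ≢ q × (E G p q → p ≡ y × q ≡ y')) → IP x z (P ++ Q)
  ip-++ {Q = []} p () e f
  ip-++ {Q = u ∷ Q} one q e f with ip-head q
  ... | refl = more e (tabulate λ {t} i → far i) q
    where
      far : ∀ {t} → t ∈ₗ Q → Far _ t
      far {t} i = proj₁ (f (here refl) (there i)) , λ e' → no-loop q i (proj₂ (proj₂ (f (here refl) (there i)) e'))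
        where
          no-loop : ∀ {u z Q} → IP u z (u ∷ Q) → t ∈ₗ Q → t ≢ u
          no-loop (more e a _) (here refl) refl = E-irrefl e
          no-loop (more e a _) (there i) refl = proj₁ (lookupAll a i) refl
  ip-++ {Q = Q@(_ ∷ _)} (more {Q = P} e a p) q e' f =
    more e (tabulate far) (ip-++ p q e' (λ i j → f (there i) j))
    where
      x≢y : ∀ {y z P} → IP y z (y ∷ P) → E G _ y → All (Far _) P → _ ≢ z
      x≢y one e a = E⇒≢ e
      x≢y p@(more _ _ _) e a refl with ip-last∈ p
      ... | here refl = E-irrefl e
      ... | there i = proj₁ (lookupAll a i) refl
      far : ∀ {t} → t ∈ₗ P ++ Q → Far _ t
      far i with ∈-++⁻ P i
      ... | inj₁ j = lookupAll a j
      ... | inj₂ j = proj₁ (f (here refl) j) , λ e'' → x≢y p e a (proj₁ (proj₂ (f (here refl) j) e''))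

  ip-reverse : ∀ {x z P} → IP x z P → IP z x (reverse P)
  ip-reverse one = one
  ip-reverse (more {x = x} {y} {Q = Q} e a p) =
    subst (IP _ x) (sym (unfold-reverse x (y ∷ Q))) (ip-++ (ip-reverse p) one (E-sym e) f)
    where
      f : ∀ {s t} → s ∈ₗ reverse (y ∷ Q) → t ∈ₗ [ x ] → s ≢ t × (E G s t → s ≡ y × t ≡ x)
      f i (here refl) with reverse⁻ {xs = y ∷ Q} i
      ... | here refl = (λ { refl → E-irrefl e }) , λ _ → refl , refl
      ... | there j = (λ { refl → proj₁ (lookupAll a j) refl }) , λ e' → ⊥-elim (proj₂ (lookupAll a j) (E-sym e'))

  ip-suffix : ∀ {x z} L {m R} → IP x z (L ++ m ∷ R) → IP m z (m ∷ R)
  ip-suffix [] p with ip-head p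
  ... | refl = p
  ip-suffix (_ ∷ []) (more _ _ p) = p
  ip-suffix (_ ∷ L@(_ ∷ _)) (more _ _ p) = ip-suffix L p

  ip-prefix : ∀ {x z} L {m R} → IP x z (L ++ m ∷ R) → IP x m (L ++ [ m ])
  ip-prefix [] p with ip-head p
  ... | refl = one
  ip-prefix (_ ∷ []) (more e a p) = more e [] one
  ip-prefix (_ ∷ L@(_ ∷ L')) {m} {R} (more e a p) = more e (tabulate far) (ip-prefix L p)
    where
      far : ∀ {t} → t ∈ₗ L' ++ [ m ] → Far _ t
      far i with ∈-++⁻ L' i
      ... | inj₁ j = lookupAll a (∈-++⁺ˡ j)
      ... | inj₂ (here refl) = lookupAll a (∈-++⁺ʳ L' (here refl))

  ip-distinct : ∀ {x z} L {R p q} → IP x z (L ++ R) → p ∈ₗ L → q ∈ₗ R → p ≢ q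
  ip-distinct (_ ∷ []) (more e a _) (here refl) (here refl) refl = E-irrefl e
  ip-distinct (_ ∷ []) (more e a _) (here refl) (there i) refl = proj₁ (lookupAll a i) refl
  ip-distinct (_ ∷ u ∷ L) (more e a _) (here refl) j refl = proj₁ (lookupAll a (∈-++⁺ʳ L j)) refl
  ip-distinct (_ ∷ L@(_ ∷ _)) (more e a p) (there i) j = ip-distinct L p i j

  ip-far : ∀ {x z} L {m R p q} → IP x z (L ++ m ∷ R) → p ∈ₗ L → q ∈ₗ R → Far p q
  ip-far (_ ∷ []) (more e a _) (here refl) j = lookupAll a j
  ip-far (_ ∷ u ∷ L) (more e a _) (here refl) j = lookupAll a (∈-++⁺ʳ L (there j))
  ip-far (_ ∷ L@(_ ∷ _)) (more e a p) (there i) j = ip-far L p i j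

  ip-adjacent : ∀ {x z} L {y y' R} → IP x z (L ++ y ∷ y' ∷ R) → E G y y'
  ip-adjacent L p with ip-suffix L p
  ... | more e _ _ = e

  ip-connected : ∀ {x z P} → IP x z P → ∀ {s t} → s ∈ₗ P → t ∈ₗ P → Walk (_∈ₗ P) s t
  ip-connected {x} {P = P} p i j = walk-reverse (from-x i) ⊕ from-x j
    where
      from-x : ∀ {s} → s ∈ₗ P → Walk (_∈ₗ P) x s
      from-x i with ∈-∃++ i
      ... | L , R , refl = walk-map (snoc⊆ L) (ip-walk (ip-prefix L p))

  walk⇒ip : ∀ {S x y} → Walk S x y → ∃[ P ] IP x y P × (∀ {z} → z ∈ₗ P → S z)
  walk⇒ip (stop s) = [ _ ] , one , λ { (here refl) → s }
  walk⇒ip {S} (step {x} {x'} s e w) with walk⇒ip w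
  ... | P , p , inS with anyL? (x ≟_) P
  ...   | yes x∈P with ∈-∃++ x∈P
  ...     | L , R , refl = x ∷ R , ip-suffix L p , λ i → inS (∈-++⁺ʳ L i)
  walk⇒ip {S} (step {x} {x'} s e w) | P , p , inS | no x∉P with splitLast (E? x) P (ip-first∈ p) e
  ... | L , u , R , refl , xu , none =
    x ∷ u ∷ R ,
    more xu (tabulate λ {t} i → (λ { refl → x∉P (∈-++⁺ʳ L (there i)) }) , none t i) (ip-suffix L p) ,
    λ { (here refl) → s ; (there i) → inS (∈-++⁺ʳ L i) }

  ip⇒IsPath : ∀ {x z P} → IP x z P → IsPath G P
  ip⇒IsPath p = record { nonempty = ne p ; distinct = di p ; induced = ind p }
    where
      ne : ∀ {x z P} → IP x z P → 1 ≤ length P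
      ne one = s≤s z≤n
      ne (more _ _ _) = s≤s z≤n
      fd : ∀ {x y z Q} → E G x y → All (Far x) Q → IP y z (y ∷ Q) → ∀ j → x ≢ lookup (y ∷ Q) j
      fd e a p zero refl = E-irrefl e
      fd e a p (suc j) refl = proj₁ (lookupAll a (∈-lookup j)) refl
      di : ∀ {x z P} → IP x z P → ∀ i j → lookup P i ≡ lookup P j → i ≡ j
      di one zero zero _ = refl
      di (more e a p) zero zero _ = refl
      di (more e a p) zero (suc j) eq = ⊥-elim (fd e a p j eq)
      di (more e a p) (suc i) zero eq = ⊥-elim (fd e a p i (sym eq))
      di (more e a p) (suc i) (suc j) eq = cong suc (di p i j eq)
      ind : ∀ {x z P} → IP x z P → ∀ i j →
            E G (lookup P i) (lookup P j) ⇔ (toℕ j ≡ suc (toℕ i) ⊎ toℕ i ≡ suc (toℕ j))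
      ind one zero zero = mk⇔ (⊥-elim ∘ E-irrefl) λ { (inj₁ ()) ; (inj₂ ()) }
      ind (more e a p) zero zero = mk⇔ (⊥-elim ∘ E-irrefl) λ { (inj₁ ()) ; (inj₂ ()) }
      ind (more e a p) zero (suc zero) = mk⇔ (λ _ → inj₁ refl) (λ _ → e)
      ind (more e a p) (suc zero) zero = mk⇔ (λ _ → inj₂ refl) (λ _ → E-sym e)
      ind (more e a p) zero (suc (suc j)) =
        mk⇔ (⊥-elim ∘ proj₂ (lookupAll a (∈-lookup j))) λ { (inj₁ ()) ; (inj₂ ()) }
      ind (more e a p) (suc (suc j)) zero =
        mk⇔ (⊥-elim ∘ proj₂ (lookupAll a (∈-lookup j)) ∘ E-sym) λ { (inj₁ ()) ; (inj₂ ()) }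
      ind (more e a p) (suc i) (suc j) =
        mk⇔ (λ e' → [ inj₁ ∘ cong suc , inj₂ ∘ cong suc ]′ (Equivalence.to (ind p i j) e'))
            (λ { (inj₁ q) → Equivalence.from (ind p i j) (inj₁ (ℕ.suc-injective q))
               ; (inj₂ q) → Equivalence.from (ind p i j) (inj₂ (ℕ.suc-injective q)) })

  ip⇒PathFT : ∀ {x z P} → IP x z P → PathFT G P x z
  ip⇒PathFT p = ip⇒IsPath p , ip-first p , ip-last p

  IsPath⇒ip : ∀ {x P} → IsPath G (x ∷ P) → ∃[ z ] IP x z (x ∷ P)
  IsPath⇒ip {x} {[]} p = x , one
  IsPath⇒ip {x} {y ∷ P} p with IsPath⇒ip {y} {P} (record
      { nonempty = s≤s z≤n
      ; distinct = λ i j eq → suc-inj (distinct (suc i) (suc j) eq)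
      ; induced = λ i j → mk⇔
          (λ e → [ inj₁ ∘ ℕ.suc-injective , inj₂ ∘ ℕ.suc-injective ]′
                   (Equivalence.to (induced (suc i) (suc j)) e))
          (λ s → Equivalence.from (induced (suc i) (suc j))
                   ([ inj₁ ∘ cong suc , inj₂ ∘ cong suc ]′ s)) })
    where
      open IsPath p
      suc-inj : ∀ {k} {i j : Fin k} → Fin.suc i ≡ suc j → i ≡ j
      suc-inj refl = refl
  ... | z , q = z , more (Equivalence.from (induced zero (suc zero)) (inj₁ refl)) (tabulate far) q
    where
      open IsPath p
      far : ∀ {t} → t ∈ₗ P → Far x t
      far {t} i = (λ eq → 0≢s (distinct zero (suc (suc (index i))) (trans eq (lookup-index i))))
                , (λ e → bad (Equivalence.to (induced zero (suc (suc (index i))))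
                                (subst (E G x) (lookup-index i) e)))
        where
          0≢s : ∀ {k} {j : Fin k} → Fin.zero ≢ suc j
          0≢s ()
          bad : suc (suc (toℕ (index i))) ≡ 1 ⊎ 0 ≡ suc (suc (suc (toℕ (index i)))) → ⊥
          bad (inj₁ ())
          bad (inj₂ ())

  PathFT⇒ip : ∀ {x y P} → PathFT G P x y → IP x y P
  PathFT⇒ip {x} {y} (p , (Q , refl) , (R , eq)) with IsPath⇒ip p
  ... | z , q with ip-last q
  ...   | R' , eq' with last-unique R R' (trans (sym eq) eq')
    where
      last-unique : ∀ (R R' : List (Fin n)) {y z} → R ++ [ y ] ≡ R' ++ [ z ] → y ≡ z
      last-unique [] [] refl = refl
      last-unique [] (_ ∷ []) ()
      last-unique [] (_ ∷ _ ∷ _) ()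
      last-unique (_ ∷ []) [] ()
      last-unique (_ ∷ _ ∷ _) [] ()
      last-unique (_ ∷ R) (_ ∷ R') eq = last-unique R R' (proj₂ (∷-injective eq))
  ...     | refl = q

  ip-length : ∀ {x z P} → IP x z P → length P ≤ n
  ip-length {P = P} p = injective⇒≤ {f = lookup P} (λ {i} {j} → IsPath.distinct (ip⇒IsPath p) i j)

triple : {A : Set} → A → A → A → Fin 3 → A
triple x y z zero = x
triple x y z (suc zero) = y
triple x y z (suc (suc zero)) = z

each : {P : Fin 3 → Set} → P zero → P (suc zero) → P (suc (suc zero)) → ∀ i → P i
each x y z zero = x
each x y z (suc zero) = y
each x y z (suc (suc zero)) = z

eachPair : {P : Fin 3 → Fin 3 → Set} → (∀ {i j} → P i j → P j i) →
  P zero (suc zero) → P zero (suc (suc zero)) → P (suc zero) (suc (suc zero)) →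
  ∀ i j → i ≢ j → P i j
eachPair s p q r zero zero ne = ⊥-elim (ne refl)
eachPair s p q r (suc zero) (suc zero) ne = ⊥-elim (ne refl)
eachPair s p q r (suc (suc zero)) (suc (suc zero)) ne = ⊥-elim (ne refl)
eachPair s p q r zero (suc zero) ne = p
eachPair s p q r zero (suc (suc zero)) ne = q
eachPair s p q r (suc zero) (suc (suc zero)) ne = r
eachPair s p q r (suc zero) zero ne = s p
eachPair s p q r (suc (suc zero)) zero ne = s q
eachPair s p q r (suc (suc zero)) (suc zero) ne = s r

module _ {n : ℕ} (G : Graph n) where

  Anti : (Fin n → Set) → (Fin n → Set) → Set
  Anti S S' = ∀ {x y} → S x → S' y → Far G x y

  no-theta : ThetaFree G → ∀ {s t} → Far G s t → (A B C : Fin n → Set) →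
    Anti A B → Anti A C → Anti B C →
    Walk G (λ z → A z ⊎ z ≡ s ⊎ z ≡ t) s t →
    Walk G (λ z → B z ⊎ z ≡ s ⊎ z ≡ t) s t →
    Walk G (λ z → C z ⊎ z ≡ s ⊎ z ≡ t) s t → ⊥
  no-theta tf {s} {t} (s≢t , s≁t) A B C AB AC BC wA wB wC
    with walk⇒ip G wA | walk⇒ip G wB | walk⇒ip G wC
  ... | PA , pA , inA | PB , pB , inB | PC , pC , inC =
    tf s t (triple PA PB PC)
      ( s≁t
      , each (ip⇒PathFT G pA , long pA) (ip⇒PathFT G pB , long pB) (ip⇒PathFT G pC , long pC)
      , eachPair (λ f z i j → f z j i)
          (λ z i j → proj₁ (AB (int inA i) (int inB j)) refl)
          (λ z i j → proj₁ (AC (int inA i) (int inC j)) refl)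
          (λ z i j → proj₁ (BC (int inB i) (int inC j)) refl)
      , eachPair (λ f z w i j e → f w z j i (E-sym G e))
          (λ z w i j → proj₂ (AB (int inA i) (int inB j)))
          (λ z w i j → proj₂ (AC (int inA i) (int inC j)))
          (λ z w i j → proj₂ (BC (int inB i) (int inC j))))
    where
      long : ∀ {P} → IP G s t P → 3 ≤ length P
      long one = ⊥-elim (s≢t refl)
      long (more e _ one) = ⊥-elim (s≁t e)
      long (more _ _ (more _ _ _)) = s≤s (s≤s (s≤s z≤n))
      int : ∀ {P} {S : Fin n → Set} → (∀ {z} → z ∈ₗ P → S z ⊎ z ≡ s ⊎ z ≡ t) →
            ∀ {z} → Interior G P s t z → S z
      int f (i , z≢s , z≢t) with f i
      ... | inj₁ q = q
      ... | inj₂ (inj₁ eq) = ⊥-elim (z≢s eq)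
      ... | inj₂ (inj₂ eq) = ⊥-elim (z≢t eq)

  Link : (S S' : Fin n → Set) (a b a' b' : Fin n) → Set
  Link S S' a b a' b' =
    ∀ {x y} → S x → S' y → x ≢ y × (E G x y → (x ≡ a × y ≡ a') ⊎ (x ≡ b × y ≡ b'))

  no-prism : PrismFree G → ∀ {a₁ a₂ a₃ b₁ b₂ b₃} (A B C : Fin n → Set) →
    E G a₁ a₂ → E G a₁ a₃ → E G a₂ a₃ → E G b₁ b₂ → E G b₁ b₃ → E G b₂ b₃ →
    a₁ ≢ b₁ → a₂ ≢ b₂ → a₃ ≢ b₃ →
    Walk G A a₁ b₁ → Walk G B a₂ b₂ → Walk G C a₃ b₃ →
    Link A B a₁ b₁ a₂ b₂ → Link A C a₁ b₁ a₃ b₃ → Link B C a₂ b₂ a₃ b₃ → ⊥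
  no-prism pf {a₁} {a₂} {a₃} {b₁} {b₂} {b₃} A B C aa₁₂ aa₁₃ aa₂₃ bb₁₂ bb₁₃ bb₂₃ n₁ n₂ n₃ wA wB wC AB AC BC
    with walk⇒ip G wA | walk⇒ip G wB | walk⇒ip G wC
  ... | PA , pA , inA | PB , pB , inB | PC , pC , inC =
    pf (triple a₁ a₂ a₃) (triple b₁ b₂ b₃) (triple PA PB PC)
      ( eachPair (E-sym G) aa₁₂ aa₁₃ aa₂₃
      , eachPair (E-sym G) bb₁₂ bb₁₃ bb₂₃
      , each (each n₁ (proj₁ (AB a₁∈ b₂∈)) (proj₁ (AC a₁∈ b₃∈)))
             (each (proj₁ (AB b₁∈ a₂∈) ∘ sym) n₂ (proj₁ (BC a₂∈ b₃∈)))
             (each (proj₁ (AC b₁∈ a₃∈) ∘ sym) (proj₁ (BC b₂∈ a₃∈) ∘ sym) n₃)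
      , each (ip⇒PathFT G pA) (ip⇒PathFT G pB) (ip⇒PathFT G pC)
      , eachPair (λ f z i j → f z j i)
          (λ z i j → proj₁ (AB (inA i) (inB j)) refl)
          (λ z i j → proj₁ (AC (inA i) (inC j)) refl)
          (λ z i j → proj₁ (BC (inB i) (inC j)) refl)
      , eachPair (λ f x y i j e → swap' (f y x j i (E-sym G e)))
          (λ x y i j → proj₂ (AB (inA i) (inB j)))
          (λ x y i j → proj₂ (AC (inA i) (inC j)))
          (λ x y i j → proj₂ (BC (inB i) (inC j))))
    where
      a₁∈ = walk-start G wA
      a₂∈ = walk-start G wB
      a₃∈ = walk-start G wC
      b₁∈ = walk-end G wA
      b₂∈ = walk-end G wB
      b₃∈ = walk-end G wC
      swap' : ∀ {P Q R S : Set} → (P × Q) ⊎ (R × S) → (Q × P) ⊎ (S × R)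
      swap' (inj₁ (p , q)) = inj₁ (q , p)
      swap' (inj₂ (p , q)) = inj₂ (q , p)

module Pyramids {n : ℕ} (G : Graph n) (tf : ThetaFree G) (pf : PrismFree G) (a : Fin n) where

  private
    _~_ : Fin n → Fin n → Set
    _~_ = E G

  Cross : List (Fin n) → Fin n → List (Fin n) → Fin n → Set
  Cross Γ b Γ' b' = ∀ {x y} → x ∈ₗ Γ → y ∈ₗ Γ' → x ≢ y × (x ~ y → x ≡ b × y ≡ b')

  -- Γᵢ is the path to bᵢ without its first vertex, the apex a; by abᵢ, that path has length at least two.
  record Pyr (Γ₁ Γ₂ Γ₃ : List (Fin n)) (b₁ b₂ b₃ : Fin n) : Set where
    field
      ip₁ : IP G a b₁ (a ∷ Γ₁)
      ip₂ : IP G a b₂ (a ∷ Γ₂)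
      ip₃ : IP G a b₃ (a ∷ Γ₃)
      X₁₂ : Cross Γ₁ b₁ Γ₂ b₂
      X₁₃ : Cross Γ₁ b₁ Γ₃ b₃
      X₂₃ : Cross Γ₂ b₂ Γ₃ b₃
      bb₁₂ : b₁ ~ b₂
      bb₁₃ : b₁ ~ b₃
      bb₂₃ : b₂ ~ b₃
      ab₁ : Far G a b₁
      ab₂ : Far G a b₂
      ab₃ : Far G a b₃

  cross-sym : ∀ {Γ b Γ' b'} → Cross Γ b Γ' b' → Cross Γ' b' Γ b
  cross-sym X i j with X j i
  ... | ne , h = ne ∘ sym , λ e → let p , q = h (E-sym G e) in q , p

  pyr-swap₁₂ : ∀ {Γ₁ Γ₂ Γ₃ b₁ b₂ b₃} → Pyr Γ₁ Γ₂ Γ₃ b₁ b₂ b₃ → Pyr Γ₂ Γ₁ Γ₃ b₂ b₁ b₃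
  pyr-swap₁₂ p = record
    { ip₁ = ip₂ ; ip₂ = ip₁ ; ip₃ = ip₃ ; X₁₂ = cross-sym X₁₂ ; X₁₃ = X₂₃ ; X₂₃ = X₁₃
    ; bb₁₂ = E-sym G bb₁₂ ; bb₁₃ = bb₂₃ ; bb₂₃ = bb₁₃ ; ab₁ = ab₂ ; ab₂ = ab₁ ; ab₃ = ab₃ }
    where open Pyr p

  up : ∀ {b} L {z R} s → IP G a b (a ∷ L ++ z ∷ R) → Walk G (λ t → t ∈ₗ L ++ [ z ] ⊎ t ≡ s ⊎ t ≡ a) z a
  up L s p = walk-map G (λ { (here eq) → inj₂ (inj₂ eq) ; (there i) → inj₁ i })
               (walk-reverse G (ip-walk G (ip-prefix G (a ∷ L) p)))

  up≢b : ∀ {b} L {z R t} → IP G a b (a ∷ L ++ z ∷ R) → z ≢ b → t ∈ₗ L ++ [ z ] → t ≢ b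
  up≢b L {z} p ne i with ∈-++⁻ L i
  ... | inj₁ j = ip-distinct G (a ∷ L) p (there j) (ip-last∈ G (ip-suffix G (a ∷ L) p))
  ... | inj₂ (here refl) = ne

  down : ∀ {b} L {z R} → IP G a b (a ∷ L ++ z ∷ R) → Walk G (_∈ₗ z ∷ R) z b
  down L p = ip-walk G (ip-suffix G (a ∷ L) p)

  record Link₁₂ (Γ₁ Γ₂ Γ₃ : List (Fin n)) (D : Fin n → Set) (q r : Fin n) : Set where
    field
      walk : Walk G D q r
      Da  : ∀ {d} → D d → Far G d a
      D₁  : ∀ {d z} → D d → z ∈ₗ Γ₁ → d ≢ z
      D₂  : ∀ {d z} → D d → z ∈ₗ Γ₂ → d ≢ z
      D₃  : ∀ {d z} → D d → z ∈ₗ Γ₃ → d ≢ z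
      Na  : ∀ {d z} → D d → d ~ z → ¬ a ~ z
      c₁  : ∀ {d z} → D d → z ∈ₗ Γ₁ → d ~ z → d ≡ q
      c₂  : ∀ {d z} → D d → z ∈ₗ Γ₂ → d ~ z → d ≡ r
      c₃  : ∀ {d z} → D d → z ∈ₗ Γ₃ → ¬ d ~ z

  link-swap : ∀ {Γ₁ Γ₂ Γ₃ D q r} → Link₁₂ Γ₁ Γ₂ Γ₃ D q r → Link₁₂ Γ₂ Γ₁ Γ₃ D r q
  link-swap l = record
    { walk = walk-reverse G walk ; Da = Da ; D₁ = D₂ ; D₂ = D₁ ; D₃ = D₃ ; Na = Na ; c₁ = c₂ ; c₂ = c₁ ; c₃ = c₃ }
    where open Link₁₂ l

  EndsIn : List (Fin n) → Fin n → Fin n → Set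
  EndsIn Γ b q = ∃[ L ] ∃[ z ] Γ ≡ L ++ z ∷ b ∷ [] × q ~ z × q ~ b × (∀ t → t ∈ₗ L → ¬ q ~ t)

  private
   module Half {Γ₁ Γ₂ Γ₃ b₁ b₂ b₃} (π : Pyr Γ₁ Γ₂ Γ₃ b₁ b₂ b₃) {D q r} (l : Link₁₂ Γ₁ Γ₂ Γ₃ D q r) where
    open Pyr π
    open Link₁₂ l

    infixr 5 _⊕′_
    _⊕′_ : ∀ {S x y z} → Walk G S x y → Walk G S y z → Walk G S x z
    _⊕′_ = _⊕_ G

    q∈D : D q
    q∈D = walk-start G walk

    r∈D : D r
    r∈D = walk-end G walk

    module _ {y} (L₂ R₂ : List (Fin n)) (eq₂ : Γ₂ ≡ L₂ ++ y ∷ R₂) (y≢b : y ≢ b₂) (ry : r ~ y) where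

      p₂ : IP G a b₂ (a ∷ L₂ ++ y ∷ R₂)
      p₂ = subst (λ Γ → IP G a b₂ (a ∷ Γ)) eq₂ ip₂

      u∈Γ₂ : ∀ {u} → u ∈ₗ L₂ ++ [ y ] → u ∈ₗ Γ₂
      u∈Γ₂ i = subst (_ ∈ₗ_) (sym eq₂) (snoc⊆ L₂ i)

      d∈Γ₂ : ∀ {u} → u ∈ₗ y ∷ R₂ → u ∈ₗ Γ₂
      d∈Γ₂ i = subst (_ ∈ₗ_) (sym eq₂) (∈-++⁺ʳ L₂ i)

      u≢b₂ : ∀ {u} → u ∈ₗ L₂ ++ [ y ] → u ≢ b₂
      u≢b₂ = up≢b L₂ p₂ y≢b

      far₁ : ∀ {t u} → t ∈ₗ Γ₁ → u ∈ₗ L₂ ++ [ y ] → Far G t u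
      far₁ i j with X₁₂ i (u∈Γ₂ j)
      ... | ne , h = ne , λ e → u≢b₂ j (proj₂ (h e))

      far₃ : ∀ {t u} → t ∈ₗ Γ₃ → u ∈ₗ L₂ ++ [ y ] → Far G u t
      far₃ i j with X₂₃ (u∈Γ₂ j) i
      ... | ne , h = ne , λ e → u≢b₂ j (proj₁ (h e))

      farD₃ : ∀ {t d} → t ∈ₗ Γ₃ → D d → Far G d t
      farD₃ i dd = D₃ dd i , c₃ dd i

      a≁down : ∀ {u} → u ∈ₗ y ∷ R₂ → Far G a u
      a≁down = helper L₂ p₂
        where
          helper : ∀ L → IP G a b₂ (a ∷ L ++ y ∷ R₂) → ∀ {u} → u ∈ₗ y ∷ R₂ → Far G a u
          helper [] p = ⊥-elim (Na r∈D ry (ip-adjacent G [] p))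
          helper (_ ∷ L) p i = ip-far G [ a ] p (here refl) (∈-++⁺ʳ L i)

      to-b₃ : Walk G (_∈ₗ a ∷ Γ₃) a b₃
      to-b₃ = ip-walk G ip₃

      single⊥ : ∀ L z R → Γ₁ ≡ L ++ z ∷ R → q ~ z → z ≢ b₁ →
        (∀ t → t ∈ₗ L → ¬ q ~ t) → (∀ t → t ∈ₗ R → ¬ q ~ t) → ⊥
      single⊥ L z R refl qz z≢b noL noR =
        no-theta G tf (ip-distinct G [ a ] ip₁ (here refl) (∈-++⁺ʳ L (here refl)) ∘ sym , Na q∈D qz ∘ E-sym G)
          (_∈ₗ L) (λ t → D t ⊎ t ∈ₗ L₂ ++ [ y ]) (λ t → t ∈ₗ R ⊎ t ∈ₗ Γ₃) AB AC BC
          (walk-map G (λ { (inj₁ i) → [ inj₁ , (λ { (here eq) → inj₂ (inj₁ eq) }) ]′ (∈-++⁻ L i) ; (inj₂ s) → inj₂ s })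
            (up L z ip₁))
          (step (inj₂ (inj₁ refl)) (E-sym G qz)
            (walk-map G (inj₁ ∘ inj₁) walk ⊕′
             step (inj₁ (inj₁ r∈D)) ry (walk-map G (λ { (inj₁ i) → inj₁ (inj₂ i) ; (inj₂ s) → inj₂ s }) (up L₂ z p₂))))
          (walk-map G (λ { (here eq) → inj₂ (inj₁ eq) ; (there i) → inj₁ (inj₁ i) }) (down L ip₁) ⊕′
           step (b₁∈ (ip-last∈ G (ip-suffix G (a ∷ L) ip₁))) bb₁₃
             (walk-map G (λ { (here eq) → inj₂ (inj₂ eq) ; (there i) → inj₁ (inj₂ i) }) (walk-reverse G to-b₃)))
        where
          b₁∈ : ∀ {s} → s ∈ₗ z ∷ R → (s ∈ₗ R ⊎ s ∈ₗ Γ₃) ⊎ s ≡ z ⊎ s ≡ a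
          b₁∈ (here eq) = inj₂ (inj₁ eq)
          b₁∈ (there i) = inj₁ (inj₁ i)
          noD : ∀ {d t} → D d → t ∈ₗ L ⊎ t ∈ₗ R → Far G d t
          noD dd (inj₁ i) = D₁ dd (∈-++⁺ˡ i) , λ e → noL _ i (subst (_~ _) (c₁ dd (∈-++⁺ˡ i) e) e)
          noD dd (inj₂ i) = D₁ dd i' , λ e → noR _ i (subst (_~ _) (c₁ dd i' e) e)
            where i' = ∈-++⁺ʳ L (there i)
          AB : Anti G (_∈ₗ L) (λ t → D t ⊎ t ∈ₗ L₂ ++ [ y ])
          AB i (inj₁ d) = far-sym G (noD d (inj₁ i))
          AB i (inj₂ j) = far₁ (∈-++⁺ˡ i) j
          AC : Anti G (_∈ₗ L) (λ t → t ∈ₗ R ⊎ t ∈ₗ Γ₃)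
          AC i (inj₁ j) = ip-far G (a ∷ L) ip₁ (there i) j
          AC i (inj₂ j) with X₁₃ (∈-++⁺ˡ i) j
          ... | ne , h = ne , λ e → up≢b L ip₁ z≢b (∈-++⁺ˡ i) (proj₁ (h e))
          BC : Anti G (λ t → D t ⊎ t ∈ₗ L₂ ++ [ y ]) (λ t → t ∈ₗ R ⊎ t ∈ₗ Γ₃)
          BC (inj₁ d) (inj₁ j) = noD d (inj₂ j)
          BC (inj₁ d) (inj₂ j) = farD₃ j d
          BC (inj₂ i) (inj₁ j) = far-sym G (far₁ (∈-++⁺ʳ L (there j)) i)
          BC (inj₂ i) (inj₂ j) = far₃ j i

      wide⊥ : ∀ L z m M y' R → Γ₁ ≡ L ++ z ∷ m ∷ M ++ y' ∷ R → q ~ z → q ~ y' → ⊥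
      wide⊥ L z m M y' R refl qz qy' =
        no-theta G tf (Da q∈D)
          (_∈ₗ L ++ [ z ]) (λ t → (D t × t ≢ q) ⊎ t ∈ₗ L₂ ++ [ y ]) (λ t → t ∈ₗ y' ∷ R ⊎ t ∈ₗ Γ₃) AB AC BC
          (step (inj₂ (inj₁ refl)) qz (up L q ip₁))
          (walk-map G inD walk ⊕′
             step (inD r∈D) ry (walk-map G (λ { (inj₁ i) → inj₁ (inj₂ i) ; (inj₂ s) → inj₂ s }) (up L₂ q p₂)))
          (step (inj₂ (inj₁ refl)) qy'
            (walk-map G (inj₁ ∘ inj₁) (ip-walk G y'R) ⊕′
             step (inj₁ (inj₁ (ip-last∈ G y'R))) bb₁₃
             (walk-map G (λ { (here eq) → inj₂ (inj₂ eq) ; (there i) → inj₁ (inj₂ i) }) (walk-reverse G to-b₃))))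
        where
          inD : ∀ {d} → D d → ((D d × d ≢ q) ⊎ d ∈ₗ L₂ ++ [ y ]) ⊎ d ≡ q ⊎ d ≡ a
          inD {d} dd with d ≟ q
          ... | yes eq = inj₂ (inj₁ eq)
          ... | no ne = inj₁ (inj₁ (dd , ne))
          zs : IP G z b₁ (z ∷ m ∷ M ++ y' ∷ R)
          zs = ip-suffix G (a ∷ L) ip₁
          y'R : IP G y' b₁ (y' ∷ R)
          y'R = ip-suffix G (z ∷ m ∷ M) zs
          z≢b : z ≢ b₁
          z≢b = ip-distinct G [ z ] zs (here refl) (∈-++⁺ʳ (m ∷ M) (ip-last∈ G y'R))
          C⊆ : ∀ {t} → t ∈ₗ y' ∷ R → t ∈ₗ L ++ z ∷ m ∷ M ++ y' ∷ R
          C⊆ i = ∈-++⁺ʳ L (there (∈-++⁺ʳ (m ∷ M) i))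
          AB : Anti G (_∈ₗ L ++ [ z ]) (λ t → (D t × t ≢ q) ⊎ t ∈ₗ L₂ ++ [ y ])
          AB i (inj₁ (dd , ne)) = D₁ dd (snoc⊆ L i) ∘ sym , λ e → ne (c₁ dd (snoc⊆ L i) (E-sym G e))
          AB i (inj₂ j) = far₁ (snoc⊆ L i) j
          AC : Anti G (_∈ₗ L ++ [ z ]) (λ t → t ∈ₗ y' ∷ R ⊎ t ∈ₗ Γ₃)
          AC i (inj₁ j) with ∈-++⁻ L i
          ... | inj₁ k = ip-far G (a ∷ L) ip₁ (there k) (∈-++⁺ʳ (m ∷ M) j)
          ... | inj₂ (here refl) = ip-far G [ z ] zs (here refl) (∈-++⁺ʳ M j)
          AC i (inj₂ j) with X₁₃ (snoc⊆ L i) j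
          ... | ne , h = ne , λ e → up≢b L ip₁ z≢b i (proj₁ (h e))
          BC : Anti G (λ t → (D t × t ≢ q) ⊎ t ∈ₗ L₂ ++ [ y ]) (λ t → t ∈ₗ y' ∷ R ⊎ t ∈ₗ Γ₃)
          BC (inj₁ (dd , ne)) (inj₁ j) = D₁ dd (C⊆ j) , λ e → ne (c₁ dd (C⊆ j) e)
          BC (inj₁ (dd , ne)) (inj₂ j) = farD₃ j dd
          BC (inj₂ i) (inj₁ j) = far-sym G (far₁ (C⊆ j) i)
          BC (inj₂ i) (inj₂ j) = far₃ j i

      double⊥ : ∀ L z y' R → Γ₁ ≡ L ++ z ∷ y' ∷ R → q ~ z → q ~ y' → y' ≢ b₁ →
        (∀ t → t ∈ₗ L → ¬ q ~ t) → (∀ t → t ∈ₗ R → ¬ q ~ t) → ⊥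
      double⊥ L z y' R refl qz qy' y'≢b noL noR =
        no-prism G pf (λ t → D t ⊎ t ∈ₗ y ∷ R₂) (_∈ₗ y' ∷ R) (λ t → t ∈ₗ L ++ [ z ] ⊎ t ∈ₗ a ∷ Γ₃)
          qy' qz (E-sym G (ip-adjacent G (a ∷ L) ip₁)) (E-sym G bb₁₂) bb₂₃ bb₁₃
          (D₂ q∈D (d∈Γ₂ (ip-last∈ G (ip-suffix G (a ∷ L₂) p₂)))) y'≢b
          (proj₁ (X₁₃ (snoc⊆ L (∈-++⁺ʳ L (here refl))) b₃∈))
          (walk-map G inj₁ walk ⊕′ step (inj₁ r∈D) ry (walk-map G inj₂ (down L₂ p₂)))
          (ip-walk G y'R)
          (walk-map G (λ { (inj₁ i) → inj₁ i ; (inj₂ (inj₁ eq)) → inj₂ (here eq) ; (inj₂ (inj₂ eq)) → inj₂ (here eq) }) (up L a ip₁)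
            ⊕′ walk-map G inj₂ to-b₃)
          AB AC BC
        where
          zs : IP G z b₁ (z ∷ y' ∷ R)
          zs = ip-suffix G (a ∷ L) ip₁
          y'R : IP G y' b₁ (y' ∷ R)
          y'R = ip-suffix G [ z ] zs
          z≢b : z ≢ b₁
          z≢b = ip-distinct G [ z ] zs (here refl) (ip-last∈ G y'R)
          b₃∈ : b₃ ∈ₗ Γ₃
          b₃∈ with ip-last∈ G ip₃
          ... | here eq = ⊥-elim (proj₁ ab₃ (sym eq))
          ... | there i = i
          B⊆ : ∀ {t} → t ∈ₗ y' ∷ R → t ∈ₗ L ++ z ∷ y' ∷ R
          B⊆ i = ∈-++⁺ʳ L (there i)
          AB : Link G (λ t → D t ⊎ t ∈ₗ y ∷ R₂) (_∈ₗ y' ∷ R) q b₂ y' b₁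
          AB (inj₁ d) j = D₁ d (B⊆ j) , λ e → inj₁ (c₁ d (B⊆ j) e , is-y' j (subst (_~ _) (c₁ d (B⊆ j) e) e))
            where
              is-y' : ∀ {t} → t ∈ₗ y' ∷ R → q ~ t → t ≡ y'
              is-y' (here eq) _ = eq
              is-y' (there i) e = ⊥-elim (noR _ i e)
          AB (inj₂ i) j with X₁₂ (B⊆ j) (d∈Γ₂ i)
          ... | ne , h = ne ∘ sym , λ e → inj₂ (let p , p' = h (E-sym G e) in p' , p)
          AC : Link G (λ t → D t ⊎ t ∈ₗ y ∷ R₂) (λ t → t ∈ₗ L ++ [ z ] ⊎ t ∈ₗ a ∷ Γ₃) q b₂ z b₃
          AC (inj₁ d) (inj₁ j) = D₁ d (snoc⊆ L j) , λ e → inj₁ (c₁ d (snoc⊆ L j) e , is-z (∈-++⁻ L j) (subst (_~ _) (c₁ d (snoc⊆ L j) e) e))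
            where
              is-z : ∀ {t} → t ∈ₗ L ⊎ t ∈ₗ [ z ] → q ~ t → t ≡ z
              is-z (inj₁ i) e = ⊥-elim (noL _ i e)
              is-z (inj₂ (here eq)) _ = eq
          AC (inj₁ d) (inj₂ (here refl)) = proj₁ (Da d) , ⊥-elim ∘ proj₂ (Da d)
          AC (inj₁ d) (inj₂ (there j)) = D₃ d j , ⊥-elim ∘ c₃ d j
          AC (inj₂ i) (inj₁ j) with X₁₂ (snoc⊆ L j) (d∈Γ₂ i)
          ... | ne , h = ne ∘ sym , λ e → ⊥-elim (up≢b L ip₁ z≢b j (proj₁ (h (E-sym G e))))
          AC (inj₂ i) (inj₂ (here refl)) with a≁down i
          ... | ne , na = ne ∘ sym , ⊥-elim ∘ na ∘ E-sym G
          AC (inj₂ i) (inj₂ (there j)) with X₂₃ (d∈Γ₂ i) j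
          ... | ne , h = ne , inj₂ ∘ h
          BC : Link G (_∈ₗ y' ∷ R) (λ t → t ∈ₗ L ++ [ z ] ⊎ t ∈ₗ a ∷ Γ₃) y' b₁ z b₃
          BC i (inj₁ j) with ∈-++⁻ L j
          ... | inj₁ k with ip-far G (a ∷ L) ip₁ (there k) i
          ...   | ne , na = ne ∘ sym , ⊥-elim ∘ na ∘ E-sym G
          BC (here refl) (inj₁ j) | inj₂ (here refl) =
            ip-distinct G [ z ] zs (here refl) (here refl) ∘ sym , λ _ → inj₁ (refl , refl)
          BC (there i) (inj₁ j) | inj₂ (here refl) with ip-far G [ z ] zs (here refl) i
          ...   | ne , na = ne ∘ sym , ⊥-elim ∘ na ∘ E-sym G
          BC i (inj₂ (here refl)) with ip-far G (a ∷ L) ip₁ (here refl) i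
          ... | ne , na = ne ∘ sym , ⊥-elim ∘ na ∘ E-sym G
          BC i (inj₂ (there j)) with X₁₃ (B⊆ i) j
          ... | ne , h = ne , inj₂ ∘ h

    endsIn : ∀ {x y} → x ∈ₗ Γ₁ → q ~ x → x ≢ b₁ → y ∈ₗ Γ₂ → r ~ y → y ≢ b₂ → EndsIn Γ₁ b₁ q
    endsIn {x} x∈ qx x≢b y∈ ry y≢b with ∈-∃++ y∈
    ... | L₂ , R₂ , eq₂ = go Γ₁ refl (shape (E? G q) Γ₁ x∈ qx)
      where
        last-only : ∀ {z R} → IP G z b₁ (b₁ ∷ R) → R ≡ []
        last-only one = refl
        last-only p@(more _ _ _) = ⊥-elim (ip-distinct G [ b₁ ] p (here refl) (ip-last∈ G (ip-suffix G [ b₁ ] p)) refl)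
        go : ∀ Γ → Γ₁ ≡ Γ → Shape (q ~_) Γ → EndsIn Γ₁ b₁ q
        go _ eq (single L z R qz noL noR) =
          ⊥-elim (single⊥ L₂ R₂ eq₂ y≢b ry L z R eq qz (λ z≡b → x≢b (trans (is-z (∈-++⁻ L (subst (x ∈ₗ_) eq x∈))) z≡b)) noL noR)
          where
            is-z : x ∈ₗ L ⊎ x ∈ₗ z ∷ R → x ≡ z
            is-z (inj₁ i) = ⊥-elim (noL _ i qx)
            is-z (inj₂ (here eq)) = eq
            is-z (inj₂ (there i)) = ⊥-elim (noR _ i qx)
        go _ eq (wide L z m M y' R qz qy') = ⊥-elim (wide⊥ L₂ R₂ eq₂ y≢b ry L z m M y' R eq qz qy')
        go _ eq (double L z y' R qz qy' noL noR) with y' ≟ b₁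
        ... | no ne = ⊥-elim (double⊥ L₂ R₂ eq₂ y≢b ry L z y' R eq qz qy' ne noL noR)
        ... | yes refl = L , z , trans eq (cong (λ R → L ++ z ∷ y' ∷ R) (last-only (ip-suffix G [ z ]
                           (ip-suffix G (a ∷ L) (subst (λ Γ → IP G a b₁ (a ∷ Γ)) eq ip₁))))) , qz , qy' , noL

  private
   twin⊥ : ∀ {Γ₁ Γ₂ Γ₃ b₁ b₂ b₃} → Pyr Γ₁ Γ₂ Γ₃ b₁ b₂ b₃ → ∀ {D q r} → Link₁₂ Γ₁ Γ₂ Γ₃ D q r →
     EndsIn Γ₁ b₁ q → EndsIn Γ₂ b₂ r → q ≢ r → ⊥
   twin⊥ {b₁ = b₁} {b₂} π {D} {q} {r} l (L₁ , z₁ , refl , qz , qb , no₁) (L₂ , z₂ , refl , rz , rb , no₂) q≢r =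
     no-prism G pf D (λ t → t ≡ b₁ ⊎ t ≡ b₂) C
       qb qz (E-sym G (ip-adjacent G (a ∷ L₁) ip₁)) rb rz (E-sym G (ip-adjacent G (a ∷ L₂) ip₂))
       q≢r (E⇒≢ G bb₁₂) (proj₁ (X₁₂ (∈-++⁺ʳ L₁ (here refl)) (∈-++⁺ʳ L₂ (here refl))))
       walk (step (inj₁ refl) bb₁₂ (stop (inj₂ refl)))
       (_⊕_ G (walk-map G (λ { (inj₁ i) → inj₁ i ; (inj₂ (inj₁ eq)) → inj₂ (inj₁ eq) ; (inj₂ (inj₂ eq)) → inj₂ (inj₁ eq) })
                (up L₁ a ip₁))
              (walk-reverse G (walk-map G (λ { (inj₁ i) → inj₂ (inj₂ i) ; (inj₂ (inj₁ eq)) → inj₂ (inj₁ eq) ; (inj₂ (inj₂ eq)) → inj₂ (inj₁ eq) })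
                (up L₂ a ip₂))))
       AB AC BC
     where
       open Pyr π
       open Link₁₂ l
       C : Fin n → Set
       C t = t ∈ₗ L₁ ++ [ z₁ ] ⊎ t ≡ a ⊎ t ∈ₗ L₂ ++ [ z₂ ]
       b₁∈ : b₁ ∈ₗ L₁ ++ z₁ ∷ b₁ ∷ []
       b₁∈ = ∈-++⁺ʳ L₁ (there (here refl))
       b₂∈ : b₂ ∈ₗ L₂ ++ z₂ ∷ b₂ ∷ []
       b₂∈ = ∈-++⁺ʳ L₂ (there (here refl))
       is-z : ∀ {q} L {z t} → (∀ t → t ∈ₗ L → ¬ q ~ t) → t ∈ₗ L ++ [ z ] → q ~ t → t ≡ z
       is-z L none i e with ∈-++⁻ L i
       ... | inj₁ j = ⊥-elim (none _ j e)
       ... | inj₂ (here eq) = eq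
       own : ∀ {b} L {z t} → IP G a b (a ∷ L ++ z ∷ b ∷ []) → t ∈ₗ L ++ [ z ] → b ≢ t × (b ~ t → t ≡ z)
       own L p i with ∈-++⁻ L i
       ... | inj₁ j with ip-far G (a ∷ L) p (there j) (here refl)
       ...   | ne , na = ne ∘ sym , ⊥-elim ∘ na ∘ E-sym G
       own L p i | inj₂ (here refl) = E⇒≢ G (ip-adjacent G (a ∷ L) p) ∘ sym , λ _ → refl
       z≢b : ∀ {b} L {z} → IP G a b (a ∷ L ++ z ∷ b ∷ []) → z ≢ b
       z≢b L p = E⇒≢ G (ip-adjacent G (a ∷ L) p)
       AB : Link G D (λ t → t ≡ b₁ ⊎ t ≡ b₂) q r b₁ b₂
       AB d (inj₁ refl) = D₁ d b₁∈ , λ e → inj₁ (c₁ d b₁∈ e , refl)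
       AB d (inj₂ refl) = D₂ d b₂∈ , λ e → inj₂ (c₂ d b₂∈ e , refl)
       AC : Link G D C q r z₁ z₂
       AC d (inj₁ i) = D₁ d (snoc⊆ L₁ i) , λ e → inj₁ (c₁ d (snoc⊆ L₁ i) e , is-z L₁ no₁ i (subst (_~ _) (c₁ d (snoc⊆ L₁ i) e) e))
       AC d (inj₂ (inj₁ refl)) = proj₁ (Da d) , ⊥-elim ∘ proj₂ (Da d)
       AC d (inj₂ (inj₂ i)) = D₂ d (snoc⊆ L₂ i) , λ e → inj₂ (c₂ d (snoc⊆ L₂ i) e , is-z L₂ no₂ i (subst (_~ _) (c₂ d (snoc⊆ L₂ i) e) e))
       BC : Link G (λ t → t ≡ b₁ ⊎ t ≡ b₂) C b₁ b₂ z₁ z₂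
       BC (inj₁ refl) (inj₁ i) with own L₁ ip₁ i
       ... | ne , h = ne , λ e → inj₁ (refl , h e)
       BC (inj₁ refl) (inj₂ (inj₁ refl)) = proj₁ ab₁ ∘ sym , ⊥-elim ∘ proj₂ ab₁ ∘ E-sym G
       BC (inj₁ refl) (inj₂ (inj₂ i)) with X₁₂ b₁∈ (snoc⊆ L₂ i)
       ... | ne , h = ne , λ e → ⊥-elim (up≢b L₂ ip₂ (z≢b L₂ ip₂) i (proj₂ (h e)))
       BC (inj₂ refl) (inj₁ i) with X₁₂ (snoc⊆ L₁ i) b₂∈
       ... | ne , h = ne ∘ sym , λ e → ⊥-elim (up≢b L₁ ip₁ (z≢b L₁ ip₁) i (proj₁ (h (E-sym G e))))
       BC (inj₂ refl) (inj₂ (inj₁ refl)) = proj₁ ab₂ ∘ sym , ⊥-elim ∘ proj₂ ab₂ ∘ E-sym G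
       BC (inj₂ refl) (inj₂ (inj₂ i)) with own L₂ ip₂ i
       ... | ne , h = ne , λ e → inj₂ (refl , h e)

  linked⇒jewel : ∀ {Γ₁ Γ₂ Γ₃ b₁ b₂ b₃} → Pyr Γ₁ Γ₂ Γ₃ b₁ b₂ b₃ → ∀ {D q r} → Link₁₂ Γ₁ Γ₂ Γ₃ D q r →
    ∀ {x y} → x ∈ₗ Γ₁ → q ~ x → x ≢ b₁ → y ∈ₗ Γ₂ → r ~ y → y ≢ b₂ →
    q ≡ r × EndsIn Γ₁ b₁ q × EndsIn Γ₂ b₂ r
  linked⇒jewel π {q = q} {r} l x∈ qx x≢b y∈ ry y≢b with q ≟ r
  ... | yes eq = eq , Half.endsIn π l x∈ qx x≢b y∈ ry y≢b
                    , Half.endsIn (pyr-swap₁₂ π) (link-swap l) y∈ ry y≢b x∈ qx x≢b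
  ... | no ne = ⊥-elim (twin⊥ π l (Half.endsIn π l x∈ qx x≢b y∈ ry y≢b)
                    (Half.endsIn (pyr-swap₁₂ π) (link-swap l) y∈ ry y≢b x∈ qx x≢b) ne)

  three-arms⊥ : ∀ {Γ₁ Γ₂ Γ₃ b₁ b₂ b₃} → Pyr Γ₁ Γ₂ Γ₃ b₁ b₂ b₃ → ∀ {p} → Far G p a →
    ∀ {x y z} → x ∈ₗ Γ₁ → p ~ x → x ≢ b₁ → y ∈ₗ Γ₂ → p ~ y → y ≢ b₂ → z ∈ₗ Γ₃ → p ~ z → ⊥
  three-arms⊥ π {p} pa {x} {y} {z} x∈ px x≢b y∈ py y≢b z∈ pz with ∈-∃++ x∈ | ∈-∃++ y∈ | ∈-∃++ z∈
  ... | L₁ , _ , refl | L₂ , _ , refl | L₃ , _ , refl =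
    no-theta G tf pa (_∈ₗ L₁ ++ [ x ]) (_∈ₗ L₂ ++ [ y ]) (_∈ₗ L₃ ++ [ z ])
      (λ i j → far X₁₂ (snoc⊆ L₁ i) (snoc⊆ L₂ j) (up≢b L₁ ip₁ x≢b i))
      (λ i j → far X₁₃ (snoc⊆ L₁ i) (snoc⊆ L₃ j) (up≢b L₁ ip₁ x≢b i))
      (λ i j → far X₂₃ (snoc⊆ L₂ i) (snoc⊆ L₃ j) (up≢b L₂ ip₂ y≢b i))
      (step (inj₂ (inj₁ refl)) px (up L₁ p ip₁))
      (step (inj₂ (inj₁ refl)) py (up L₂ p ip₂))
      (step (inj₂ (inj₁ refl)) pz (up L₃ p ip₃))
    where
      open Pyr π
      far : ∀ {Γ b Γ' b' x y} → Cross Γ b Γ' b' → x ∈ₗ Γ → y ∈ₗ Γ' → x ≢ b → Far G x y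
      far X i j ne with X i j
      ... | ne' , h = ne' , λ e → ne (proj₁ (h e))

  base-linked⊥ : ∀ {Γ₁ Γ₂ Γ₃ b₁ b₂ b₃} → Pyr Γ₁ Γ₂ Γ₃ b₁ b₂ b₃ → ∀ {D q r} → Walk G D q r →
    (∀ {d z} → D d → z ∈ₗ Γ₁ ⊎ z ∈ₗ Γ₃ → d ≢ z) →
    (∀ {d z} → D d → z ∈ₗ Γ₁ → d ~ z → z ≡ b₁) → (∀ {d z} → D d → z ∈ₗ Γ₃ → ¬ d ~ z) →
    q ~ b₁ → ∀ {y} → y ∈ₗ Γ₂ → r ~ y → y ≢ b₂ → ⊥
  base-linked⊥ {Γ₁} {Γ₃ = Γ₃} {b₁} {b₂} π {D} walk D∉ only₁ none₃ qb {y} y∈ ry y≢b with ∈-∃++ y∈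
  ... | L₂ , R₂ , refl =
    no-theta G tf (far-sym G ab₁) A (_∈ₗ Γ₃) C AB AC BC
      (walk-map G inA (walk-reverse G (ip-walk G ip₁)))
      (step (inj₂ (inj₁ refl)) bb₁₃
        (walk-map G (λ { (here eq) → inj₂ (inj₂ eq) ; (there i) → inj₁ i }) (walk-reverse G (ip-walk G ip₃))))
      (step (inj₂ (inj₁ refl)) (E-sym G qb)
        (_⊕_ G (walk-map G (inj₁ ∘ inj₁) walk)
          (step (inj₁ (inj₁ (walk-end G walk))) ry
            (walk-map G (λ { (inj₁ i) → inj₁ (inj₂ i) ; (inj₂ s) → inj₂ s }) (up L₂ b₁ ip₂)))))
    where
      open Pyr π
      A C : Fin n → Set
      A t = t ∈ₗ Γ₁ × t ≢ b₁
      C t = D t ⊎ t ∈ₗ L₂ ++ [ y ]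
      inA : ∀ {t} → t ∈ₗ a ∷ Γ₁ → A t ⊎ t ≡ b₁ ⊎ t ≡ a
      inA (here eq) = inj₂ (inj₂ eq)
      inA {t} (there i) with t ≟ b₁
      ... | yes eq = inj₂ (inj₁ eq)
      ... | no ne = inj₁ (i , ne)
      AB : Anti G A (_∈ₗ Γ₃)
      AB (i , ne) j with X₁₃ i j
      ... | ne' , h = ne' , ne ∘ proj₁ ∘ h
      AC : Anti G A C
      AC (i , ne) (inj₁ d) = D∉ d (inj₁ i) ∘ sym , λ e → ne (only₁ d i (E-sym G e))
      AC (i , ne) (inj₂ j) with X₁₂ i (snoc⊆ L₂ j)
      ... | ne' , h = ne' , ne ∘ proj₁ ∘ h
      BC : Anti G (_∈ₗ Γ₃) C
      BC i (inj₁ d) = D∉ d (inj₂ i) ∘ sym , λ e → none₃ d i (E-sym G e)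
      BC i (inj₂ j) with X₂₃ (snoc⊆ L₂ j) i
      ... | ne' , h = ne' ∘ sym , λ e → up≢b L₂ ip₂ y≢b j (proj₁ (h (E-sym G e)))

module Trees {m : ℕ} (T : Graph m) (smooth : Smooth T) where

  private
    _~_ : Fin m → Fin m → Set
    _~_ = E T

  sameEdge? : ∀ u v x y → Dec (SameEdge T u v x y)
  sameEdge? u v x y = (u ≟ x ×-dec v ≟ y) ⊎-dec (u ≟ y ×-dec v ≟ x)

  same-swapˡ : ∀ {u v x y} → SameEdge T u v x y → SameEdge T v u x y
  same-swapˡ (inj₁ (p , q)) = inj₂ (q , p)
  same-swapˡ (inj₂ (p , q)) = inj₁ (q , p)

  same-sym : ∀ {u v x y} → SameEdge T u v x y → SameEdge T x y u v
  same-sym (inj₁ (p , q)) = inj₁ (sym p , sym q)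
  same-sym (inj₂ (p , q)) = inj₂ (sym q , sym p)

  same-trans : ∀ {u v x y s t} → SameEdge T u v x y → SameEdge T x y s t → SameEdge T u v s t
  same-trans (inj₁ (refl , refl)) s = s
  same-trans (inj₂ (refl , refl)) s = same-swapˡ s

  same-end : ∀ {u v x y t} → SameEdge T u v x y → t ≡ u ⊎ t ≡ v → t ≡ x ⊎ t ≡ y
  same-end (inj₁ (refl , refl)) i = i
  same-end (inj₂ (refl , refl)) (inj₁ eq) = inj₂ eq
  same-end (inj₂ (refl , refl)) (inj₂ eq) = inj₁ eq

  two-ends : ∀ {x y s t} → x ≢ y → x ≡ s ⊎ x ≡ t → y ≡ s ⊎ y ≡ t → SameEdge T x y s t
  two-ends ne (inj₁ p) (inj₁ q) = ⊥-elim (ne (trans p (sym q)))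
  two-ends ne (inj₁ p) (inj₂ q) = inj₁ (p , q)
  two-ends ne (inj₂ p) (inj₁ q) = inj₂ (p , q)
  two-ends ne (inj₂ p) (inj₂ q) = ⊥-elim (ne (trans p (sym q)))

  walkOK⇒walk : ∀ {u v} W → WalkOK T W → ∃[ Q ] W ≡ u ∷ Q → ∃[ R ] W ≡ R ++ [ v ] → Walk T (λ _ → ⊤) u v
  walkOK⇒walk (x ∷ []) ok (_ , refl) ([] , refl) = stop tt
  walkOK⇒walk (x ∷ []) ok (_ , refl) (_ ∷ [] , ())
  walkOK⇒walk (x ∷ []) ok (_ , refl) (_ ∷ _ ∷ _ , ())
  walkOK⇒walk (x ∷ y ∷ W) (e , ok) (_ , refl) ([] , ())
  walkOK⇒walk (x ∷ y ∷ W) (e , ok) (_ , refl) (_ ∷ R , eq) =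
    step tt e (walkOK⇒walk (y ∷ W) ok (W , refl) (R , proj₂ (∷-injective eq)))

  ip⇒walkOK : ∀ {x z P} → IP T x z P → WalkOK T P
  ip⇒walkOK one = tt
  ip⇒walkOK (more e _ p) = e , ip⇒walkOK p

  -- w is the first step from v towards u.
  Dir : Fin m → Fin m → Fin m → Set
  Dir v w u = Walk T (_≢ v) w u

  dir-unique : ∀ {v w w' u} → v ~ w → v ~ w' → Dir v w u → Dir v w' u → w ≡ w'
  dir-unique {v} {w} {w'} vw vw' d d' with w ≟ w'
  ... | yes eq = eq
  ... | no ne with walk⇒ip T (_⊕_ T d (walk-reverse T d'))
  ...   | P , p , avoid = ⊥-elim (proj₂ (proj₁ smooth) (v ∷ P)
      ( long p
      , distinct
      , ok p (ip⇒walkOK p)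
      , v , w' , closing))
    where
      long : ∀ {P} → IP T w w' P → 3 ≤ length (v ∷ P)
      long one = ⊥-elim (ne refl)
      long (more _ _ _) = s≤s (s≤s (s≤s z≤n))
      distinct : ∀ i j → lookup (v ∷ P) i ≡ lookup (v ∷ P) j → i ≡ j
      distinct zero zero _ = refl
      distinct zero (suc j) eq = ⊥-elim (avoid (∈-lookup j) (sym eq))
      distinct (suc i) zero eq = ⊥-elim (avoid (∈-lookup i) eq)
      distinct (suc i) (suc j) eq = cong suc (IsPath.distinct (ip⇒IsPath T p) i j eq)
      ok : ∀ {P} → IP T w w' P → WalkOK T P → WalkOK T (v ∷ P)
      ok one o = vw , o
      ok (more _ _ _) o = vw , o
      closing : ∃[ R ] v ∷ P ≡ v ∷ R ++ [ w' ] × w' ~ v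
      closing with ip-last T p
      ... | R , eq = R , cong (v ∷_) eq , E-sym T vw'

  dir-exists : ∀ v u → u ≢ v → ∃[ w ] v ~ w × Dir v w u
  dir-exists v u ne with proj₁ (proj₁ smooth) v u
  ... | W , ok , first , last with walk⇒ip T (walkOK⇒walk W ok first last)
  ...   | _ , one , _ = ⊥-elim (ne refl)
  ...   | _ , more {y = w} e a p , _ = w , e , walk-map T away (ip-walk T p)
    where
      away : ∀ {z} → z ∈ₗ w ∷ _ → z ≢ v
      away (here refl) = E⇒≢ T e ∘ sym
      away (there i) = proj₁ (lookupAll a i) ∘ sym

  dir-step : ∀ {v w x y} → Dir v w x → x ~ y → y ≢ v → Dir v w y
  dir-step d e ne = snoc T d e ne

  dir-self : ∀ {v w} → v ~ w → Dir v w w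
  dir-self e = stop (E⇒≢ T e ∘ sym)

  EDir : Fin m → Fin m → Fin m → Fin m → Set
  EDir v w x y = Dir v w x ⊎ Dir v w y

  edir-swap : ∀ {v w x y} → EDir v w x y → EDir v w y x
  edir-swap (inj₁ d) = inj₂ d
  edir-swap (inj₂ d) = inj₁ d

  edir-end : ∀ {v w x y t} → x ~ y → EDir v w x y → t ≡ x ⊎ t ≡ y → t ≢ v → Dir v w t
  edir-end e (inj₁ d) (inj₁ refl) ne = d
  edir-end e (inj₁ d) (inj₂ refl) ne = dir-step d e ne
  edir-end e (inj₂ d) (inj₁ refl) ne = dir-step d (E-sym T e) ne
  edir-end e (inj₂ d) (inj₂ refl) ne = d

  other-end : ∀ {x y} v → x ~ y → ∃[ t ] (t ≡ x ⊎ t ≡ y) × t ≢ v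
  other-end {x} {y} v e with x ≟ v
  ... | no ne = x , inj₁ refl , ne
  ... | yes refl = y , inj₂ refl , E⇒≢ T e ∘ sym

  edir-unique : ∀ {v w w' x y} → v ~ w → v ~ w' → x ~ y → EDir v w x y → EDir v w' x y → w ≡ w'
  edir-unique {v} vw vw' e d d' with other-end v e
  ... | t , i , ne = dir-unique vw vw' (edir-end e d i ne) (edir-end e d' i ne)

  edir-exists : ∀ {x y} v → x ~ y → ∃[ w ] v ~ w × EDir v w x y
  edir-exists v e with other-end v e
  ... | t , i , ne with dir-exists v t ne
  ...   | w , vw , d = w , vw , pick i d
    where
      pick : ∀ {t x y} → t ≡ x ⊎ t ≡ y → Dir v w t → EDir v w x y
      pick (inj₁ refl) d = inj₁ d
      pick (inj₂ refl) d = inj₂ d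

  edir-self : ∀ {v w} → v ~ w → EDir v w v w
  edir-self e = inj₂ (dir-self e)

  dir-opposite : ∀ {v w u} → v ~ w → Dir v w u → ¬ Dir w v u
  dir-opposite {v} {w} e d d' with walk⇒ip T d
  ... | _ , one , _ = walk-end T d' refl
  ... | _ , more {y = w₁} {Q = Q} ww₁ a p , avoid =
    avoid (there (here refl)) (dir-unique ww₁ (E-sym T e) (walk-map T away (ip-walk T p)) d')
    where
      away : ∀ {z} → z ∈ₗ w₁ ∷ Q → z ≢ w
      away (here refl) = E⇒≢ T ww₁ ∘ sym
      away (there i) = proj₁ (lookupAll a i) ∘ sym

  dir-beyond≢ : ∀ {v w w' u} → v ~ w → w ~ w' → w' ≢ v → Dir w w' u → u ≢ v
  dir-beyond≢ vw ww' ne d refl = ne (dir-unique ww' (E-sym T vw) d (dir-self (E-sym T vw)))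

  dir-beyond : ∀ {v w w' u} → v ~ w → w ~ w' → w' ≢ v → Dir w w' u → Dir v w u
  dir-beyond vw ww' ne d =
    step (E⇒≢ T vw ∘ sym) ww'
      (walk-map T (dir-beyond≢ vw ww' ne) (walk-reach T (stop (walk-start T d)) d))

  edir-beyond : ∀ {v w w' x y} → v ~ w → w ~ w' → w' ≢ v → EDir w w' x y → EDir v w x y
  edir-beyond vw ww' ne (inj₁ d) = inj₁ (dir-beyond vw ww' ne d)
  edir-beyond vw ww' ne (inj₂ d) = inj₂ (dir-beyond vw ww' ne d)

  edir-beyond≢ : ∀ {v w w' x y t} → v ~ w → w ~ w' → w' ≢ v → x ~ y → EDir w w' x y →
    t ≡ x ⊎ t ≡ y → t ≢ v
  edir-beyond≢ {w = w} {t = t} vw ww' ne e d i with t ≟ w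
  ... | yes refl = E⇒≢ T vw ∘ sym
  ... | no t≢w = dir-beyond≢ vw ww' ne (edir-end e d i t≢w)

  edir-opposite : ∀ {v w x y} → v ~ w → x ~ y → EDir v w x y → ¬ SameEdge T x y v w →
    ∃[ w' ] w ~ w' × w' ≢ v × EDir w w' x y
  edir-opposite {v} {w} {x} {y} vw e d ns with edir-exists w e
  ... | w' , ww' , d' with w' ≟ v
  ...   | no ne = w' , ww' , ne , d'
  ...   | yes refl = ⊥-elim (ns (two-ends (E⇒≢ T e) (end (inj₁ refl)) (end (inj₂ refl))))
    where
      end : ∀ {t} → t ≡ x ⊎ t ≡ y → t ≡ v ⊎ t ≡ w
      end {t} i with t ≟ v | t ≟ w
      ... | yes p | _ = inj₁ p
      ... | no _ | yes p = inj₂ p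
      ... | no p | no q = ⊥-elim (dir-opposite vw (edir-end e d i p) (edir-end e d' i q))

  edir-share : ∀ {v w₁ w₂ x y x' y' t} → v ~ w₁ → v ~ w₂ → w₁ ≢ w₂ → x ~ y → x' ~ y' →
    EDir v w₁ x y → EDir v w₂ x' y' → t ≡ x ⊎ t ≡ y → t ≡ x' ⊎ t ≡ y' → t ≡ v
  edir-share {v} {t = t} vw₁ vw₂ ne e e' d d' i i' with t ≟ v
  ... | yes eq = eq
  ... | no t≢v = ⊥-elim (ne (dir-unique vw₁ vw₂ (edir-end e d i t≢v) (edir-end e' d' i' t≢v)))

  edir-disjoint : ∀ {v w₁ w₂ x y x' y'} → v ~ w₁ → v ~ w₂ → w₁ ≢ w₂ → x ~ y → x' ~ y' →
    EDir v w₁ x y → EDir v w₂ x' y' → ¬ SameEdge T x y x' y'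
  edir-disjoint vw₁ vw₂ ne e e' d d' s =
    E⇒≢ T e (trans (edir-share vw₁ vw₂ ne e e' d d' (inj₁ refl) (same-end s (inj₁ refl)))
             (sym (edir-share vw₁ vw₂ ne e e' d d' (inj₂ refl) (same-end s (inj₂ refl)))))

  separator : ∀ {x y x' y'} → x ~ y → x' ~ y' → ¬ SameEdge T x y x' y' →
    ∃[ v ] ∃[ w₁ ] ∃[ w₂ ] v ~ w₁ × v ~ w₂ × w₁ ≢ w₂ × EDir v w₁ x y × EDir v w₂ x' y' × (v ≡ x ⊎ v ≡ y)
  separator {x} {y} e e' ns with edir-exists x e'
  ... | w , xw , d with y ≟ w
  ...   | no ne = x , y , w , e , xw , ne , edir-self e , d , inj₁ refl
  ...   | yes refl with edir-opposite e e' d (ns ∘ same-sym)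
  ...     | w' , yw' , ne , d' = y , x , w' , E-sym T e , yw' , ne ∘ sym , edir-swap (edir-self (E-sym T e)) , d' , inj₂ refl

  not-avoid : ∀ {v w l} → v ~ w → Dir v w l → ¬ ReachAvoid T v w v l
  not-avoid {v} {w} {l} vw d (W , ok , first , last) = go W ok first last (λ d' → walk-end T d' refl) d
    where
      go : ∀ {t} W → WalkAvoid T v w W → ∃[ Q ] W ≡ t ∷ Q → ∃[ R ] W ≡ R ++ [ l ] →
           ¬ Dir v w t → ¬ Dir v w l
      go (x ∷ []) ok (_ , refl) ([] , refl) nd = nd
      go (x ∷ []) ok (_ , refl) (_ ∷ [] , ())
      go (x ∷ []) ok (_ , refl) (_ ∷ _ ∷ _ , ())
      go (x ∷ y ∷ W) ok (_ , refl) ([] , ())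
      go (x ∷ y ∷ W) (e , ns , ok) (_ , refl) (_ ∷ R , eq) nd =
        go (y ∷ W) ok (W , refl) (R , proj₂ (∷-injective eq)) nd'
        where
          nd' : ¬ Dir v w y
          nd' d' with x ≟ v
          ... | no x≢v = nd (dir-step d' (E-sym T e) x≢v)
          ... | yes refl = ns (inj₁ (refl , dir-unique e vw (dir-self e) d'))

  two⇒¬leaf : ∀ {v w₁ w₂} → v ~ w₁ → v ~ w₂ → w₁ ≢ w₂ → ¬ Leaf T v
  two⇒¬leaf e₁ e₂ ne (u , _ , only) = ne (trans (only _ e₁) (sym (only _ e₂)))

  ¬leaf⇒branch : ∀ {v} → ¬ Leaf T v → Branch T v
  ¬leaf⇒branch {v} nl with proj₂ (proj₂ smooth) v
  ... | inj₁ l = ⊥-elim (nl l)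
  ... | inj₂ b = b

  next : ∀ {v} → ¬ Leaf T v → ∀ w → ∃[ w' ] v ~ w' × w' ≢ w
  next nl w with ¬leaf⇒branch nl
  ... | x , y , z , x≢y , _ , _ , vx , vy , _ with x ≟ w
  ...   | no ne = x , vx , ne
  ...   | yes refl = y , vy , x≢y ∘ sym

  third : ∀ {v w₁ w₂} → v ~ w₁ → v ~ w₂ → w₁ ≢ w₂ → ∃[ w₃ ] v ~ w₃ × w₃ ≢ w₁ × w₃ ≢ w₂
  third {v} {w₁} {w₂} e₁ e₂ ne with ¬leaf⇒branch (two⇒¬leaf e₁ e₂ ne)
  ... | x , y , z , x≢y , y≢z , x≢z , vx , vy , vz with x ≟ w₁ | x ≟ w₂ | y ≟ w₁ | y ≟ w₂ | z ≟ w₁ | z ≟ w₂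
  ... | no p | no q | _ | _ | _ | _ = x , vx , p , q
  ... | _ | _ | no p | no q | _ | _ = y , vy , p , q
  ... | _ | _ | _ | _ | no p | no q = z , vz , p , q
  ... | yes refl | _ | yes refl | _ | _ | _ = ⊥-elim (x≢y refl)
  ... | yes refl | _ | _ | _ | yes refl | _ = ⊥-elim (x≢z refl)
  ... | _ | _ | yes refl | _ | yes refl | _ = ⊥-elim (y≢z refl)
  ... | _ | yes refl | _ | yes refl | _ | _ = ⊥-elim (x≢y refl)
  ... | _ | yes refl | _ | _ | _ | yes refl = ⊥-elim (x≢z refl)
  ... | _ | _ | _ | yes refl | _ | yes refl = ⊥-elim (y≢z refl)

  leaf? : ∀ v → Dec (Leaf T v)
  leaf? v with proj₂ (proj₂ smooth) v
  ... | inj₁ l = yes l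
  ... | inj₂ (x , y , z , x≢y , _ , _ , vx , vy , _) = no (two⇒¬leaf vx vy x≢y)

module Strips {n m : ℕ} (G : Graph n) (a : Fin n) (T : Graph m) (smooth : Smooth T) (η : StripData n m) where

  open StripData η
  open Trees T smooth

  private
    _~_ : Fin n → Fin n → Set
    _~_ = E G

  inηT? : Decidable (InηT G T a η)
  inηT? x = any? (λ v → x ∈? ηv v) ⊎-dec any? (λ u → any? λ v → E? T u v ×-dec x ∈? ηe u v)

  inηT⁺? : Decidable (InηT⁺ G T a η)
  inηT⁺? x = x ≟ a ⊎-dec inηT? x

  inB? : ∀ v → Decidable (InB G T a η v)
  inB? v x = any? λ u → E? T v u ×-dec x ∈? ηev v u v

  B : Fin m → Fin n → Set
  B = InB G T a η

  record Rung (u v : Fin m) (R : List (Fin n)) (c b : Fin n) : Set where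
    field
      path   : IP G c b R
      inside : ∀ {z} → z ∈ₗ R → z ∈ ηe u v
      start  : c ∈ ηev u v u
      end    : b ∈ ηev u v v
      start! : ∀ {z} → z ∈ₗ R → z ∈ ηev u v u → z ≡ c
      end!   : ∀ {z} → z ∈ₗ R → z ∈ ηev u v v → z ≡ b

  PyramidArm : (v w : Fin m) (b : Fin n) (P : List (Fin n)) → Set
  PyramidArm v w b P = b ∈ ηev v w v
      × ∃[ l ] Leaf T l × ¬ ReachAvoid T v w v l
      × ∃[ Λ ] PathFT T Λ v l
      × ∃[ Γ ] P ≡ a ∷ Γ
      × IsPath G Γ
      × (∀ z → z ∈ₗ Γ → ∃[ x ] ∃[ y ] Consec T Λ x y × z ∈ ηe x y)
      × IsLongRung G T a η v w (λ z → z ∈ₗ Γ × z ∈ ηe v w)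
      × (∀ x y → Consec T Λ x y → ¬ SameEdge T x y v w →
           IsRung G T a η x y (λ z → z ∈ₗ Γ × z ∈ ηe x y))

  private
    RungEnds : (u v : Fin m) → List (Fin n) → Set
    RungEnds u v P =
      (∃[ x ] P ≡ [ x ] × x ∈ ηev u v u × x ∈ ηev u v v)
      ⊎ (∃[ x ] ∃[ y ] PathFT G P x y
           × x ∈ ηev u v u × x ∉ ηev u v v
           × y ∈ ηev u v v × y ∉ ηev u v u
           × (∀ z → Interior G P x y z → InCirc G T a η u v z))

    ends⇒rung : ∀ {u v P} → (∀ z → z ∈ₗ P → z ∈ ηe u v) → RungEnds u v P → ∃[ c ] ∃[ b ] Rung u v P c b
    ends⇒rung ins (inj₁ (x , refl , xu , xv)) = x , x , record
      { path = one ; inside = ins _ ; start = xu ; end = xv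
      ; start! = λ { (here refl) _ → refl } ; end! = λ { (here refl) _ → refl } }
    ends⇒rung {u} {v} {P} ins (inj₂ (x , y , p , xu , x∉v , yv , y∉u , int)) = x , y , record
      { path = PathFT⇒ip G p ; inside = ins _ ; start = xu ; end = yv ; start! = s! ; end! = e! }
      where
        s! : ∀ {z} → z ∈ₗ P → z ∈ ηev u v u → z ≡ x
        s! {z} i zu with z ≟ x | z ≟ y
        ... | yes eq | _ = eq
        ... | no _ | yes refl = ⊥-elim (y∉u zu)
        ... | no p | no q = ⊥-elim (proj₁ (proj₂ (int z (i , p , q))) zu)
        e! : ∀ {z} → z ∈ₗ P → z ∈ ηev u v v → z ≡ y
        e! {z} i zv with z ≟ x | z ≟ y
        ... | _ | yes eq = eq
        ... | yes refl | no _ = ⊥-elim (x∉v zv)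
        ... | no p | no q = ⊥-elim (proj₂ (proj₂ (int z (i , p , q))) zv)

    rung⇒ends : ∀ {u v P c b} → Rung u v P c b → RungEnds u v P
    rung⇒ends {c = c} {b} r with Rung.path r
    ... | one = inj₁ (c , refl , Rung.start r , Rung.end r)
    ... | p@(more {Q = Q} e far q) = inj₂ (c , b , ip⇒PathFT G p
        , start , (λ cv → c≢b (end! (here refl) cv))
        , end , (λ bu → c≢b (sym (start! (ip-last∈ G p) bu)))
        , λ z (i , z≢c , z≢b) → inside i , z≢c ∘ start! i , z≢b ∘ end! i)
      where
        open Rung r
        c≢b : c ≢ b
        c≢b = ip-distinct G [ c ] p (here refl) (ip-last∈ G q)

  IsRung⇒rung : ∀ {u v S} → IsRung G T a η u v S → ∃[ R ] ∃[ c ] ∃[ b ] Rung u v R c b × (∀ z → S z ⇔ z ∈ₗ R)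
  IsRung⇒rung (P , S⇔ , ins , ends) with ends⇒rung ins ends
  ... | c , b , r = P , c , b , r , S⇔

  IsLongRung⇒rung : ∀ {u v S} → IsLongRung G T a η u v S → ∃[ R ] ∃[ c ] ∃[ b ] Rung u v R c b × 2 ≤ length R
  IsLongRung⇒rung (P , S⇔ , l , ins , ends) with ends⇒rung ins ends
  ... | c , b , r = P , c , b , r , l

  rung⇒IsRung : ∀ {u v R c b} {S : Fin n → Set} → Rung u v R c b → (∀ z → S z ⇔ z ∈ₗ R) → IsRung G T a η u v S
  rung⇒IsRung {R = R} r S⇔ = R , S⇔ , (λ _ → Rung.inside r) , rung⇒ends r

  rung⇒IsLongRung : ∀ {u v R c b} {S : Fin n → Set} → Rung u v R c b → 2 ≤ length R →
    (∀ z → S z ⇔ z ∈ₗ R) → IsLongRung G T a η u v S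
  rung⇒IsLongRung {R = R} r l S⇔ = R , S⇔ , l , (λ _ → Rung.inside r) , rung⇒ends r

  reverse-rung : ∀ {u v R c b} → ηe u v ≡ ηe v u → (∀ t → ηev u v t ≡ ηev v u t) →
    Rung u v R c b → Rung v u (reverse R) b c
  reverse-rung {u} {v} {R} esym evsym r = record
    { path = ip-reverse G path
    ; inside = λ i → subst (_ ∈_) esym (inside (rev i))
    ; start = subst (_ ∈_) (evsym v) end
    ; end = subst (_ ∈_) (evsym u) start
    ; start! = λ i j → end! (rev i) (subst (_ ∈_) (sym (evsym v)) j)
    ; end! = λ i j → start! (rev i) (subst (_ ∈_) (sym (evsym u)) j) }
    where
      open Rung r
      rev : ∀ {z} → z ∈ₗ reverse R → z ∈ₗ R
      rev = reverse⁻

  rung⇒start-path : ∀ {u v R c b x} → Rung u v R c b → x ∈ₗ R →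
    ∃[ P ] ∃[ y ] PathFT G P x y × y ∈ ηev u v u × (∀ z → z ∈ₗ P → z ∈ ηe u v)
      × (∀ z → Interior G P x y z → InCirc G T a η u v z)
  rung⇒start-path {c = c} {b} {x} r i with ∈-∃++ i
  ... | L , R' , refl with walk⇒ip G (walk-reverse G (ip-walk G (ip-prefix G L (Rung.path r))))
  ...   | P , p , ⊆L = P , c , ip⇒PathFT G p , start , (λ z j → inside (snoc⊆ L (⊆L j)))
    , λ z (j , z≢x , z≢c) → inside (snoc⊆ L (⊆L j)) , z≢c ∘ start! (snoc⊆ L (⊆L j)) ,
        λ zv → before (∈-++⁻ L (⊆L j)) z≢x (end! (snoc⊆ L (⊆L j)) zv)
    where
      open Rung r
      before : ∀ {z} → z ∈ₗ L ⊎ z ∈ₗ [ x ] → z ≢ x → z ≢ b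
      before (inj₁ k) _ = ip-distinct G L path k (ip-last∈ G (ip-suffix G L path))
      before (inj₂ (here eq)) ne = ⊥-elim (ne eq)

  At : Fin m → Fin m → Fin n → Set
  At v w z = ∃[ x ] ∃[ y ] E T x y × EDir v w x y × z ∈ ηe x y

  Sep : Fin m → Fin m → Fin m → Fin n → Fin n → Set
  Sep v w₁ w₂ z₁ z₂ = E T v w₁ × E T v w₂ × w₁ ≢ w₂ × At v w₁ z₁ × At v w₂ z₂ × ¬ (B v z₁ × B v z₂)

  SepPair : Fin n → Fin n → Set
  SepPair z₁ z₂ = ∃[ v ] ∃[ w₁ ] ∃[ w₂ ] Sep v w₁ w₂ z₁ z₂

  sep-sym : ∀ {v w₁ w₂ z₁ z₂} → Sep v w₁ w₂ z₁ z₂ → Sep v w₂ w₁ z₂ z₁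
  sep-sym (e₁ , e₂ , ne , at₁ , at₂ , nb) = e₂ , e₁ , ne ∘ sym , at₂ , at₁ , λ (p , q) → nb (q , p)

  OnEdge : Fin n → Set
  OnEdge z = ∃[ x ] ∃[ y ] E T x y × z ∈ ηe x y

  onEdge? : Decidable OnEdge
  onEdge? z = any? λ x → any? λ y → E? T x y ×-dec z ∈? ηe x y

  Local : (Fin n → Set) → Set
  Local N = (∃[ v ] ∀ z → N z → B v z) ⊎ (∃[ x ] ∃[ y ] E T x y × (∀ z → N z → z ∈ ηe x y))

  local? : ∀ {N} → Decidable N → Dec (Local N)
  local? N? = any? (λ v → all? λ z → N? z →-dec inB? v z)
        ⊎-dec any? (λ x → any? λ y → E? T x y ×-dec all? λ z → N? z →-dec z ∈? ηe x y)

  module Facts (S : IsStrip G T a η) where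
    open IsStrip S

    rung-reverse : ∀ {u v R c b} → E T u v → Rung u v R c b → Rung v u (reverse R) b c
    rung-reverse e = reverse-rung (ηe-sym _ _ e) (λ t → ηev-sym _ _ t e)

    same-ηe : ∀ {u v x y z} → E T u v → SameEdge T u v x y → z ∈ ηe u v → z ∈ ηe x y
    same-ηe e (inj₁ (refl , refl)) i = i
    same-ηe e (inj₂ (refl , refl)) i = subst (_ ∈_) (ηe-sym _ _ e) i

    same-ηev : ∀ {u v x y t z} → E T u v → SameEdge T u v x y → z ∈ ηev u v t → z ∈ ηev x y t
    same-ηev e (inj₁ (refl , refl)) i = i
    same-ηev e (inj₂ (refl , refl)) i = subst (_ ∈_) (ηev-sym _ _ _ e) i

    same-edge : ∀ {u v x y z} → E T u v → E T x y → z ∈ ηe u v → z ∈ ηe x y → SameEdge T u v x y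
    same-edge {u} {v} {x} {y} e e' i j with sameEdge? u v x y
    ... | yes s = s
    ... | no ns = ⊥-elim (S1-ee u v x y e e' ns _ i j)

    ev-end : ∀ {u v t z} → E T u v → z ∈ ηev u v t → t ≡ u ⊎ t ≡ v
    ev-end e i = Equivalence.to (S3-ne _ _ _ e) (_ , i)

    ev-exists : ∀ u v → E T u v → ∃[ z ] z ∈ ηev u v u
    ev-exists u v e = Equivalence.from (S3-ne u v u e) (inj₁ refl)

    ev⇒e : ∀ {u v t z} → E T u v → z ∈ ηev u v t → z ∈ ηe u v
    ev⇒e e i = S3-sub _ _ _ e _ i

    B⇒ev : ∀ {v x y z} → E T x y → z ∈ ηe x y → B v z → z ∈ ηev x y v
    B⇒ev e i (u , e' , j) = same-ηev e' (same-edge e' e (ev⇒e e' j) i) j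

    ev⇒B : ∀ {v x y z} → E T x y → z ∈ ηev x y v → B v z
    ev⇒B e i with ev-end e i
    ... | inj₁ refl = _ , e , i
    ... | inj₂ refl = _ , E-sym T e , subst (_ ∈_) (ηev-sym _ _ _ e) i

    B⇒end : ∀ {v x y z} → E T x y → z ∈ ηe x y → B v z → v ≡ x ⊎ v ≡ y
    B⇒end e i b = ev-end e (B⇒ev e i b)

    B⇒OnEdge : ∀ {v z} → B v z → OnEdge z
    B⇒OnEdge (u , e , i) = _ , u , e , ev⇒e e i

    OnEdge⇒inηT : ∀ {z} → OnEdge z → InηT G T a η z
    OnEdge⇒inηT = inj₂

    at-exists : ∀ v {z} → OnEdge z → ∃[ w ] E T v w × At v w z
    at-exists v (x , y , e , i) with edir-exists v e
    ... | w , vw , d = w , vw , x , y , e , d , i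

    at-unique : ∀ {v w w' z} → E T v w → E T v w' → At v w z → At v w' z → w ≡ w'
    at-unique e e' (x , y , xy , d , i) (x' , y' , xy' , d' , i') with same-edge xy xy' i i'
    ... | inj₁ (refl , refl) = edir-unique e e' xy d d'
    ... | inj₂ (refl , refl) = edir-unique e e' xy d (edir-swap d')

    cross : ∀ {v w₁ w₂ z₁ z₂} → E T v w₁ → E T v w₂ → w₁ ≢ w₂ → At v w₁ z₁ → At v w₂ z₂ →
      z₁ ≢ z₂ × (z₁ ~ z₂ → B v z₁ × B v z₂)
    cross {v} e₁ e₂ ne (x , y , e , d , i) (x' , y' , e' , d' , i') =
      (λ { refl → ns (same-edge e e' i i') }) , adj
      where
        ns : ¬ SameEdge T x y x' y'
        ns = edir-disjoint e₁ e₂ ne e e' d d'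
        adj : _ ~ _ → B v _ × B v _
        adj zz with S4-other x y x' y' e e' ns _ _ i i' zz
        ... | t , j , j' with edir-share e₁ e₂ ne e e' d d' (ev-end e j) (ev-end e' j')
        ...   | refl = ev⇒B e j , ev⇒B e' j'

    complete : ∀ {v w₁ w₂ z₁ z₂} → E T v w₁ → E T v w₂ → w₁ ≢ w₂ → z₁ ∈ ηev v w₁ v → z₂ ∈ ηev v w₂ v → z₁ ~ z₂
    complete {v} {w₁} {w₂} e₁ e₂ ne i j =
      S4-comp v w₁ v w₂ e₁ e₂ (λ { (inj₁ (_ , p)) → ne p ; (inj₂ (p , q)) → ne (trans q p) }) v _ _ i j

    at-ev : ∀ {v w z} → E T v w → z ∈ ηe v w → At v w z
    at-ev e i = _ , _ , e , edir-self e , i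

    sep⊥local : ∀ {N : Fin n → Set} → Local N → ∀ {z₁ z₂} → N z₁ → N z₂ → ¬ SepPair z₁ z₂
    sep⊥local (inj₁ (t , sub)) n₁ n₂ (v , w₁ , w₂ , e₁ , e₂ , ne , (x , y , e , d , i) , (x' , y' , e' , d' , i') , nb)
      with edir-share e₁ e₂ ne e e' d d' (B⇒end e i (sub _ n₁)) (B⇒end e' i' (sub _ n₂))
    ... | refl = nb (sub _ n₁ , sub _ n₂)
    sep⊥local (inj₂ (s , t , st , sub)) n₁ n₂ (v , w₁ , w₂ , e₁ , e₂ , ne , (x , y , e , d , i) , (x' , y' , e' , d' , i') , nb) =
      edir-disjoint e₁ e₂ ne e e' d d' (same-trans (same-edge e st i (sub _ n₁)) (same-sym (same-edge e' st i' (sub _ n₂))))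

    no-sep⇒local : ∀ {N : Fin n → Set} → Decidable N → (∀ {z} → N z → OnEdge z) →
      (∀ {z₁ z₂} → N z₁ → N z₂ → ¬ SepPair z₁ z₂) → Local N
    no-sep⇒local {N} N? on nosep with any? N?
    ... | no none = inj₁ (some-vertex (proj₁ (proj₂ smooth)) , λ z nz → ⊥-elim (none (z , nz)))
      where
        some-vertex : ∀ {k} → 3 ≤ k → Fin k
        some-vertex (s≤s _) = zero
    ... | yes (z , nz) with on nz
    ...   | x , y , e , i with any? (λ z' → N? z' ×-dec ¬? (z' ∈? ηe x y))
    ...     | no none = inj₂ (x , y , e , λ z' nz' → decidable-stable (z' ∈? ηe x y) λ ni → none (z' , nz' , ni))
    ...     | yes (z' , nz' , ni) with on nz'
    ...       | x' , y' , e' , i' with separator e e' (λ s → ni (same-ηe e' (same-sym s) i'))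
    ...         | v , w₁ , w₂ , e₁ , e₂ , ne , d , d' , _ = inj₁ (v , allB)
      where
        both : B v z × B v z'
        both = decidable-stable (inB? v z ×-dec inB? v z')
          λ nb → nosep nz nz' (v , w₁ , w₂ , e₁ , e₂ , ne , (x , y , e , d , i) , (x' , y' , e' , d' , i') , nb)
        allB : ∀ t → N t → B v t
        allB t nt with at-exists v (on nt)
        ... | w₃ , e₃ , at₃ with w₃ ≟ w₁
        ...   | no ne₃ = decidable-stable (inB? v t) λ nb →
                  nosep nt nz (v , w₃ , w₁ , e₃ , e₁ , ne₃ , at₃ , (x , y , e , d , i) , nb ∘ proj₁)
        ...   | yes refl = decidable-stable (inB? v t) λ nb →
                  nosep nt nz' (v , w₃ , w₂ , e₃ , e₂ , ne , at₃ , (x' , y' , e' , d' , i') , nb ∘ proj₁)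

    module _ (rich : Rich G T a η) where

      private
        trapped = proj₁ rich

      N[a]⊆ : ∀ {x} → a ~ x → InηT⁺ G T a η x
      N[a]⊆ = proj₁ (proj₂ trapped) _

      N²[a]⊆ : ∀ {x y} → a ~ x → x ~ y → InηT⁺ G T a η y
      N²[a]⊆ = proj₁ (proj₂ (proj₂ trapped)) _ _

      a∉OnEdge : ¬ OnEdge a
      a∉OnEdge (x , y , e , i) = a∉e x y e i

      -- Otherwise a vertex of η(e,l) ∩ B(v), with e = lv and l a leaf, would have degree at least three.
      a≁B : ∀ {v z} → ¬ Leaf T v → B v z → Far G a z
      a≁B {v} {z} nl b@(_ , e₀ , i₀) = (λ { refl → a∉OnEdge (_ , _ , e₀ , ev⇒e e₀ i₀) }) , λ az → contra az
        where
          contra : ¬ a ~ z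
          contra az with S8-other z (OnEdge⇒inηT (B⇒OnEdge b)) az
          ... | l , u , leaf , lu , i with B⇒end lu (ev⇒e lu i) b
          ...   | inj₁ refl = nl leaf
          ...   | inj₂ refl with next nl l
          ...     | t₁ , e₁ , ne₁ with third (E-sym T lu) e₁ (ne₁ ∘ sym)
          ...       | t₂ , e₂ , ne₂ , ne₁₂ with ev-exists v t₁ e₁ | ev-exists v t₂ e₂
          ...         | x₁ , i₁ | x₂ , i₂ with proj₂ (proj₂ (proj₂ trapped)) z az
          ...           | p , q , _ , _ , _ , _ , _ , only =
            three (only a (inj₁ refl) (E-sym G az))
                  (only x₁ (inj₂ (OnEdge⇒inηT (v , t₁ , e₁ , ev⇒e e₁ i₁))) (complete vl e₁ (ne₁ ∘ sym) zv i₁))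
                  (only x₂ (inj₂ (OnEdge⇒inηT (v , t₂ , e₂ , ev⇒e e₂ i₂))) (complete vl e₂ (ne₂ ∘ sym) zv i₂))
            where
              vl : E T v l
              vl = E-sym T lu
              zv : z ∈ ηev v l v
              zv = B⇒ev vl (ev⇒e vl (subst (z ∈_) (ηev-sym l v l lu) i)) b
              n₁ : a ≢ x₁
              n₁ refl = a∉OnEdge (v , t₁ , e₁ , ev⇒e e₁ i₁)
              n₂ : a ≢ x₂
              n₂ refl = a∉OnEdge (v , t₂ , e₂ , ev⇒e e₂ i₂)
              n₃ : x₁ ≢ x₂
              n₃ = proj₁ (cross e₁ e₂ (ne₁₂ ∘ sym) (at-ev e₁ (ev⇒e e₁ i₁)) (at-ev e₂ (ev⇒e e₂ i₂)))
              three : a ≡ p ⊎ a ≡ q → x₁ ≡ p ⊎ x₁ ≡ q → x₂ ≡ p ⊎ x₂ ≡ q → ⊥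
              three (inj₁ r) (inj₁ s) _ = n₁ (trans r (sym s))
              three (inj₂ r) (inj₂ s) _ = n₁ (trans r (sym s))
              three (inj₁ r) _ (inj₁ s) = n₂ (trans r (sym s))
              three (inj₂ r) _ (inj₂ s) = n₂ (trans r (sym s))
              three _ (inj₁ r) (inj₁ s) = n₃ (trans r (sym s))
              three _ (inj₂ r) (inj₂ s) = n₃ (trans r (sym s))

module Arms {n m : ℕ} (G : Graph n) (a : Fin n) (T : Graph m) (smooth : Smooth T) (η : StripData n m)
  (S : IsStrip G T a η) (tame : Tame G T a η) (substantial : Substantial G T a η) (rich : Rich G T a η) where

  open StripData η
  open IsStrip S
  open Trees T smooth
  open Strips G a T smooth η
  open Facts S

  private
    _~_ : Fin n → Fin n → Set
    _~_ = E G

  long-rung : ∀ {u v} → E T u v → ∃[ R ] ∃[ c ] ∃[ b ] Rung u v R c b × 2 ≤ length R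
  long-rung {u} {v} e = IsLongRung⇒rung (proj₂ (substantial u v e))

  rung-through : ∀ {u v z} → E T u v → z ∈ ηe u v → ∃[ R ] ∃[ c ] ∃[ b ] Rung u v R c b × z ∈ₗ R
  rung-through {u} {v} {z} e i with proj₂ tame u v e z i
  ... | X , r , z∈X with IsRung⇒rung r
  ...   | R , c , b , r' , X⇔ = R , c , b , r' , Equivalence.to (X⇔ z) z∈X

  -- Rungs along a path w ∷ Λ of T which starts at w, avoids v and ends in a leaf; Γ is their union, leaf side first.
  data Beyond : (v w : Fin m) → List (Fin n) → List (Fin m) → Set where
    tip : ∀ {v w} → Leaf T w → Beyond v w [] []
    arm : ∀ {v w w' Γ Λ R c b} → E T w w' → w' ≢ v → Beyond w w' Γ Λ → Rung w' w R c b →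
          Beyond v w (Γ ++ R) (w' ∷ Λ)

  arm-in : ∀ {v w Γ Λ R c b z} → E T v w → Beyond v w Γ Λ → Rung w v R c b → z ∈ₗ Γ ++ R →
    ∃[ x ] ∃[ y ] Consec T (v ∷ w ∷ Λ) x y × E T x y × EDir v w x y × z ∈ ηe x y
  arm-in {v} {w} e (tip l) r i =
    v , w , inj₁ (refl , refl) , e , edir-self e , subst (_ ∈_) (ηe-sym w v (E-sym T e)) (Rung.inside r i)
  arm-in {v} {w} e (arm {Γ = Γ} {R = R} e' ne bey r') r i with ∈-++⁻ (Γ ++ R) i
  ... | inj₂ j = v , w , inj₁ (refl , refl) , e , edir-self e , subst (_ ∈_) (ηe-sym w v (E-sym T e)) (Rung.inside r j)
  ... | inj₁ j with arm-in e' bey r' j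
  ...   | x , y , con , xy , d , k = x , y , inj₂ con , xy , edir-beyond e e' ne d , k

  arm-at : ∀ {v w Γ Λ R c b z} → E T v w → Beyond v w Γ Λ → Rung w v R c b → z ∈ₗ Γ ++ R → At v w z
  arm-at e bey r i with arm-in e bey r i
  ... | x , y , _ , xy , d , k = x , y , xy , d , k

  at-beyond∉ : ∀ {v w w' z} → E T v w → E T w w' → w' ≢ v → At w w' z → ¬ B v z
  at-beyond∉ e e' ne (x , y , xy , d , i) b = edir-beyond≢ e e' ne xy d (B⇒end xy i b) refl

  at-beyond∉e : ∀ {v w w' z} → E T v w → E T w w' → w' ≢ v → At w w' z → z ∉ ηe v w
  at-beyond∉e e e' ne at i =
    ne (at-unique e' (E-sym T e) at (at-ev (E-sym T e) (subst (_ ∈_) (ηe-sym _ _ e) i)))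

  beyond-∉e : ∀ {v w Γ Λ z} → E T v w → Beyond v w Γ Λ → z ∈ₗ Γ → z ∉ ηe v w
  beyond-∉e e (arm e' ne bey r) i = at-beyond∉e e e' ne (arm-at e' bey r i)

  arm-B : ∀ {v w Γ Λ R c b z} → E T v w → Beyond v w Γ Λ → Rung w v R c b → z ∈ₗ Γ ++ R → B v z → z ≡ b
  arm-B {v} {w} {Γ} e bey r i b with ∈-++⁻ Γ i
  ... | inj₂ j = Rung.end! r j (B⇒ev (E-sym T e) (Rung.inside r j) b)
  arm-B e (arm e' ne bey r') r i b | inj₁ j = ⊥-elim (at-beyond∉ e e' ne (arm-at e' bey r' j) b)

  end∈B : ∀ {v w R c b} → E T v w → Rung w v R c b → B v b
  end∈B e r = ev⇒B (E-sym T e) (Rung.end r)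

  arm-path : ∀ {v w Γ Λ R c b} → E T v w → ¬ Leaf T v → Beyond v w Γ Λ → Rung w v R c b →
    IP G a b (a ∷ Γ ++ R)
  arm-path {v} {w} {R = R} {c} e nl (tip l) r =
    ip-++ G one path (S8-comp w v l (E-sym T e) c start) X
    where
      open Rung r
      X : ∀ {p q} → p ∈ₗ [ a ] → q ∈ₗ R → p ≢ q × (p ~ q → p ≡ a × q ≡ c)
      X {q = q} (here refl) j = (λ { refl → a∉e w v (E-sym T e) (inside j) }) , adj
        where
          adj : a ~ q → a ≡ a × q ≡ c
          adj aq with S8-other q (OnEdge⇒inηT (w , v , E-sym T e , inside j)) aq
          ... | l' , u , leaf , lu , i with same-edge lu (E-sym T e) (ev⇒e lu i) (inside j)
          ...   | inj₁ (refl , refl) = refl , start! j i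
          ...   | inj₂ (refl , refl) = ⊥-elim (nl leaf)
  arm-path {v} {w} {R = R} {c} e nl (arm {w' = w'} {Γ = Γ} {R = R'} {b = b'} e' ne bey r') r =
    ip-++ G (arm-path e' nlw bey r') path b'~c X
    where
      open Rung r
      nlw : ¬ Leaf T w
      nlw = two⇒¬leaf (E-sym T e) e' (ne ∘ sym)
      b'~c : b' ~ c
      b'~c = complete e' (E-sym T e) ne (subst (b' ∈_) (ηev-sym w' w w (E-sym T e')) (Rung.end r')) start
      X : ∀ {p q} → p ∈ₗ a ∷ Γ ++ R' → q ∈ₗ R → p ≢ q × (p ~ q → p ≡ b' × q ≡ c)
      X {q = q} (here refl) j = (λ { refl → a∉e w v (E-sym T e) (inside j) }) , adj
        where
          adj : a ~ q → a ≡ b' × q ≡ c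
          adj aq with S8-other q (OnEdge⇒inηT (w , v , E-sym T e , inside j)) aq
          ... | l' , u , leaf , lu , i with same-edge lu (E-sym T e) (ev⇒e lu i) (inside j)
          ...   | inj₁ (refl , refl) = ⊥-elim (nlw leaf)
          ...   | inj₂ (refl , refl) = ⊥-elim (nl leaf)
      X (there i) j with cross e' (E-sym T e) ne (arm-at e' bey r' i) (at-ev (E-sym T e) (inside j))
      ... | ne' , h = ne' , λ pq → let bp , bq = h pq in
                        arm-B e' bey r' i bp , start! j (B⇒ev (E-sym T e) (inside j) bq)

  arm-rung : ∀ {v w Γ Λ R c b} → E T v w → Beyond v w Γ Λ → Rung w v R c b → ∀ {x y} → Consec T (v ∷ w ∷ Λ) x y →
    E T x y × EDir v w x y × (∃[ R' ] ∃[ c' ] ∃[ b' ] Rung y x R' c' b' ×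
      (∀ z → (z ∈ₗ Γ ++ R × z ∈ ηe x y) ⇔ z ∈ₗ R'))
  arm-rung {v} {w} {Γ} {R = R} e bey r (inj₁ (refl , refl)) =
    e , edir-self e , R , _ , _ , r , λ z → mk⇔ to
      (λ i → ∈-++⁺ʳ Γ i , subst (z ∈_) (ηe-sym w v (E-sym T e)) (Rung.inside r i))
    where
      to : ∀ {z} → z ∈ₗ Γ ++ R × z ∈ ηe v w → z ∈ₗ R
      to (i , k) with ∈-++⁻ Γ i
      ... | inj₁ j = ⊥-elim (beyond-∉e e bey j k)
      ... | inj₂ j = j
  arm-rung {v} {w} {R = R} e (arm {w' = w'} {Γ = Γ} {R = R₁} e' ne bey r') r (inj₂ con) with arm-rung e' bey r' con
  ... | xy , d , R' , c' , b' , r'' , h =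
    xy , edir-beyond e e' ne d , R' , c' , b' , r'' , λ z → mk⇔ to
      (λ i → ∈-++⁺ˡ (proj₁ (Equivalence.from (h z) i)) , proj₂ (Equivalence.from (h z) i))
    where
      to : ∀ {z} → z ∈ₗ (Γ ++ R₁) ++ R × z ∈ ηe _ _ → z ∈ₗ R'
      to {z} (i , k) with ∈-++⁻ (Γ ++ R₁) i
      ... | inj₁ j = Equivalence.to (h z) (j , k)
      ... | inj₂ j = ⊥-elim (at-beyond∉e e e' ne (_ , _ , xy , d , k)
                       (subst (z ∈_) (ηe-sym w v (E-sym T e)) (Rung.inside r j)))

  beyond-tree : ∀ {v w Γ Λ} → E T v w → Beyond v w Γ Λ →
    ∃[ l ] Leaf T l × IP T v l (v ∷ w ∷ Λ) × (∀ {t} → t ∈ₗ w ∷ Λ → Dir v w t)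
  beyond-tree {w = w} e (tip l) = w , l , more e [] one , λ { (here refl) → dir-self e }
  beyond-tree {v} {w} e (arm {w' = w'} {Λ = Λ} e' ne bey r) with beyond-tree e' bey
  ... | l , leaf , p , dir = l , leaf , more e (tabulate far) p , dir'
    where
      far : ∀ {t} → t ∈ₗ w' ∷ Λ → Far T v t
      far i = dir-beyond≢ e e' ne (dir i) ∘ sym ,
              λ vt → walk-end T (dir i) (sym (dir-unique e vt (dir-beyond e e' ne (dir i)) (dir-self vt)))
      dir' : ∀ {t} → t ∈ₗ w ∷ w' ∷ Λ → Dir v w t
      dir' (here refl) = dir-self e
      dir' (there i) = dir-beyond e e' ne (dir i)

  beyond-exists : ∀ {v w} → E T v w → ∃[ Γ ] ∃[ Λ ] Beyond v w Γ Λ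
  beyond-exists {v} {w} e = grow m (more (E-sym T e) [] one) (ℕ.m<m+n m (s≤s z≤n))
    where
      grow : ∀ k {v w r Q} → IP T w r (w ∷ v ∷ Q) → m < k Data.Nat.+ length (w ∷ v ∷ Q) →
        ∃[ Γ ] ∃[ Λ ] Beyond v w Γ Λ
      grow zero p l = ⊥-elim (ℕ.<⇒≱ l (ip-length T p))
      grow (suc k) {v} {w} {r} {Q} p@(more wv far q) l with leaf? w
      ... | yes leaf = [] , [] , tip leaf
      ... | no nl with next nl v
      ...   | w' , ww' , ne with grow k (more (E-sym T ww') (tabulate far') p)
                                  (subst (m <_) (sym (ℕ.+-suc k _)) l)
        where
          away : ∀ {s} → s ∈ₗ v ∷ Q → s ≢ w
          away (here refl) = E⇒≢ T wv ∘ sym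
          away (there i) = proj₁ (lookupAll far i) ∘ sym
          dir : ∀ {t} → t ∈ₗ v ∷ Q → Dir w v t
          dir i = walk-map T away (ip-connected T q (ip-first∈ T q) i)
          far' : ∀ {t} → t ∈ₗ v ∷ Q → Far T w' t
          far' i = (λ { refl → ne (dir-unique ww' wv (dir-self ww') (dir i)) }) ,
                   λ w't → ne (dir-unique ww' wv (dir-self ww')
                               (dir-step (dir i) (E-sym T w't) (E⇒≢ T ww' ∘ sym)))
      ...     | Γ , Λ , bey with long-rung (E-sym T ww')
      ...       | R , c , b , r' , _ = Γ ++ R , w' ∷ Λ , arm ww' ne bey r'

  record Arm (v w : Fin m) : Set where
    field
      {Γ R} : List (Fin n)
      {Λ} : List (Fin m)
      {c b} : Fin n
      edge : E T v w
      beyond : Beyond v w Γ Λ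
      rung : Rung w v R c b
    list : List (Fin n)
    list = Γ ++ R

  arm-extend : ∀ {v w w'} → E T v w → w' ≢ v → (A : Arm w w') →
    Σ (Arm v w) λ A' → ∀ {z} → z ∈ₗ Arm.list A → z ∈ₗ Arm.list A'
  arm-extend e ne A with long-rung (E-sym T e)
  ... | R , c , b , r , _ =
    record { edge = e ; beyond = arm (Arm.edge A) ne (Arm.beyond A) (Arm.rung A) ; rung = r } , ∈-++⁺ˡ

  arm-with-rung : ∀ {v w R c b} → E T v w → Rung w v R c b →
    Σ (Arm v w) λ A → Arm.R A ≡ R × Arm.b A ≡ b
  arm-with-rung e r with beyond-exists e
  ... | Γ , Λ , bey = record { edge = e ; beyond = bey ; rung = r } , refl , refl

  arm-through-edge : ∀ {v w z} → E T v w → z ∈ ηe v w → Σ (Arm v w) λ A → z ∈ₗ Arm.list A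
  arm-through-edge {v} {w} e i with rung-through (E-sym T e) (subst (_ ∈_) (ηe-sym v w e) i)
  ... | R , c , b , r , j with arm-with-rung e r
  ...   | A , refl , _ = A , ∈-++⁺ʳ (Arm.Γ A) j

  private
   arm-towards : ∀ {v w x y z} → E T v w → E T x y → Dir v w x → z ∈ ηe x y → Σ (Arm v w) λ A → z ∈ₗ Arm.list A
   arm-towards {v} {w} {x} {y} {z} e xy d i with walk⇒ip T d
   ... | P , p , avoid = through p avoid e (inj₁ refl)
    where
      through : ∀ {v w u P} → IP T w u P → (∀ {t} → t ∈ₗ P → t ≢ v) → E T v w → u ≡ x ⊎ u ≡ y →
        Σ (Arm v w) λ A → z ∈ₗ Arm.list A
      through {v} {w} p avoid e end with sameEdge? x y v w
      ... | yes s = arm-through-edge e (same-ηe xy s i)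
      through {v} {w} one avoid e (inj₁ refl) | no ns with arm-through-edge xy i
      ... | A , j with arm-extend e (λ { refl → ns (inj₂ (refl , refl)) }) A
      ...   | A' , ⊆ = A' , ⊆ j
      through {v} {w} one avoid e (inj₂ refl) | no ns with arm-through-edge (E-sym T xy) (subst (z ∈_) (ηe-sym x y xy) i)
      ... | A , j with arm-extend e (λ { refl → ns (inj₁ (refl , refl)) }) A
      ...   | A' , ⊆ = A' , ⊆ j
      through {v} {w} (more {y = w₁} {Q = Q} ww₁ far q) avoid e end | no ns
        with through q away ww₁ end
        where
          away : ∀ {t} → t ∈ₗ w₁ ∷ Q → t ≢ w
          away (here refl) = E⇒≢ T ww₁ ∘ sym
          away (there k) = proj₁ (lookupAll far k) ∘ sym
      ... | A , j with arm-extend e (avoid (there (here refl))) A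
      ...   | A' , ⊆ = A' , ⊆ j

  arm-through : ∀ {v w z} → E T v w → At v w z → Σ (Arm v w) λ A → z ∈ₗ Arm.list A
  arm-through e (x , y , xy , inj₁ d , i) = arm-towards e xy d i
  arm-through e (x , y , xy , inj₂ d , i) = arm-towards e (E-sym T xy) d (subst (_ ∈_) (ηe-sym x y xy) i)

module Jewels {n m : ℕ} (G : Graph n) (tf : ThetaFree G) (pf : PrismFree G) (a : Fin n)
  (T : Graph m) (smooth : Smooth T) (η : StripData n m)
  (S : IsStrip G T a η) (tame : Tame G T a η) (substantial : Substantial G T a η) (rich : Rich G T a η) where

  open StripData η
  open IsStrip S
  open Trees T smooth
  open Strips G a T smooth η
  open Facts S
  open Arms G a T smooth η S tame substantial rich
  open Pyramids G tf pf a

  private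
    _~_ : Fin n → Fin n → Set
    _~_ = E G

  outside⇒¬OnEdge : ∀ {d} → ¬ InηT⁺ G T a η d → ∀ {z} → OnEdge z → d ≢ z
  outside⇒¬OnEdge out on refl = out (inj₂ (OnEdge⇒inηT on))

  outside-far-a : ∀ {d} → ¬ InηT⁺ G T a η d → Far G d a
  outside-far-a out = out ∘ inj₁ , λ da → out (N[a]⊆ rich (E-sym G da))

  at⇒OnEdge : ∀ {v w z} → At v w z → OnEdge z
  at⇒OnEdge (x , y , e , _ , i) = x , y , e , i

  module _ {v w : Fin m} (A : Arm v w) where
    open Arm A

    at : ∀ {z} → z ∈ₗ list → At v w z
    at = arm-at edge beyond rung

    atB : ∀ {z} → z ∈ₗ list → B v z → z ≡ b
    atB = arm-B edge beyond rung

    b∈B : B v b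
    b∈B = end∈B edge rung

    b∈ev : b ∈ ηev v w v
    b∈ev = subst (b ∈_) (ηev-sym w v v (E-sym T edge)) (Rung.end rung)

    apath : ¬ Leaf T v → IP G a b (a ∷ list)
    apath nl = arm-path edge nl beyond rung

    apath-long : ¬ Leaf T v → 3 ≤ length (a ∷ list)
    apath-long nl = long (apath nl)
      where
        long : ∀ {P} → IP G a b P → 3 ≤ length P
        long one = ⊥-elim (proj₁ (a≁B rich nl b∈B) refl)
        long (more e _ one) = ⊥-elim (proj₂ (a≁B rich nl b∈B) e)
        long (more _ _ (more _ _ _)) = s≤s (s≤s (s≤s z≤n))

  arms-cross : ∀ {v w₁ w₂} → w₁ ≢ w₂ → (A₁ : Arm v w₁) (A₂ : Arm v w₂) →
    Cross (Arm.list A₁) (Arm.b A₁) (Arm.list A₂) (Arm.b A₂)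
  arms-cross ne A₁ A₂ i j with cross (Arm.edge A₁) (Arm.edge A₂) ne (at A₁ i) (at A₂ j)
  ... | ne' , h = ne' , λ e → let p , q = h e in atB A₁ i p , atB A₂ j q

  arms-pyramid : ∀ {v w₁ w₂ w₃} → w₁ ≢ w₂ → w₃ ≢ w₁ → w₃ ≢ w₂ →
    (A₁ : Arm v w₁) (A₂ : Arm v w₂) (A₃ : Arm v w₃) →
    Pyr (Arm.list A₁) (Arm.list A₂) (Arm.list A₃) (Arm.b A₁) (Arm.b A₂) (Arm.b A₃)
  arms-pyramid {v} n₁₂ n₃₁ n₃₂ A₁ A₂ A₃ = record
    { ip₁ = apath A₁ nl ; ip₂ = apath A₂ nl ; ip₃ = apath A₃ nl
    ; X₁₂ = arms-cross n₁₂ A₁ A₂ ; X₁₃ = arms-cross (n₃₁ ∘ sym) A₁ A₃ ; X₂₃ = arms-cross (n₃₂ ∘ sym) A₂ A₃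
    ; bb₁₂ = complete (Arm.edge A₁) (Arm.edge A₂) n₁₂ (b∈ev A₁) (b∈ev A₂)
    ; bb₁₃ = complete (Arm.edge A₁) (Arm.edge A₃) (n₃₁ ∘ sym) (b∈ev A₁) (b∈ev A₃)
    ; bb₂₃ = complete (Arm.edge A₂) (Arm.edge A₃) (n₃₂ ∘ sym) (b∈ev A₂) (b∈ev A₃)
    ; ab₁ = a≁B rich nl (b∈B A₁) ; ab₂ = a≁B rich nl (b∈B A₂) ; ab₃ = a≁B rich nl (b∈B A₃) }
    where
      nl : ¬ Leaf T v
      nl = two⇒¬leaf (Arm.edge A₁) (Arm.edge A₂) n₁₂

  private
    reverse⇔ : ∀ {R : List (Fin n)} {P : Fin n → Set} → (∀ z → P z ⇔ z ∈ₗ R) → ∀ z → P z ⇔ z ∈ₗ reverse R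
    reverse⇔ h z = mk⇔ (reverse⁺ ∘ Equivalence.to (h z)) (Equivalence.from (h z) ∘ reverse⁻)

    arm-of-pyramid : ∀ {v w} → ¬ Leaf T v → (A : Arm v w) → 2 ≤ length (Arm.R A) →
      PyramidArm v w (Arm.b A) (a ∷ Arm.list A)
    arm-of-pyramid {v} {w} nl A long with beyond-tree (Arm.edge A) (Arm.beyond A)
    ... | l , leaf , p , dir =
      b∈ev A , l , leaf , not-avoid edge (dir-l p) , v ∷ w ∷ Λ , ip⇒PathFT T p , list , refl , tail-path (apath A nl)
      , content
      , rung⇒IsLongRung (rung-reverse (E-sym T edge) rung) (subst (2 ≤_) (sym (length-reverse R)) long)
          (reverse⇔ first-rung)
      , other-rung
      where
        open Arm A
        dir-l : IP T v l (v ∷ w ∷ Λ) → Dir v w l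
        dir-l p = dir (ip-last∈ T (ip-suffix T [ v ] p))
        content : ∀ z → z ∈ₗ list → ∃[ x ] ∃[ y ] Consec T (v ∷ w ∷ Λ) x y × z ∈ ηe x y
        content z i with arm-in edge beyond rung i
        ... | x , y , con , _ , _ , k = x , y , con , k
        first-rung : ∀ z → (z ∈ₗ list × z ∈ ηe v w) ⇔ z ∈ₗ R
        first-rung = let _ , _ , _ , _ , _ , _ , h = arm-rung edge beyond rung (inj₁ (refl , refl)) in h
        other-rung : ∀ x y → Consec T (v ∷ w ∷ Λ) x y → ¬ SameEdge T x y v w →
          IsRung G T a η x y (λ z → z ∈ₗ list × z ∈ ηe x y)
        other-rung x y con _ with arm-rung edge beyond rung con
        ... | xy , _ , R' , _ , _ , r , h = rung⇒IsRung (rung-reverse (E-sym T xy) r) (reverse⇔ h)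
        tail-path : ∀ {P} → IP G a b (a ∷ P) → IsPath G P
        tail-path one = ⊥-elim (proj₁ (a≁B rich nl (b∈B A)) refl)
        tail-path (more _ _ q) = ip⇒IsPath G q

    jewel-nbrs : ∀ {Γ b q} → IP G a b (a ∷ Γ) → ¬ q ~ a → EndsIn Γ b q →
      ∀ x → x ∈ₗ a ∷ Γ → q ~ x ⇔ (x ≡ b ⊎ x ~ b)
    jewel-nbrs {b = b} {q} p qa (L , z , refl , qz , qb , none) x i = mk⇔ (to i) (from i)
      where
        zb : z ~ b
        zb = ip-adjacent G (a ∷ L) p
        to : x ∈ₗ a ∷ L ++ z ∷ b ∷ [] → q ~ x → x ≡ b ⊎ x ~ b
        to (here refl) e = ⊥-elim (qa e)
        to (there i) e with ∈-++⁻ L i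
        ... | inj₁ j = ⊥-elim (none _ j e)
        ... | inj₂ (here refl) = inj₂ zb
        ... | inj₂ (there (here refl)) = inj₁ refl
        from : x ∈ₗ a ∷ L ++ z ∷ b ∷ [] → x ≡ b ⊎ x ~ b → q ~ x
        from i (inj₁ refl) = qb
        from (here refl) (inj₂ e) = ⊥-elim (proj₂ (ip-far G (a ∷ L) p (here refl) (here refl)) e)
        from (there i) (inj₂ e) with ∈-++⁻ L i
        ... | inj₁ j = ⊥-elim (proj₂ (ip-far G (a ∷ L) p (there j) (here refl)) e)
        ... | inj₂ (here refl) = qz
        ... | inj₂ (there (here refl)) = qb

  arms⇒jewel : ∀ {v w₁ w₂ w₃} → w₁ ≢ w₂ → w₃ ≢ w₁ → w₃ ≢ w₂ →
    (A₁ : Arm v w₁) (A₂ : Arm v w₂) (A₃ : Arm v w₃) →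
    2 ≤ length (Arm.R A₁) → 2 ≤ length (Arm.R A₂) → 2 ≤ length (Arm.R A₃) →
    ∀ {q} → ¬ InηT⁺ G T a η q →
    EndsIn (Arm.list A₁) (Arm.b A₁) q → EndsIn (Arm.list A₂) (Arm.b A₂) q →
    (∀ {z} → z ∈ₗ Arm.list A₃ → ¬ q ~ z) → InJ G T a η q
  arms⇒jewel {v} {w₁} {w₂} {w₃} n₁₂ n₃₁ n₃₂ A₁ A₂ A₃ l₁ l₂ l₃ {q} out ends₁ ends₂ none₃ =
    out , v , ¬leaf⇒branch nl , triple w₁ w₂ w₃ , each (Arm.edge A₁) (Arm.edge A₂) (Arm.edge A₃) , inj
    , triple (Arm.b A₁) (Arm.b A₂) (Arm.b A₃) , triple (a ∷ Arm.list A₁) (a ∷ Arm.list A₂) (a ∷ Arm.list A₃)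
    , ( ( eachPair (E-sym G) bb₁₂ bb₁₃ bb₂₃
        , each (long A₁) (long A₂) (long A₃)
        , eachPair (λ f z i j → f z j i) (λ z i j → proj₁ (X₁₂ i j) refl) (λ z i j → proj₁ (X₁₃ i j) refl)
            (λ z i j → proj₁ (X₂₃ i j) refl)
        , eachPair (λ f x y i j e → let p , p' = f y x j i (E-sym G e) in p' , p)
            (λ x y i j → proj₂ (X₁₂ i j)) (λ x y i j → proj₂ (X₁₃ i j)) (λ x y i j → proj₂ (X₂₃ i j))
        , eachPair (λ f l l' → f l' l) (λ l _ → not-two A₁ l) (λ l _ → not-two A₁ l) (λ l _ → not-two A₂ l))
      , each (arm-of-pyramid nl A₁ l₁) (arm-of-pyramid nl A₂ l₂) (arm-of-pyramid nl A₃ l₃))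
    , ( each (∉ A₁) (∉ A₂) (∉ A₃)
      , (λ { x (here refl) → proj₂ (outside-far-a out) ; x (there i) → none₃ i })
      , each (λ _ → jewel-nbrs ip₁ (proj₂ (outside-far-a out)) ends₁)
             (λ _ → jewel-nbrs ip₂ (proj₂ (outside-far-a out)) ends₂)
             (λ ne → ⊥-elim (ne refl)))
    where
      open Pyr (arms-pyramid n₁₂ n₃₁ n₃₂ A₁ A₂ A₃)
      nl : ¬ Leaf T v
      nl = two⇒¬leaf (Arm.edge A₁) (Arm.edge A₂) n₁₂
      inj : ∀ i j → triple w₁ w₂ w₃ i ≡ triple w₁ w₂ w₃ j → i ≡ j
      inj zero zero _ = refl
      inj zero (suc zero) eq = ⊥-elim (n₁₂ eq)
      inj zero (suc (suc zero)) eq = ⊥-elim (n₃₁ (sym eq))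
      inj (suc zero) zero eq = ⊥-elim (n₁₂ (sym eq))
      inj (suc zero) (suc zero) _ = refl
      inj (suc zero) (suc (suc zero)) eq = ⊥-elim (n₃₂ (sym eq))
      inj (suc (suc zero)) zero eq = ⊥-elim (n₃₁ eq)
      inj (suc (suc zero)) (suc zero) eq = ⊥-elim (n₃₂ eq)
      inj (suc (suc zero)) (suc (suc zero)) _ = refl
      long : ∀ {w} (A : Arm v w) → PathFT G (a ∷ Arm.list A) a (Arm.b A) × 2 ≤ length (a ∷ Arm.list A)
      long A = ip⇒PathFT G (apath A nl) , ℕ.≤-trans (s≤s (s≤s z≤n)) (apath-long A nl)
      not-two : ∀ {w} (A : Arm v w) → length (a ∷ Arm.list A) ≢ 2
      not-two A eq = ℕ.<⇒≢ (apath-long A nl) (sym eq)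
      ∉ : ∀ {w} (A : Arm v w) → q ∉ₗ a ∷ Arm.list A
      ∉ A (here eq) = out (inj₁ eq)
      ∉ A (there i) = outside⇒¬OnEdge out (at⇒OnEdge (at A i)) refl

  private
    ends-within : ∀ {A : Set} (Γ : List A) {R L z b} → Γ ++ R ≡ L ++ z ∷ b ∷ [] → ¬ 2 ≤ length R → z ∈ₗ Γ
    ends-within [] {L = L} {z} {b} refl short = ⊥-elim (short (len L))
      where
        len : ∀ {A : Set} L {z b : A} → 2 ≤ length (L ++ z ∷ b ∷ [])
        len [] = s≤s (s≤s z≤n)
        len (_ ∷ L) = ℕ.≤-trans (len L) (ℕ.n≤1+n _)
    ends-within (_ ∷ Γ) {L = []} eq short = here (sym (proj₁ (∷-injective eq)))
    ends-within (_ ∷ Γ) {L = _ ∷ L} eq short = there (ends-within Γ {L = L} (proj₂ (∷-injective eq)) short)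

    ends-beyond : ∀ {A : Set} (Γ : List A) {R L z b t} → Γ ++ R ≡ L ++ z ∷ b ∷ [] → 2 ≤ length R → t ∈ₗ Γ → t ∈ₗ L
    ends-beyond (g ∷ []) {L = []} refl (s≤s ())
    ends-beyond (g ∷ _ ∷ []) {L = []} refl ()
    ends-beyond (g ∷ _ ∷ _ ∷ _) {L = []} ()
    ends-beyond (g ∷ Γ) {L = l ∷ L} eq long (here refl) = here (proj₁ (∷-injective eq))
    ends-beyond (g ∷ Γ) {L = l ∷ L} eq long (there i) = there (ends-beyond Γ {L = L} (proj₂ (∷-injective eq)) long i)

  -- Holds for a shortest path D among those whose ends q and r see a separated pair.
  Minimal : (D : List (Fin n)) (q r : Fin n) → Set
  Minimal D q r = ∀ {d₁ d₂ z₁ z₂} → d₁ ∈ₗ D → d₂ ∈ₗ D → d₁ ~ z₁ → d₂ ~ z₂ → SepPair z₁ z₂ →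
    (d₁ ≡ q × d₂ ≡ r) ⊎ (d₁ ≡ r × d₂ ≡ q)

  module Attach (D : List (Fin n)) (conn : ∀ {d d'} → d ∈ₗ D → d' ∈ₗ D → Walk G (_∈ₗ D) d d')
    (out : ∀ {d} → d ∈ₗ D → ¬ InηT⁺ G T a η d) where

    private
     module Oriented {q r} (q∈D : q ∈ₗ D) (r∈D : r ∈ₗ D) (minimal : Minimal D q r) {v w₁ w₂ w₃}
       (n₁₂ : w₁ ≢ w₂) (n₃₁ : w₃ ≢ w₁) (n₃₂ : w₃ ≢ w₂) (A₂ : Arm v w₂) (A₃ : Arm v w₃)
       {y : Fin n} (y∈ : y ∈ₗ Arm.list A₂) (ry : r ~ y) (ny : ¬ B v y) where

      ends : (A₁ : Arm v w₁) → ∀ {x} → x ∈ₗ Arm.list A₁ → q ~ x → ¬ B v x →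
        q ≡ r × EndsIn (Arm.list A₁) (Arm.b A₁) q × EndsIn (Arm.list A₂) (Arm.b A₂) r
          × (∀ {z} → z ∈ₗ Arm.list A₃ → ¬ q ~ z)
      ends A₁ {x} x∈ qx nx =
        let eq , end₁ , end₂ = linked⇒jewel π link x∈ qx x≢b y∈ ry y≢b
        in eq , end₁ , end₂ , λ i → c₃ q∈D i
        where
          π : Pyr (Arm.list A₁) (Arm.list A₂) (Arm.list A₃) (Arm.b A₁) (Arm.b A₂) (Arm.b A₃)
          π = arms-pyramid n₁₂ n₃₁ n₃₂ A₁ A₂ A₃
          x≢b : x ≢ Arm.b A₁
          x≢b refl = nx (b∈B A₁)
          y≢b : y ≢ Arm.b A₂
          y≢b refl = ny (b∈B A₂)
          e₁ = Arm.edge A₁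
          e₂ = Arm.edge A₂
          e₃ = Arm.edge A₃
          first : ∀ {d z} → d ∈ₗ D → d ~ z → SepPair z y → d ≡ q
          first i dz sp with minimal i r∈D dz ry sp
          ... | inj₁ (eq , _) = eq
          ... | inj₂ (eq , eq') = trans eq eq'
          second : ∀ {d z} → d ∈ₗ D → d ~ z → SepPair x z → d ≡ r
          second i dz sp with minimal q∈D i qx dz sp
          ... | inj₁ (_ , eq) = eq
          ... | inj₂ (eq , eq') = trans eq' eq
          c₁ : ∀ {d z} → d ∈ₗ D → z ∈ₗ Arm.list A₁ → d ~ z → d ≡ q
          c₁ i j dz = first i dz (v , w₁ , w₂ , e₁ , e₂ , n₁₂ , at A₁ j , at A₂ y∈ , ny ∘ proj₂)
          c₂ : ∀ {d z} → d ∈ₗ D → z ∈ₗ Arm.list A₂ → d ~ z → d ≡ r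
          c₂ i j dz = second i dz (v , w₁ , w₂ , e₁ , e₂ , n₁₂ , at A₁ x∈ , at A₂ j , nx ∘ proj₁)
          c₃ : ∀ {d z} → d ∈ₗ D → z ∈ₗ Arm.list A₃ → ¬ d ~ z
          c₃ i j dz with first i dz (v , w₃ , w₂ , e₃ , e₂ , n₃₂ , at A₃ j , at A₂ y∈ , ny ∘ proj₂)
                       | second i dz (v , w₁ , w₃ , e₁ , e₃ , n₃₁ ∘ sym , at A₁ x∈ , at A₃ j , nx ∘ proj₁)
          ... | refl | refl = three-arms⊥ π (outside-far-a (out i)) x∈ qx x≢b y∈ ry y≢b j dz
          link : Link₁₂ (Arm.list A₁) (Arm.list A₂) (Arm.list A₃) (_∈ₗ D) q r
          link = record
            { walk = conn q∈D r∈D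
            ; Da = λ i → outside-far-a (out i)
            ; D₁ = λ i j → outside⇒¬OnEdge (out i) (at⇒OnEdge (at A₁ j))
            ; D₂ = λ i j → outside⇒¬OnEdge (out i) (at⇒OnEdge (at A₂ j))
            ; D₃ = λ i j → outside⇒¬OnEdge (out i) (at⇒OnEdge (at A₃ j))
            ; Na = λ i dz az → out i (N²[a]⊆ rich az (E-sym G dz))
            ; c₁ = c₁ ; c₂ = c₂ ; c₃ = c₃ }

      -- With a short first rung, exchanging it for a long one would move b₁ but not the other neighbour of q.
      first-long : (A₁ : Arm v w₁) → ∀ {x} → x ∈ₗ Arm.list A₁ → q ~ x → ¬ B v x → 2 ≤ length (Arm.R A₁)
      first-long A₁ x∈ qx nx with 2 ℕ.≤? length (Arm.R A₁)
      ... | yes long = long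
      ... | no short with ends A₁ x∈ qx nx | long-rung (E-sym T (Arm.edge A₁))
      ...   | _ , (L , z , eq , qz , _ , _) , _ | R , c , b , r , long
        with ends (record { edge = Arm.edge A₁ ; beyond = Arm.beyond A₁ ; rung = r })
               (∈-++⁺ˡ z∈Γ) qz z∉B
        where
          z∈Γ : z ∈ₗ Arm.Γ A₁
          z∈Γ = ends-within (Arm.Γ A₁) eq short
          nl : ¬ Leaf T v
          nl = two⇒¬leaf (Arm.edge A₁) (Arm.edge A₂) n₁₂
          z∉B : ¬ B v z
          z∉B bz = E⇒≢ G (ip-adjacent G (a ∷ L) (subst (λ Γ → IP G a (Arm.b A₁) (a ∷ Γ)) eq (apath A₁ nl)))
                     (atB A₁ (∈-++⁺ˡ z∈Γ) bz)
      ...   | _ , (L' , z' , eq' , _ , _ , none) , _ =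
        ⊥-elim (none _ (ends-beyond (Arm.Γ A₁) eq' long (ends-within (Arm.Γ A₁) eq short)) qz)

    private
     oriented⊥ : ∀ {q r} → q ∈ₗ D → r ∈ₗ D → Minimal D q r → (q ≡ r → ¬ InJ G T a η q) →
       ∀ {v w₁ w₂ x y} → E T v w₁ → E T v w₂ → w₁ ≢ w₂ → At v w₁ x → At v w₂ y →
       q ~ x → r ~ y → ¬ B v x → ¬ B v y → ⊥
     oriented⊥ {q} {r} q∈D r∈D minimal nj {v} {w₁} {w₂} e₁ e₂ ne at₁ at₂ qx ry nx ny
       with third e₁ e₂ ne
     ... | w₃ , e₃ , n₃₁ , n₃₂ with arm-through e₁ at₁ | arm-through e₂ at₂ | long-rung (E-sym T e₃)
     ...   | A₁ , x∈ | A₂ , y∈ | R , c , b , rung , long with arm-with-rung e₃ rung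
     ...     | A₃ , refl , _ with Oriented.ends q∈D r∈D minimal ne n₃₁ n₃₂ A₂ A₃ y∈ ry ny A₁ x∈ qx nx
     ...       | refl , end₁ , end₂ , none₃ = nj refl (arms⇒jewel ne n₃₁ n₃₂ A₁ A₂ A₃
                   (Oriented.first-long q∈D r∈D minimal ne n₃₁ n₃₂ A₂ A₃ y∈ ry ny A₁ x∈ qx nx)
                   (Oriented.first-long r∈D q∈D min' (ne ∘ sym) n₃₂ n₃₁ A₁ A₃ x∈ qx nx A₂ y∈ ry ny)
                   long (out q∈D) end₁ end₂ none₃)
       where
         min' : Minimal D r q
         min' i j e e' sp with minimal i j e e' sp
         ... | inj₁ p = inj₂ p
         ... | inj₂ p = inj₁ p

    module Claims {q r} (q∈D : q ∈ₗ D) (r∈D : r ∈ₗ D) (minimal : Minimal D q r)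
      (nj : q ≡ r → ¬ InJ G T a η q) where

      Nbr : Fin n → Set
      Nbr z = ∃[ d ] d ∈ₗ D × d ~ z

      nbr? : Decidable Nbr
      nbr? z = any? λ d → anyL? (d ≟_) D ×-dec E? G d z

      meets-base : ∀ {v w₁ w₂ x y} → E T v w₁ → E T v w₂ → w₁ ≢ w₂ → At v w₁ x → At v w₂ y →
        Nbr x → Nbr y → ¬ B v y → B v x
      meets-base {v} {x = x} e₁ e₂ ne at₁ at₂ (d₁ , i₁ , d₁x) (d₂ , i₂ , d₂y) ny =
        decidable-stable (inB? v x) absurd
        where
          absurd : ¬ ¬ B v x
          absurd nx with minimal i₁ i₂ d₁x d₂y (v , _ , _ , e₁ , e₂ , ne , at₁ , at₂ , ny ∘ proj₂)
          ... | inj₁ (refl , refl) = oriented⊥ q∈D r∈D minimal nj e₁ e₂ ne at₁ at₂ d₁x d₂y nx ny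
          ... | inj₂ (refl , refl) = oriented⊥ q∈D r∈D minimal nj e₂ e₁ (ne ∘ sym) at₂ at₁ d₂y d₁x ny nx

      private
       sees-third : ∀ {v w₁ w₂ w₃ x y z} → E T v w₁ → E T v w₂ → w₁ ≢ w₂ → At v w₁ x → At v w₂ y →
         Nbr x → Nbr y → ¬ B v y → E T v w₃ → w₃ ≢ w₁ → w₃ ≢ w₂ → z ∈ ηev v w₃ v → Nbr z
       sees-third {v} {w₁} {w₂} {w₃} {x} {y} {z} e₁ e₂ ne at₁ at₂ nbx@(d₁ , i₁ , d₁x) nby@(d₂ , i₂ , d₂y) ny e₃ n₃₁ n₃₂ zv =
         decidable-stable (nbr? z) absurd
         where
           absurd : ¬ ¬ Nbr z
           absurd nz with arm-through e₁ at₁ | arm-through e₂ at₂ | arm-through e₃ (at-ev e₃ (ev⇒e e₃ zv))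
           ... | A₁ , x∈ | A₂ , y∈ | A₃ , z∈ =
             base-linked⊥ (arms-pyramid ne n₃₁ n₃₂ A₁ A₂ A₃) (conn i₁ i₂)
               (λ { i (inj₁ j) → outside⇒¬OnEdge (out i) (at⇒OnEdge (at A₁ j))
                  ; i (inj₂ j) → outside⇒¬OnEdge (out i) (at⇒OnEdge (at A₃ j)) })
               (λ i j dt → atB A₁ j (meets-base e₁ e₂ ne (at A₁ j) at₂ (_ , i , dt) nby ny))
               (λ {d} i j dt → nz (subst Nbr (trans (atB A₃ j (meets-base e₃ e₂ n₃₂ (at A₃ j) at₂ (d , i , dt) nby ny))
                                               (sym (atB A₃ z∈ (ev⇒B e₃ zv)))) (d , i , dt)))
               (subst (d₁ ~_) (atB A₁ x∈ (meets-base e₁ e₂ ne at₁ at₂ nbx nby ny)) d₁x)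
               y∈ d₂y (λ { refl → ny (b∈B A₂) })

      sees-base : ∀ {v w₁ w₂ w₃ x y z} → E T v w₁ → E T v w₂ → w₁ ≢ w₂ → At v w₁ x → At v w₂ y →
        Nbr x → Nbr y → ¬ B v y → E T v w₃ → w₃ ≢ w₂ → z ∈ ηev v w₃ v → Nbr z
      sees-base {v} {w₁} {w₂} {w₃} e₁ e₂ ne at₁ at₂ nbx nby ny e₃ n₃₂ zv with w₃ ≟ w₁
      ... | no n₃₁ = sees-third e₁ e₂ ne at₁ at₂ nbx nby ny e₃ n₃₁ n₃₂ zv
      ... | yes refl with third e₁ e₂ ne
      ...   | w₄ , e₄ , n₄₁ , n₄₂ with ev-exists v w₄ e₄
      ...     | z₄ , i₄ = sees-third e₄ e₂ n₄₂ (at-ev e₄ (ev⇒e e₄ i₄)) at₂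
                  (sees-third e₁ e₂ ne at₁ at₂ nbx nby ny e₄ n₄₁ n₄₂ i₄) nby ny e₁ (n₄₁ ∘ sym) ne zv

module Expandability {n m : ℕ} (G : Graph n) (a : Fin n) (T : Graph m) (smooth : Smooth T) (η : StripData n m) where

  open StripData η
  open Trees T smooth
  open Strips G a T smooth η

  private
    _~_ : Fin n → Fin n → Set
    _~_ = E G

  -- The path D from q to r can be added to η(uv) as a rung.
  NewRung : List (Fin n) → Fin n → Fin n → Fin m → Fin m → Set
  NewRung D q r u v = E T u v × ¬ Leaf T u × ¬ Leaf T v
    × (∀ d z → d ∈ₗ D → d ~ z → OnEdge z → z ∈ ηe u v ⊎ (d ≡ q × B u z) ⊎ (d ≡ r × B v z))
    × (∀ z → B u z → z ∉ ηe u v → q ~ z)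
    × (∀ z → B v z → z ∉ ηe u v → r ~ z)

  -- The path D from q to r, followed by the end of some rung, can be added to η(vw) as a rung.
  NewStart : List (Fin n) → Fin n → Fin n → Fin m → Fin m → Set
  NewStart D q r v w = E T v w × ¬ Leaf T v
    × (∀ d z → d ∈ₗ D → d ~ z → OnEdge z → (z ∈ ηe v w × (B v z ⊎ d ≡ r)) ⊎ (d ≡ q × B v z))
    × (∀ z → B v z → z ∉ ηe v w → q ~ z)
    × ∃[ x ] x ∈ ηe v w × ¬ B v x × r ~ x

  Expands : List (Fin n) → Set
  Expands D = (∀ d → d ∈ₗ D → ¬ InηT⁺ G T a η d) × ∃[ q ] ∃[ r ] IP G q r D
    × ∃[ u ] ∃[ v ] (NewRung D q r u v ⊎ NewStart D q r u v)

  ip? : ∀ q r D → Dec (IP G q r D)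
  ip? q r [] = no λ ()
  ip? q r (x ∷ []) with x ≟ q | x ≟ r
  ... | yes refl | yes refl = yes one
  ... | no ne | _ = no λ { one → ne refl }
  ... | _ | no ne = no λ { one → ne refl }
  ip? q r (x ∷ y ∷ D) with x ≟ q | ip? y r (y ∷ D)
  ... | no ne | _ = no λ { (more _ _ _) → ne refl }
  ... | yes refl | rest? = map′ (λ { (e , f , p) → more e f p }) (λ { (more e f p) → e , f , p })
        (E? G x y ×-dec allL? (λ z → ¬? (x ≟ z) ×-dec ¬? (E? G x z)) D ×-dec rest?)

  private
    _∈D?_ : (d : Fin n) (D : List (Fin n)) → Dec (d ∈ₗ D)
    d ∈D? D = anyL? (d ≟_) D

  newRung? : ∀ D q r u v → Dec (NewRung D q r u v)
  newRung? D q r u v = E? T u v ×-dec ¬? (leaf? u) ×-dec ¬? (leaf? v)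
    ×-dec (all? λ d → all? λ z → d ∈D? D →-dec (E? G d z →-dec (onEdge? z →-dec
            (z ∈? ηe u v ⊎-dec (d ≟ q ×-dec inB? u z) ⊎-dec (d ≟ r ×-dec inB? v z)))))
    ×-dec (all? λ z → inB? u z →-dec (¬? (z ∈? ηe u v) →-dec E? G q z))
    ×-dec (all? λ z → inB? v z →-dec (¬? (z ∈? ηe u v) →-dec E? G r z))

  newStart? : ∀ D q r v w → Dec (NewStart D q r v w)
  newStart? D q r v w = E? T v w ×-dec ¬? (leaf? v)
    ×-dec (all? λ d → all? λ z → d ∈D? D →-dec (E? G d z →-dec (onEdge? z →-dec
            ((z ∈? ηe v w ×-dec (inB? v z ⊎-dec d ≟ r)) ⊎-dec (d ≟ q ×-dec inB? v z)))))
    ×-dec (all? λ z → inB? v z →-dec (¬? (z ∈? ηe v w) →-dec E? G q z))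
    ×-dec any? λ x → x ∈? ηe v w ×-dec ¬? (inB? v x) ×-dec E? G r x

  expands? : Decidable Expands
  expands? D = (all? λ d → d ∈D? D →-dec ¬? (inηT⁺? d)) ×-dec any? λ q → any? λ r → ip? q r D
    ×-dec any? λ u → any? λ v → newRung? D q r u v ⊎-dec newStart? D q r u v

  expandable? : Dec (∃ Expands)
  expandable? = list? expands? n λ { _ (_ , _ , _ , p , _) → ip-length G p }

module Expanding {n m : ℕ} (G : Graph n) (tf : ThetaFree G) (pf : PrismFree G) (a : Fin n)
  (T : Graph m) (smooth : Smooth T) (η : StripData n m)
  (S : IsStrip G T a η) (tame : Tame G T a η) (substantial : Substantial G T a η) (rich : Rich G T a η) where

  open StripData η
  open IsStrip S
  open Trees T smooth
  open Strips G a T smooth η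
  open Facts S
  open Arms G a T smooth η S tame substantial rich
  open Jewels G tf pf a T smooth η S tame substantial rich
  open Expandability G a T smooth η

  private
    _~_ : Fin n → Fin n → Set
    _~_ = E G

  at-beyond : ∀ {v w w' z} → E T v w → E T w w' → w' ≢ v → At w w' z → At v w z
  at-beyond e e' ne (x , y , xy , d , i) = x , y , xy , edir-beyond e e' ne d , i

  at-opposite : ∀ {v w z} → E T v w → At v w z → z ∉ ηe v w → ∃[ w' ] E T w w' × w' ≢ v × At w w' z
  at-opposite e (x , y , xy , d , i) ni with edir-opposite e xy d (λ s → ni (same-ηe xy s i))
  ... | w' , e' , ne , d' = w' , e' , ne , x , y , xy , d' , i

  module _ {q r D} (p : IP G q r D) (out : ∀ {d} → d ∈ₗ D → ¬ InηT⁺ G T a η d) (minimal : Minimal D q r)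
    (nj : q ≡ r → ¬ InJ G T a η q) where

    open Attach D (ip-connected G p) out
    open Claims (ip-first∈ G p) (ip-last∈ G p) minimal nj

    private
      SeesBase : Fin m → Fin m → Set
      SeesBase u v = ∀ {w z} → E T u w → w ≢ v → z ∈ ηev u w u → Nbr z

      avoids : ∀ {u v w z} → E T u v → E T u w → z ∉ ηe u v → z ∈ ηev u w u → w ≢ v
      avoids e e' ni i refl = ni (ev⇒e e i)

      far-base : ∀ {v w w' z} → E T v w → E T w w' → w' ≢ v → z ∈ ηev w w' w → At v w z × ¬ B v z
      far-base e e' ne i = at-beyond e e' ne at₀ , at-beyond∉ e e' ne at₀
        where at₀ = at-ev e' (ev⇒e e' i)

      other-base : ∀ {v w z} → E T v w → ¬ Leaf T v → SeesBase v w → Nbr z → At v w z → z ∉ ηe v w →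
        ¬ Leaf T w × SeesBase w v × B w z
      other-base {v} {w} e nl sees nbz atz ni with at-opposite e atz ni | next nl w
      ... | w' , e' , ne , at' | t , vt , t≢w with ev-exists v t vt
      ...   | y , iy with far-base (E-sym T e) vt t≢w iy
      ...     | aty , ny =
        two⇒¬leaf e' (E-sym T e) ne
        , sees-base e' (E-sym T e) ne at' aty nbz (sees vt t≢w iy) ny
        , meets-base e' (E-sym T e) ne at' aty nbz (sees vt t≢w iy) ny

      attached : ∀ {u v z} → E T u v → ¬ Leaf T u → ¬ Leaf T v → SeesBase u v → SeesBase v u →
        Nbr z → OnEdge z → z ∉ ηe u v → B u z ⊎ B v z
      attached {u} {v} {z} e nlu nlv su sv nbz on ni with at-exists u on
      ... | w , uw , atz with w ≟ v
      ...   | yes refl = inj₂ (proj₂ (proj₂ (other-base e nlu su nbz atz ni)))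
      ...   | no ne with next nlv u
      ...     | t , vt , t≢u with ev-exists v t vt
      ...       | y , iy with far-base e vt t≢u iy
      ...         | aty , ny = inj₁ (meets-base uw e ne atz aty nbz (sv vt t≢u iy) ny)

      Min-sym : ∀ {q r} → Minimal D q r → Minimal D r q
      Min-sym min i j e e' sp with min i j e e' sp
      ... | inj₁ p = inj₂ p
      ... | inj₂ p = inj₁ p

      rung-ends : ∀ {q r u v} → q ∈ₗ D → r ∈ₗ D → Minimal D q r →
        E T u v → ¬ Leaf T u → ¬ Leaf T v → SeesBase u v → SeesBase v u →
        ∀ {t t' y y'} → E T u t → t ≢ v → y ∈ ηev u t u → q ~ y → E T v t' → t' ≢ u → y' ∈ ηev v t' v → r ~ y' →
        NewRung D q r u v
      rung-ends {q} {r} {u} {v} q∈D r∈D min e nlu nlv su sv {t} {t'} {y} {y'} ut t≢v iy qy vt t'≢u iy' ry' =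
        e , nlu , nlv , att
        , (λ z b ni → let d , i , dz = seen su e (λ k → ni k) b in subst (_~ z) (first i dz b ni) dz)
        , (λ z b ni → let d , i , dz = seen sv (E-sym T e) (λ k → ni (subst (z ∈_) (ηe-sym v u (E-sym T e)) k)) b
                      in subst (_~ z) (second i dz b ni) dz)
        where
          e' = E-sym T e
          seen : ∀ {u v z} → SeesBase u v → E T u v → z ∉ ηe u v → B u z → Nbr z
          seen su e ni (w , uw , i) = su uw (avoids e uw ni i) i
          y'-far = far-base e vt t'≢u iy'
          y-far = far-base e' ut t≢v iy
          first : ∀ {d z} → d ∈ₗ D → d ~ z → B u z → z ∉ ηe u v → d ≡ q
          first i dz (w , uw , k) ni
            with min i r∈D dz ry' (u , w , v , uw , e , avoids e uw ni k , at-ev uw (ev⇒e uw k) , proj₁ y'-far , proj₂ y'-far ∘ proj₂)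
          ... | inj₁ (eq , _) = eq
          ... | inj₂ (eq , eq') = trans eq eq'
          second : ∀ {d z} → d ∈ₗ D → d ~ z → B v z → z ∉ ηe u v → d ≡ r
          second i dz (w , vw , k) ni
            with min q∈D i qy dz (v , u , w , e' , vw ,
                   avoids e' vw (λ j → ni (subst (_ ∈_) (ηe-sym v u e') j)) k ∘ sym ,
                   proj₁ y-far , at-ev vw (ev⇒e vw k) , proj₂ y-far ∘ proj₁)
          ... | inj₁ (_ , eq) = eq
          ... | inj₂ (eq , eq') = trans eq' eq
          att : ∀ d z → d ∈ₗ D → d ~ z → OnEdge z → z ∈ ηe u v ⊎ (d ≡ q × B u z) ⊎ (d ≡ r × B v z)
          att d z i dz on with z ∈? ηe u v
          ... | yes k = inj₁ k
          ... | no ni with attached e nlu nlv su sv (d , i , dz) on ni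
          ...   | inj₁ b = inj₂ (inj₁ (first i dz b ni , b))
          ...   | inj₂ b = inj₂ (inj₂ (second i dz b ni , b))

      rung-swap : ∀ {q r u v} → NewRung D q r u v → NewRung D r q v u
      rung-swap {u = u} {v} (e , nlu , nlv , att , allu , allv) =
        E-sym T e , nlv , nlu
        , (λ d z i dz on → [ (λ k → inj₁ (subst (z ∈_) (ηe-sym u v e) k)) , [ inj₂ ∘ inj₂ , inj₂ ∘ inj₁ ]′ ]′ (att d z i dz on))
        , (λ z b ni → allv z b (λ k → ni (subst (z ∈_) (ηe-sym u v e) k)))
        , (λ z b ni → allu z b (λ k → ni (subst (z ∈_) (ηe-sym u v e) k)))

      full⇒expands : ∀ {u v} → E T u v → ¬ Leaf T u → ¬ Leaf T v → SeesBase u v → SeesBase v u → Expands D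
      full⇒expands {u} {v} e nlu nlv su sv with next nlu v | next nlv u
      ... | t , ut , t≢v | t' , vt , t'≢u with ev-exists u t ut | ev-exists v t' vt
      ...   | y , iy | y' , iy' with su ut t≢v iy | sv vt t'≢u iy' | far-base e vt t'≢u iy'
      ...     | d₁ , i₁ , d₁y | d₂ , i₂ , d₂y' | aty' , ny'
        with minimal i₁ i₂ d₁y d₂y' (u , t , v , ut , e , t≢v , at-ev ut (ev⇒e ut iy) , aty' , ny' ∘ proj₂)
      ...     | inj₁ (refl , refl) =
        (λ _ → out) , q , r , p , u , v , inj₁ (rung-ends i₁ i₂ minimal e nlu nlv su sv ut t≢v iy d₁y vt t'≢u iy' d₂y')
      ...     | inj₂ (refl , refl) =
        (λ _ → out) , q , r , p , v , u ,
          inj₁ (rung-swap (rung-ends i₁ i₂ (Min-sym minimal) e nlu nlv su sv ut t≢v iy d₁y vt t'≢u iy' d₂y'))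

      start-ends : ∀ {q r v w} → q ∈ₗ D → r ∈ₗ D → Minimal D q r → E T v w → ¬ Leaf T v → SeesBase v w →
        (∀ {z} → Nbr z → OnEdge z → z ∉ ηe v w → B v z) →
        ∀ {x t y} → x ∈ ηe v w → ¬ B v x → r ~ x → E T v t → t ≢ w → y ∈ ηev v t v → q ~ y →
        NewStart D q r v w
      start-ends {q} {r} {v} {w} q∈D r∈D min e nl sv only {x} {t} {y} ix nx rx vt t≢w iy qy =
        e , nl , att
        , (λ z b ni → let t , vt , k = b ; d , i , dz = sv vt (avoids e vt ni k) k in subst (_~ z) (first i dz b ni) dz)
        , x , ix , nx , rx
        where
          first : ∀ {d z} → d ∈ₗ D → d ~ z → B v z → z ∉ ηe v w → d ≡ q
          first i dz (s , vs , k) ni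
            with min i r∈D dz rx (v , s , w , vs , e , avoids e vs ni k , at-ev vs (ev⇒e vs k) , at-ev e ix , nx ∘ proj₂)
          ... | inj₁ (eq , _) = eq
          ... | inj₂ (eq , eq') = trans eq eq'
          att : ∀ d z → d ∈ₗ D → d ~ z → OnEdge z → (z ∈ ηe v w × (B v z ⊎ d ≡ r)) ⊎ (d ≡ q × B v z)
          att d z i dz on with z ∈? ηe v w
          ... | no ni = inj₂ (first i dz (only (d , i , dz) on ni) ni , only (d , i , dz) on ni)
          ... | yes k with inB? v z
          ...   | yes b = inj₁ (k , inj₁ b)
          ...   | no nb with min q∈D i qy dz (v , t , w , vt , e , t≢w , at-ev vt (ev⇒e vt iy) , at-ev e k , nb ∘ proj₂)
          ...     | inj₁ (_ , eq) = inj₁ (k , inj₂ eq)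
          ...     | inj₂ (eq , eq') = inj₁ (k , inj₂ (trans eq' eq))

      start-reverse : ∀ {q r v w} → NewStart D q r v w → NewStart (reverse D) q r v w
      start-reverse (e , nl , att , rest) = e , nl , (λ d z i → att d z (reverse⁻ i)) , rest

      start⇒expands : ∀ {v w x} → E T v w → ¬ Leaf T v → SeesBase v w →
        (∀ {z} → Nbr z → OnEdge z → z ∉ ηe v w → B v z) → x ∈ ηe v w → ¬ B v x → Nbr x → ∃ Expands
      start⇒expands {v} {w} {x} e nl sv only ix nx (d₁ , i₁ , d₁x) with next nl w
      ... | t , vt , t≢w with ev-exists v t vt
      ...   | y , iy with sv vt t≢w iy
      ...     | d₂ , i₂ , d₂y
        with minimal i₂ i₁ d₂y d₁x (v , t , w , vt , e , t≢w , at-ev vt (ev⇒e vt iy) , at-ev e ix , nx ∘ proj₂)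
      ...     | inj₁ (refl , refl) = D , (λ _ → out) , q , r , p , v , w ,
                  inj₂ (start-ends i₂ i₁ minimal e nl sv only ix nx d₁x vt t≢w iy d₂y)
      ...     | inj₂ (refl , refl) = reverse D , (λ _ i → out (reverse⁻ i)) , r , q , ip-reverse G p , v , w ,
                  inj₂ (start-reverse (start-ends i₂ i₁ (Min-sym minimal) e nl sv only ix nx d₁x vt t≢w iy d₂y))

      one-sided : ∀ {v w x} → E T v w → ¬ Leaf T v → SeesBase v w → Nbr x → At v w x → ¬ B v x → ∃ Expands
      one-sided {v} {w} {x} e nl sees nbx atx nx with x ∈? ηe v w
      ... | no ni with other-base e nl sees nbx atx ni
      ...   | nlw , sw , _ = D , full⇒expands e nl nlw sees sw
      one-sided {v} {w} {x} e nl sees nbx atx nx | yes ix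
        with any? (λ z → nbr? z ×-dec onEdge? z ×-dec ¬? (z ∈? ηe v w) ×-dec ¬? (inB? v z))
      ... | no none = start⇒expands e nl sees
              (λ {z} nbz on ni → decidable-stable (inB? v z) λ nb → none (z , nbz , on , ni , nb)) ix nx nbx
      ... | yes (z , nbz , on , ni , nb) with at-exists v on
      ...   | w' , e' , atz with w' ≟ w
      ...     | no ne = ⊥-elim (nb (meets-base e' e ne atz atx nbz nbx nx))
      ...     | yes refl with other-base e nl sees nbz atz ni
      ...       | nlw , sw , _ = D , full⇒expands e nl nlw sees sw

    separated⇒expandable : ∀ {x y} → Nbr x → Nbr y → SepPair x y → ∃ Expands
    separated⇒expandable {x} {y} nbx nby (v , w₁ , w₂ , e₁ , e₂ , ne , at₁ , at₂ , nb) with inB? v x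
    ... | no nx = one-sided e₁ nl (λ e i → sees-base e₂ e₁ (ne ∘ sym) at₂ at₁ nby nbx nx e i) nbx at₁ nx
      where
        nl = two⇒¬leaf e₁ e₂ ne
    ... | yes bx = one-sided e₂ nl (λ e i → sees-base e₁ e₂ ne at₁ at₂ nbx nby ny e i) nby at₂ ny
      where
        nl = two⇒¬leaf e₁ e₂ ne
        ny : ¬ B v y
        ny by = nb (bx , by)

module Extension {n m : ℕ} (G : Graph n) (a : Fin n) (T : Graph m) (smooth : Smooth T) (η : StripData n m)
  (S : IsStrip G T a η) (tame : Tame G T a η) (substantial : Substantial G T a η) (rich : Rich G T a η) where

  open StripData η
  open IsStrip S
  open Trees T smooth
  open Strips G a T smooth η
  open Facts S
  open Arms G a T smooth η S tame substantial rich
  open Expandability G a T smooth η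

  private
    _~_ : Fin n → Fin n → Set
    _~_ = E G

  Larger : StripData n m → Set
  Larger η' = IsStrip G T a η' × Tame G T a η' × Substantial G T a η' × Rich G T a η'
    × (∀ {z} → InηT G T a η z → InηT G T a η' z) × ∃[ d ] ¬ InηT G T a η d × InηT G T a η' d

  -- Adding D to η(uv), where End t d puts the vertex d of D into η(uv,t).
  module Adding (D : List (Fin n)) (out : ∀ d → d ∈ₗ D → ¬ InηT⁺ G T a η d) (u v : Fin m) (uv : E T u v)
    (End : Fin m → Fin n → Set) (End? : ∀ t d → Dec (End t d))
    (end⊆ : ∀ {t d} → End t d → d ∈ₗ D × (t ≡ u ⊎ t ≡ v) × ¬ Leaf T t)
    (end-complete : ∀ {t d z} → End t d → B t z → z ∉ ηe u v → d ~ z)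
    (end-only : ∀ {d z} → d ∈ₗ D → d ~ z → OnEdge z → z ∉ ηe u v → ∃[ t ] End t d × B t z) where

    private
      e? : ∀ x y → Decidable (λ z → z ∈ ηe x y ⊎ (SameEdge T x y u v × z ∈ₗ D))
      e? x y z = z ∈? ηe x y ⊎-dec (sameEdge? x y u v ×-dec anyL? (z ≟_) D)

      ev? : ∀ x y t → Decidable (λ z → z ∈ ηev x y t ⊎ (SameEdge T x y u v × End t z))
      ev? x y t z = z ∈? ηev x y t ⊎-dec (sameEdge? x y u v ×-dec End? t z)

    η' : StripData n m
    η' = record { ηv = ηv ; ηe = λ x y → set (e? x y) ; ηev = λ x y t → set (ev? x y t) }

    open StripData η' using () renaming (ηe to ηe' ; ηev to ηev')
    module Strips' = Strips G a T smooth η'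

    e⁻ : ∀ {x y z} → z ∈ ηe' x y → z ∈ ηe x y ⊎ (SameEdge T x y u v × z ∈ₗ D)
    e⁻ {x} {y} = ∈set⁻ (e? x y)

    e⁺ : ∀ {x y z} → z ∈ ηe x y → z ∈ ηe' x y
    e⁺ {x} {y} = ∈set⁺ (e? x y) ∘ inj₁

    new-e : ∀ {x y z} → SameEdge T x y u v → z ∈ₗ D → z ∈ ηe' x y
    new-e {x} {y} s i = ∈set⁺ (e? x y) (inj₂ (s , i))

    ev⁻ : ∀ {x y t z} → z ∈ ηev' x y t → z ∈ ηev x y t ⊎ (SameEdge T x y u v × End t z)
    ev⁻ {x} {y} {t} = ∈set⁻ (ev? x y t)

    ev⁺ : ∀ {x y t z} → z ∈ ηev x y t → z ∈ ηev' x y t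
    ev⁺ {x} {y} {t} = ∈set⁺ (ev? x y t) ∘ inj₁

    new-ev : ∀ {x y t z} → SameEdge T x y u v → End t z → z ∈ ηev' x y t
    new-ev {x} {y} {t} s i = ∈set⁺ (ev? x y t) (inj₂ (s , i))

    D∌ : ∀ {d} → d ∈ₗ D → ¬ OnEdge d
    D∌ i on = out _ i (inj₂ (inj₂ on))

    ev-old : ∀ {x y t z} → OnEdge z → z ∈ ηev' x y t → z ∈ ηev x y t
    ev-old on i with ev⁻ i
    ... | inj₁ j = j
    ... | inj₂ (_ , end) = ⊥-elim (D∌ (proj₁ (end⊆ end)) on)

    ev-new : ∀ {x y t d} → E T x y → d ∈ₗ D → d ∈ ηev' x y t → End t d
    ev-new e i j with ev⁻ j
    ... | inj₁ k = ⊥-elim (D∌ i (_ , _ , e , ev⇒e e k))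
    ... | inj₂ (_ , end) = end

    old-rung : ∀ {x y R c b} → E T x y → Rung x y R c b → Strips'.Rung x y R c b
    old-rung e r = record
      { path = path ; inside = e⁺ ∘ inside ; start = ev⁺ start ; end = ev⁺ end
      ; start! = λ i j → start! i (ev-old (_ , _ , e , inside i) j)
      ; end! = λ i j → end! i (ev-old (_ , _ , e , inside i) j) }
      where open Rung r

    η⊆η' : ∀ {z} → InηT G T a η z → InηT G T a η' z
    η⊆η' (inj₁ s) = inj₁ s
    η⊆η' (inj₂ (x , y , e , i)) = inj₂ (x , y , e , e⁺ i)

    η⁺⊆η'⁺ : ∀ {z} → InηT⁺ G T a η z → InηT⁺ G T a η' z
    η⁺⊆η'⁺ (inj₁ eq) = inj₁ eq
    η⁺⊆η'⁺ (inj₂ i) = inj₂ (η⊆η' i)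

    private
      e-sym : ∀ x y → E T x y → ηe' x y ≡ ηe' y x
      e-sym x y e = ⊆-antisym (half e) (half (E-sym T e))
        where
          half : ∀ {x y} → E T x y → ηe' x y ⊆ ηe' y x
          half {x} {y} e i with e⁻ i
          ... | inj₁ j = e⁺ (subst (_ ∈_) (ηe-sym x y e) j)
          ... | inj₂ (s , j) = new-e (same-swapˡ s) j

      ev-sym : ∀ x y t → E T x y → ηev' x y t ≡ ηev' y x t
      ev-sym x y t e = ⊆-antisym (half e) (half (E-sym T e))
        where
          half : ∀ {x y} → E T x y → ηev' x y t ⊆ ηev' y x t
          half {x} {y} e i with ev⁻ i
          ... | inj₁ j = ev⁺ (subst (_ ∈_) (ηev-sym x y t e) j)
          ... | inj₂ (s , j) = new-ev (same-swapˡ s) j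

      ∉uv : ∀ {x y z} → E T x y → ¬ SameEdge T x y u v → z ∈ ηe x y → z ∉ ηe u v
      ∉uv e ns i j = ns (same-edge e uv i j)

    module WithRungs (new-rung : ∀ {d} → d ∈ₗ D → ∃[ R ] ∃[ c ] ∃[ b ] Strips'.Rung u v R c b × d ∈ₗ R)
      (d₀ : Fin n) (d₀∈ : d₀ ∈ₗ D) where

      private
        rung-through' : ∀ {x y z} → E T x y → z ∈ ηe' x y →
          ∃[ R ] ∃[ c ] ∃[ b ] Strips'.Rung x y R c b × z ∈ₗ R
        rung-through' e i with e⁻ i
        ... | inj₁ j with rung-through e j
        ...   | R , c , b , r , k = R , c , b , old-rung e r , k
        rung-through' e i | inj₂ (inj₁ (refl , refl) , j) = new-rung j
        rung-through' e i | inj₂ (inj₂ (refl , refl) , j) with new-rung j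
        ...   | R , c , b , r , k =
          reverse R , b , c , Strips'.reverse-rung (e-sym u v uv) (λ t → ev-sym u v t uv) r , reverse⁺ k

        in-old : ∀ {z} → InηT⁺ G T a η z → a ~ z → InηT G T a η z
        in-old (inj₁ refl) az = ⊥-elim (E-irrefl G az)
        in-old (inj₂ i) _ = i

        S3' : ∀ x y t → E T x y → (∃[ z ] z ∈ ηev' x y t) ⇔ (t ≡ x ⊎ t ≡ y)
        S3' x y t e = mk⇔ to (λ s → let z , i = Equivalence.from (S3-ne x y t e) s in z , ev⁺ i)
          where
            to : (∃[ z ] z ∈ ηev' x y t) → t ≡ x ⊎ t ≡ y
            to (z , i) with ev⁻ i
            ... | inj₁ j = ev-end e j
            ... | inj₂ (s , end) = same-end (same-sym s) (proj₁ (proj₂ (end⊆ end)))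

        comp' : ∀ x y x' y' → E T x y → E T x' y' → ¬ SameEdge T x y x' y' →
          ∀ w z z' → z ∈ ηev' x y w → z' ∈ ηev' x' y' w → z ~ z'
        comp' x y x' y' e e' ns w z z' i i' with ev⁻ i | ev⁻ i'
        ... | inj₁ j | inj₁ j' = S4-comp x y x' y' e e' ns w z z' j j'
        ... | inj₁ j | inj₂ (s , end) = E-sym G (end-complete end (ev⇒B e j)
                (∉uv e (λ s' → ns (same-trans s' (same-sym s))) (ev⇒e e j)))
        ... | inj₂ (s , end) | inj₁ j' = end-complete end (ev⇒B e' j')
                (∉uv e' (λ s' → ns (same-trans s (same-sym s'))) (ev⇒e e' j'))
        ... | inj₂ (s , _) | inj₂ (s' , _) = ⊥-elim (ns (same-trans s (same-sym s')))

        other' : ∀ x y x' y' → E T x y → E T x' y' → ¬ SameEdge T x y x' y' →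
          ∀ z z' → z ∈ ηe' x y → z' ∈ ηe' x' y' → z ~ z' → ∃[ w ] z ∈ ηev' x y w × z' ∈ ηev' x' y' w
        other' x y x' y' e e' ns z z' i i' zz' with e⁻ i | e⁻ i'
        ... | inj₁ j | inj₁ j' with S4-other x y x' y' e e' ns z z' j j' zz'
        ...   | w , k , k' = w , ev⁺ k , ev⁺ k'
        other' x y x' y' e e' ns z z' i i' zz' | inj₁ j | inj₂ (s , d)
          with end-only d (E-sym G zz') (x , y , e , j) (∉uv e (λ s' → ns (same-trans s' (same-sym s))) j)
        ...   | w , end , b = w , ev⁺ (B⇒ev e j b) , new-ev s end
        other' x y x' y' e e' ns z z' i i' zz' | inj₂ (s , d) | inj₁ j'
          with end-only d zz' (x' , y' , e' , j') (∉uv e' (λ s' → ns (same-trans s (same-sym s'))) j')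
        ...   | w , end , b = w , new-ev s end , ev⁺ (B⇒ev e' j' b)
        other' x y x' y' e e' ns z z' i i' zz' | inj₂ (s , _) | inj₂ (s' , _) = ⊥-elim (ns (same-trans s (same-sym s')))

      strip' : IsStrip G T a η'
      strip' = record
        { ηe-sym = e-sym
        ; ηev-sym = ev-sym
        ; a∉v = a∉v
        ; a∉e = λ x y e i → [ a∉e x y e , (λ (_ , d) → out a d (inj₁ refl)) ]′ (e⁻ i)
        ; a∉ev = λ x y t e i → [ a∉ev x y t e , (λ (_ , end) → out a (proj₁ (end⊆ end)) (inj₁ refl)) ]′ (ev⁻ i)
        ; S1-vv = λ x y ne z i → ⊥-elim (proj₁ tame x z i)
        ; S1-ve = λ w x y e z i → ⊥-elim (proj₁ tame w z i)
        ; S1-ee = disjoint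
        ; S2 = λ l _ → proj₁ tame l
        ; S3-sub = λ x y t e z i → [ e⁺ ∘ ev⇒e e , (λ (s , end) → new-e s (proj₁ (end⊆ end))) ]′ (ev⁻ i)
        ; S3-ne = S3'
        ; S4-comp = comp'
        ; S4-other = other'
        ; S5 = λ x y e z i → let R , c , b , r , j = rung-through' e i in Strips'.rung⇒start-path r j
        ; S6 = λ w x y e z z' i → ⊥-elim (proj₁ tame w z i)
        ; S7 = λ w z i → ⊥-elim (proj₁ tame w z i)
        ; S8-comp = λ l x leaf e z i →
            [ S8-comp l x leaf e z , (λ (_ , end) → ⊥-elim (proj₂ (proj₂ (end⊆ end)) leaf)) ]′ (ev⁻ i)
        ; S8-other = λ z _ az → let l , x , leaf , e , i = S8-other z (in-old (N[a]⊆ rich az) az) az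
                                in l , x , leaf , e , ev⁺ i }
        where
          disjoint : ∀ x y x' y' → E T x y → E T x' y' → ¬ SameEdge T x y x' y' →
            ∀ z → z ∈ ηe' x y → z ∉ ηe' x' y'
          disjoint x y x' y' e e' ns z i i' with e⁻ i | e⁻ i'
          ... | inj₁ j | inj₁ j' = S1-ee x y x' y' e e' ns z j j'
          ... | inj₁ j | inj₂ (_ , d) = D∌ d (x , y , e , j)
          ... | inj₂ (_ , d) | inj₁ j' = D∌ d (x' , y' , e' , j')
          ... | inj₂ (s , _) | inj₂ (s' , _) = ns (same-trans s (same-sym s'))

      larger : Larger η'
      larger = strip' , (proj₁ tame , tame') , substantial' , rich' , η⊆η' , d₀ ,
        out d₀ d₀∈ ∘ inj₂ , inj₂ (u , v , uv , new-e (inj₁ (refl , refl)) d₀∈)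
        where
          tame' : ∀ x y → E T x y → ∀ z → z ∈ ηe' x y → Σ (Subset n) λ X → IsRung G T a η' x y (_∈ X) × z ∈ X
          tame' x y e z i with rung-through' e i
          ... | R , c , b , r , j = set (λ t → anyL? (t ≟_) R) ,
            Strips'.rung⇒IsRung r (λ t → mk⇔ (∈set⁻ (λ t → anyL? (t ≟_) R)) (∈set⁺ (λ t → anyL? (t ≟_) R))) ,
            ∈set⁺ (λ t → anyL? (t ≟_) R) j
          substantial' : Substantial G T a η'
          substantial' x y e with long-rung e
          ... | R , c , b , r , long = set (λ t → anyL? (t ≟_) R) ,
            Strips'.rung⇒IsLongRung (old-rung e r) long
              (λ t → mk⇔ (∈set⁻ (λ t → anyL? (t ≟_) R)) (∈set⁺ (λ t → anyL? (t ≟_) R)))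
          rich' : Rich G T a η'
          rich' =
            ( inj₁ refl , (λ x ax → η⁺⊆η'⁺ (N[a]⊆ rich ax)) , (λ x y ax xy → η⁺⊆η'⁺ (N²[a]⊆ rich ax xy))
            , λ x ax → let y , z , ne , hy , hz , xy , xz , only = proj₂ (proj₂ (proj₂ (proj₁ rich))) x ax in
                y , z , ne , η⁺⊆η'⁺ hy , η⁺⊆η'⁺ hz , xy , xz , λ w _ xw → only w (N²[a]⊆ rich ax xw) xw)
            , λ l x leaf e → let z , h = proj₂ rich l x leaf e in
                z , λ y → mk⇔ (λ i → Equivalence.to (h y)
                    ([ id , (λ (_ , end) → ⊥-elim (proj₂ (proj₂ (end⊆ end)) leaf)) ]′ (ev⁻ i)))
                  (ev⁺ ∘ Equivalence.from (h y))

  add-rung : ∀ {D q r u v} → (∀ d → d ∈ₗ D → ¬ InηT⁺ G T a η d) → IP G q r D → NewRung D q r u v → ∃ Larger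
  add-rung {D} {q} {r} {u} {v} out p (uv , nlu , nlv , att , allu , allv) =
    η' , WithRungs.larger (λ i → D , q , r , rung , i) q (ip-first∈ G p)
    where
      End : Fin m → Fin n → Set
      End t d = (t ≡ u × d ≡ q) ⊎ (t ≡ v × d ≡ r)
      u≢v : u ≢ v
      u≢v = E⇒≢ T uv
      end⊆ : ∀ {t d} → End t d → d ∈ₗ D × (t ≡ u ⊎ t ≡ v) × ¬ Leaf T t
      end⊆ (inj₁ (refl , refl)) = ip-first∈ G p , inj₁ refl , nlu
      end⊆ (inj₂ (refl , refl)) = ip-last∈ G p , inj₂ refl , nlv
      end-complete : ∀ {t d z} → End t d → B t z → z ∉ ηe u v → d ~ z
      end-complete (inj₁ (refl , refl)) b ni = allu _ b ni
      end-complete (inj₂ (refl , refl)) b ni = allv _ b ni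
      end-only : ∀ {d z} → d ∈ₗ D → d ~ z → OnEdge z → z ∉ ηe u v → ∃[ t ] End t d × B t z
      end-only {d} {z} i dz on ni with att d z i dz on
      ... | inj₁ j = ⊥-elim (ni j)
      ... | inj₂ (inj₁ (eq , b)) = u , inj₁ (refl , eq) , b
      ... | inj₂ (inj₂ (eq , b)) = v , inj₂ (refl , eq) , b
      open Adding D out u v uv End (λ t d → (t ≟ u ×-dec d ≟ q) ⊎-dec (t ≟ v ×-dec d ≟ r)) end⊆ end-complete end-only
      rung : Strips'.Rung u v D q r
      rung = record
        { path = p ; inside = new-e (inj₁ (refl , refl))
        ; start = new-ev (inj₁ (refl , refl)) (inj₁ (refl , refl))
        ; end = new-ev (inj₁ (refl , refl)) (inj₂ (refl , refl))
        ; start! = λ i j → [ proj₂ , (λ (eq , _) → ⊥-elim (u≢v eq)) ]′ (ev-new uv i j)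
        ; end! = λ i j → [ (λ (eq , _) → ⊥-elim (u≢v (sym eq))) , proj₂ ]′ (ev-new uv i j) }

  add-start : ∀ {D q r v w} → (∀ d → d ∈ₗ D → ¬ InηT⁺ G T a η d) → IP G q r D → NewStart D q r v w → ∃ Larger
  add-start {D} {q} {r} {v} {w} out p (vw , nlv , att , allv , x , x∈ , nx , rx) with rung-through vw x∈
  ... | R₀ , c , b , rung₀ , x∈R with ∈-∃++ x∈R
  ...   | L , R₁ , refl with splitLast (E? G r) (x ∷ R₁) (here refl) rx
  ...     | L' , z , R , eq , rz , none =
    η' , WithRungs.larger (λ i → D ++ z ∷ R , q , b , rung , ∈-++⁺ˡ i) q (ip-first∈ G p)
    where
      open Rung rung₀
      End : Fin m → Fin n → Set
      End t d = t ≡ v × d ≡ q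
      end⊆ : ∀ {t d} → End t d → d ∈ₗ D × (t ≡ v ⊎ t ≡ w) × ¬ Leaf T t
      end⊆ (refl , refl) = ip-first∈ G p , inj₁ refl , nlv
      end-complete : ∀ {t d z} → End t d → B t z → z ∉ ηe v w → d ~ z
      end-complete (refl , refl) b ni = allv _ b ni
      end-only : ∀ {d z} → d ∈ₗ D → d ~ z → OnEdge z → z ∉ ηe v w → ∃[ t ] End t d × B t z
      end-only {d} {z} i dz on ni with att d z i dz on
      ... | inj₁ (j , _) = ⊥-elim (ni j)
      ... | inj₂ (eq , b) = v , (refl , eq) , b
      open Adding D out v w vw End (λ t d → t ≟ v ×-dec d ≟ q) end⊆ end-complete end-only
      suffix : IP G z b (z ∷ R)
      suffix = ip-suffix G L' (subst (IP G x b) eq (ip-suffix G L path))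
      ⊆x : ∀ {t} → t ∈ₗ z ∷ R → t ∈ₗ x ∷ R₁
      ⊆x i = subst (_ ∈ₗ_) (sym eq) (∈-++⁺ʳ L' i)
      ⊆R₀ : ∀ {t} → t ∈ₗ z ∷ R → t ∈ₗ L ++ x ∷ R₁
      ⊆R₀ i = ∈-++⁺ʳ L (⊆x i)
      x≢c : x ≢ c
      x≢c refl = nx (ev⇒B vw start)
      ≢c : ∀ L → IP G c b (L ++ x ∷ R₁) → ∀ {t} → t ∈ₗ x ∷ R₁ → t ≢ c
      ≢c [] p = ⊥-elim (x≢c (ip-head G p))
      ≢c (l ∷ L) p i refl = ip-distinct G (l ∷ L) p (here (sym (ip-head G p))) i refl
      on : ∀ {t} → t ∈ₗ z ∷ R → OnEdge t
      on i = v , w , vw , inside (⊆R₀ i)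
      not-start : ∀ {t} → t ∈ₗ z ∷ R → ¬ B v t
      not-start i b = ≢c L path (⊆x i) (start! (⊆R₀ i) (B⇒ev vw (inside (⊆R₀ i)) b))
      is-z : ∀ {t} → t ∈ₗ z ∷ R → r ~ t → t ≡ z
      is-z (here t≡z) _ = t≡z
      is-z (there i) rt = ⊥-elim (none _ i rt)
      X : ∀ {d t} → d ∈ₗ D → t ∈ₗ z ∷ R → d ≢ t × (d ~ t → d ≡ r × t ≡ z)
      X {d} {t} i j = (λ { refl → D∌ i (on j) }) , adj
        where
          adj : d ~ t → d ≡ r × t ≡ z
          adj dt with att d t i dt (on j)
          ... | inj₁ (_ , inj₁ b) = ⊥-elim (not-start j b)
          ... | inj₁ (_ , inj₂ refl) = refl , is-z j dt
          ... | inj₂ (_ , b) = ⊥-elim (not-start j b)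
      rung : Strips'.Rung v w (D ++ z ∷ R) q b
      rung = record
        { path = ip-++ G p suffix rz X
        ; inside = λ i → [ new-e (inj₁ (refl , refl)) , e⁺ ∘ inside ∘ ⊆R₀ ]′ (∈-++⁻ D i)
        ; start = new-ev (inj₁ (refl , refl)) (refl , refl)
        ; end = ev⁺ end
        ; start! = λ i j → [ (λ k → proj₂ (ev-new vw k j))
                           , (λ k → ⊥-elim (not-start k (ev⇒B vw (ev-old (on k) j)))) ]′ (∈-++⁻ D i)
        ; end! = λ i j → [ (λ k → ⊥-elim (E⇒≢ T vw (sym (proj₁ (ev-new vw k j)))))
                         , (λ k → end! (⊆R₀ k) (ev-old (on k) j)) ]′ (∈-++⁻ D i) }

  expand : ∃ Expands → ∃ Larger
  expand (D , out , q , r , p , u , v , inj₁ new) = add-rung out p new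
  expand (D , out , q , r , p , u , v , inj₂ new) = add-start out p new

shorter : ∀ {A : Set} (L L' R' : List A) {t} → L ≢ [] ⊎ R' ≢ [] → length (L' ++ [ t ]) < length (L ++ L' ++ t ∷ R')
shorter [] L' [] (inj₁ ne) = ⊥-elim (ne refl)
shorter [] L' [] (inj₂ ne) = ⊥-elim (ne refl)
shorter [] [] (_ ∷ R') _ = s≤s (s≤s z≤n)
shorter [] (_ ∷ L') (x ∷ R') o = s≤s (shorter [] L' (x ∷ R') (inj₂ λ ()))
shorter (_ ∷ []) [] R' _ = s≤s (s≤s z≤n)
shorter (x ∷ []) (_ ∷ L') R' o = s≤s (shorter (x ∷ []) L' R' o)
shorter (_ ∷ L@(_ ∷ _)) L' R' _ = ℕ.m≤n⇒m≤1+n (shorter L L' R' (inj₁ λ ()))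

module _ {n : ℕ} (G : Graph n) where

  SubPath : List (Fin n) → Fin n → Fin n → Set
  SubPath D s t = ∃[ D' ] IP G s t D' × (∀ {z} → z ∈ₗ D' → z ∈ₗ D) × length D' < length D

  ordered-subpath : ∀ {q r s t R} L → IP G q r (L ++ s ∷ R) → t ∈ₗ s ∷ R →
    (s ≡ q × t ≡ r) ⊎ SubPath (L ++ s ∷ R) s t
  ordered-subpath {s = s} {t} {R} L p k with ∈-∃++ k
  ... | L' , R' , eq = subst (λ X → _ ⊎ SubPath (L ++ X) s t) (sym eq) (go L R' p (subst (IP G s _) eq (ip-suffix G L p)))
    where
      go : ∀ {q r} L R' → IP G q r (L ++ s ∷ R) → IP G s r (L' ++ t ∷ R') → (s ≡ q × t ≡ r) ⊎ SubPath (L ++ L' ++ t ∷ R') s t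
      go [] [] p p' with ip-suffix G L' p'
      ... | one = inj₁ (ip-head G p , refl)
      go [] R'@(_ ∷ _) p p' = inj₂ (L' ++ [ t ] , ip-prefix G L' p' , snoc⊆ L' , shorter [] L' R' (inj₂ λ ()))
      go L@(_ ∷ _) R' p p' = inj₂ (L' ++ [ t ] , ip-prefix G L' p' , ∈-++⁺ʳ L ∘ snoc⊆ L' , shorter L L' R' (inj₁ λ ()))

  subpath : ∀ {q r D s t} → IP G q r D → s ∈ₗ D → t ∈ₗ D →
    ((s ≡ q × t ≡ r) ⊎ (s ≡ r × t ≡ q)) ⊎ (SubPath D s t ⊎ SubPath D t s)
  subpath {s = s} {t} p i j with ∈-∃++ i
  ... | L , R , refl with ∈-++⁻ L j
  ...   | inj₂ k = [ inj₁ ∘ inj₁ , inj₂ ∘ inj₁ ]′ (ordered-subpath L p k)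
  ...   | inj₁ k with ∈-∃++ k
  ...     | M , M' , refl with ++-assoc M (t ∷ M') (s ∷ R)
  ...       | eq with ordered-subpath M (subst (IP G _ _) eq p) (there (∈-++⁺ʳ M' (here refl)))
  ...         | inj₁ (e , e') = inj₁ (inj₂ (e' , e))
  ...         | inj₂ sub = inj₂ (inj₂ (subst (λ D → SubPath D t s) (sym eq) sub))

module Completion {n m : ℕ} (G : Graph n) (tf : ThetaFree G) (pf : PrismFree G) (a : Fin n)
  (T : Graph m) (smooth : Smooth T) (η : StripData n m)
  (S : IsStrip G T a η) (tame : Tame G T a η) (substantial : Substantial G T a η) (rich : Rich G T a η)
  (rigid : ¬ ∃ (Expandability.Expands G a T smooth η)) where

  open StripData η
  open IsStrip S
  open Trees T smooth
  open Strips G a T smooth η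
  open Facts S
  open Arms G a T smooth η S tame substantial rich
  open Jewels G tf pf a T smooth η S tame substantial rich
  open Expanding G tf pf a T smooth η S tame substantial rich

  private
    _~_ : Fin n → Fin n → Set
    _~_ = E G

  Sees : Fin n → Fin n → Set
  Sees d z = d ~ z × OnEdge z

  sees? : ∀ d → Decidable (Sees d)
  sees? d z = E? G d z ×-dec onEdge? z

  Free : Fin n → Set
  Free d = ¬ InηT⁺ G T a η d × Local (Sees d)

  free? : Decidable Free
  free? d = ¬? (inηT⁺? d) ×-dec local? (sees? d)

  sep⇒OnEdge : ∀ {x y} → SepPair x y → OnEdge x × OnEdge y
  sep⇒OnEdge (_ , _ , _ , _ , _ , _ , at₁ , at₂ , _) = at⇒OnEdge at₁ , at⇒OnEdge at₂

  sep-pair-sym : ∀ {x y} → SepPair x y → SepPair y x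
  sep-pair-sym (v , w₁ , w₂ , s) = v , w₂ , w₁ , sep-sym s

  nonlocal⇒jewel : ∀ {p} → ¬ InηT⁺ G T a η p → ¬ Local (Sees p) → ¬ ¬ InJ G T a η p
  nonlocal⇒jewel {p} out nl nj = nl (no-sep⇒local (sees? p) proj₂ λ (px , _) (py , _) sp →
    rigid (separated⇒expandable one (λ { (here refl) → out })
      (λ { (here refl) (here refl) _ _ _ → inj₁ (refl , refl) }) (λ _ → nj)
      (p , here refl , px) (p , here refl , py) sp))

  path⊥sep : ∀ k {D q r x y} → length D ≤ k → IP G q r D → (∀ {d} → d ∈ₗ D → Free d) →
    q ~ x → r ~ y → ¬ SepPair x y
  path⊥sep zero l one free qx ry sp with () ← l
  path⊥sep zero l (more _ _ _) free qx ry sp with () ← l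
  path⊥sep (suc k) {D} {q} {r} l p free qx ry sp =
    rigid (separated⇒expandable p (proj₁ ∘ free) minimal (⊥-elim ∘ distinct)
      (q , ip-first∈ G p , qx) (r , ip-last∈ G p , ry) sp)
    where
      distinct : q ≢ r
      distinct refl = sep⊥local (proj₂ (free (ip-first∈ G p))) (qx , proj₁ (sep⇒OnEdge sp)) (ry , proj₂ (sep⇒OnEdge sp)) sp
      minimal : Minimal D q r
      minimal i j d₁z₁ d₂z₂ sp' with subpath G p i j
      ... | inj₁ ends = ends
      ... | inj₂ (inj₁ (D' , p' , ⊆D , l')) =
        ⊥-elim (path⊥sep k (ℕ.≤-pred (ℕ.≤-trans l' l)) p' (free ∘ ⊆D) d₁z₁ d₂z₂ sp')
      ... | inj₂ (inj₂ (D' , p' , ⊆D , l')) =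
        ⊥-elim (path⊥sep k (ℕ.≤-pred (ℕ.≤-trans l' l)) p' (free ∘ ⊆D) d₂z₂ d₁z₁ (sep-pair-sym sp'))

  abstract
    walk? : ∀ x y → Dec (Walk G Free x y)
    walk? x y = map′
      (λ (P , p , free) → walk-map G (lookupAll free) (ip-walk G p))
      (λ w → let P , p , free = walk⇒ip G w in P , p , tabulate free)
      (list? (λ P → Expandability.ip? G a T smooth η x y P ×-dec allL? free? P) n (λ _ (p , _) → ip-length G p))

  -- The attachments in η(T) of the component of x among the free vertices.
  Att : Fin n → Fin n → Set
  Att x z = OnEdge z × ∃[ y ] Walk G Free x y × y ~ z

  abstract
    att? : ∀ x → Decidable (Att x)
    att? x z = onEdge? z ×-dec any? λ y → walk? x y ×-dec E? G y z

  att-local : ∀ x → Local (Att x)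
  att-local x = no-sep⇒local (att? x) proj₁ λ (_ , y₁ , w₁ , e₁) (_ , y₂ , w₂ , e₂) →
    let P , p , free = walk⇒ip G (_⊕_ G (walk-reverse G w₁) w₂) in
    path⊥sep (length P) ℕ.≤-refl p free e₁ e₂

  att-move : ∀ {x y z} → Walk G Free x y → Att y z → Att x z
  att-move w (on , t , w' , e) = on , t , _⊕_ G w w' , e

  AtBase : Fin m → Fin n → Set
  AtBase v x = ∀ z → Att x z → B v z

  abstract
    atBase? : ∀ v x → Dec (AtBase v x)
    atBase? v x = all? λ z → att? x z →-dec inB? v z

  InV : Fin m → Fin n → Set
  InV v x = Free x × ∃ (Att x) × AtBase v x × (∀ v' → v' ≢ v → ¬ AtBase v' x)

  abstract
    inV? : ∀ v → Decidable (InV v)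
    inV? v x = free? x ×-dec any? (att? x) ×-dec atBase? v x ×-dec all? λ v' → ¬? (v' ≟ v) →-dec ¬? (atBase? v' x)

  -- The last two conditions hold for attachments lying in η(uv,u) ∩ η(uv,v), or in neither of B(u) and B(v).
  InE : Fin m → Fin m → Fin n → Set
  InE u v x = Free x × ∃ (Att x) × (∀ z → Att x z → z ∈ ηe u v)
    × (AtBase u x → AtBase v x) × (AtBase v x → AtBase u x)

  abstract
    inE? : ∀ u v → Decidable (InE u v)
    inE? u v x = free? x ×-dec any? (att? x) ×-dec (all? λ z → att? x z →-dec z ∈? ηe u v)
      ×-dec (atBase? u x →-dec atBase? v x) ×-dec (atBase? v x →-dec atBase? u x)

  base-move : ∀ {v x y} → Walk G Free x y → AtBase v x → AtBase v y
  base-move w at z = at z ∘ att-move w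

  inV-move : ∀ {v x y} → Walk G Free x y → InV v x → InV v y
  inV-move w (_ , (z , att) , at , uniq) =
    walk-end G w , (z , att-move (walk-reverse G w) att) , base-move w at
    , λ v' ne → uniq v' ne ∘ base-move (walk-reverse G w)

  inE-move : ∀ {u v x y} → Walk G Free x y → InE u v x → InE u v y
  inE-move w (_ , (z , att) , at , f , g) =
    walk-end G w , (z , att-move (walk-reverse G w) att) , (λ z → at z ∘ att-move w)
    , base-move w ∘ f ∘ base-move (walk-reverse G w) , base-move w ∘ g ∘ base-move (walk-reverse G w)

  inE-swap : ∀ {u v x} → E T u v → InE u v x → InE v u x
  inE-swap e (fr , ne , sub , f , g) = fr , ne , (λ z at → subst (z ∈_) (ηe-sym _ _ e) (sub z at)) , g , f

  inV-inE⊥ : ∀ {w u v x} → E T u v → InV w x → ¬ InE u v x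
  inV-inE⊥ e (_ , (z , at) , base , uniq) (_ , _ , sub , f , g) with B⇒end e (sub z at) (base z at)
  ... | inj₁ refl = uniq _ (E⇒≢ T e ∘ sym) (f base)
  ... | inj₂ refl = uniq _ (E⇒≢ T e) (g base)

  classified : ∀ {x z} → Free x → Att x z → (∃[ v ] InV v x) ⊎ (∃[ u ] ∃[ v ] E T u v × InE u v x)
  classified {x} {z} free at with att-local x
  ... | inj₁ (v , sub) with any? (λ v' → ¬? (v' ≟ v) ×-dec atBase? v' x)
  ...   | no none = inj₁ (v , free , (z , at) , sub , λ v' ne at' → none (v' , ne , at'))
  ...   | yes (v' , ne , sub') = inj₂ (v , v' , vv' , free , (z , at) , (λ z' at' → proj₂ (edge z' at')) , (λ _ → sub') , (λ _ → sub))
    where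
      edge : ∀ z → Att x z → E T v v' × z ∈ ηe v v'
      edge z at with sub z at
      ... | t , vt , i with B⇒end vt (ev⇒e vt i) (sub' z at)
      ...   | inj₁ eq = ⊥-elim (ne eq)
      ...   | inj₂ refl = vt , ev⇒e vt i
      vv' : E T v v'
      vv' = proj₁ (edge z at)
  classified {x} {z} free at | inj₂ (u , v , uv , sub) with atBase? u x | atBase? v x
  ... | yes atu | yes atv = inj₂ (u , v , uv , free , (z , at) , sub , (λ _ → atv) , (λ _ → atu))
  ... | no nu | no nv = inj₂ (u , v , uv , free , (z , at) , sub , (⊥-elim ∘ nu) , (⊥-elim ∘ nv))
  ... | yes atu | no nv = inj₁ (u , free , (z , at) , atu , uniq)
    where
      uniq : ∀ v' → v' ≢ u → ¬ AtBase v' x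
      uniq v' ne at' with B⇒end uv (sub z at) (at' z at)
      ... | inj₁ eq = ne eq
      ... | inj₂ refl = nv at'
  ... | no nu | yes atv = inj₁ (v , free , (z , at) , atv , uniq)
    where
      uniq : ∀ v' → v' ≢ v → ¬ AtBase v' x
      uniq v' ne at' with B⇒end uv (sub z at) (at' z at)
      ... | inj₁ refl = nu at'
      ... | inj₂ eq = ne eq

  private
    ζe? : ∀ u v → Decidable (λ z → z ∈ ηe u v ⊎ InE u v z)
    ζe? u v z = z ∈? ηe u v ⊎-dec inE? u v z

  ζ : StripData n m
  ζ = record { ηv = λ v → set (inV? v) ; ηe = λ u v → set (ζe? u v) ; ηev = ηev }

  open StripData ζ using () renaming (ηv to ζv ; ηe to ζe)

  v⁻ : ∀ {v x} → x ∈ ζv v → InV v x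
  v⁻ {v} = ∈set⁻ (inV? v)

  v⁺ : ∀ {v x} → InV v x → x ∈ ζv v
  v⁺ {v} = ∈set⁺ (inV? v)

  e⁻ : ∀ {u v x} → x ∈ ζe u v → x ∈ ηe u v ⊎ InE u v x
  e⁻ {u} {v} = ∈set⁻ (ζe? u v)

  old-e : ∀ {u v x} → x ∈ ηe u v → x ∈ ζe u v
  old-e {u} {v} = ∈set⁺ (ζe? u v) ∘ inj₁

  new-e : ∀ {u v x} → InE u v x → x ∈ ζe u v
  new-e {u} {v} = ∈set⁺ (ζe? u v) ∘ inj₂

  free∌ : ∀ {x} → Free x → ¬ OnEdge x
  free∌ (out , _) on = out (inj₂ (inj₂ on))

  free∌a : ¬ Free a
  free∌a (out , _) = out (inj₁ refl)

  sees⇒att : ∀ {x z} → Free x → x ~ z → OnEdge z → Att x z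
  sees⇒att free e on = on , _ , stop free , e

  edge-walk : ∀ {x y} → Free x → Free y → x ~ y → Walk G Free x y
  edge-walk fx fy e = step fx e (stop fy)

  private
    StartPath : Fin m → Fin m → Fin n → Set
    StartPath u v x = ∃[ P ] ∃[ y ] PathFT G P x y × y ∈ ηev u v u × (∀ z → z ∈ₗ P → z ∈ ζe u v)
        × (∀ z → Interior G P x y z → InCirc G T a ζ u v z)

    Inner : Fin m → Fin m → Fin n → Fin n → Set
    Inner u v t z = InE u v z ⊎ InCirc G T a η u v z ⊎ z ≡ t

    start-path : ∀ {u v x t} → E T u v → t ∈ ηev u v u → Walk G (Inner u v t) x t → StartPath u v x
    start-path {u} {v} {x} {t} uv it w with walk⇒ip G w
    ... | P , p , inner = P , t , ip⇒PathFT G p , it , (λ z i → all z (inner i)) , λ z (i , _ , z≢t) → int z z≢t (inner i)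
      where
        all : ∀ z → Inner u v t z → z ∈ ζe u v
        all z (inj₁ k) = new-e k
        all z (inj₂ (inj₁ (k , _))) = old-e k
        all z (inj₂ (inj₂ refl)) = old-e (ev⇒e uv it)
        int : ∀ z → z ≢ t → Inner u v t z → InCirc G T a ζ u v z
        int z ne (inj₁ k) = new-e k , nev , nev
          where
            nev : ∀ {s} → z ∉ ηev u v s
            nev k' = free∌ (proj₁ k) (u , v , uv , ev⇒e uv k')
        int z ne (inj₂ (inj₁ (k , k' , k''))) = old-e k , k' , k''
        int z ne (inj₂ (inj₂ eq)) = ⊥-elim (ne eq)

    new-walk : ∀ {u v x y t} → InE u v x → Walk G Free x y → Walk G (Inner u v t) x y
    new-walk ine w = walk-map G (λ w' → inj₁ (inE-move w' ine)) (walk-reach G (stop (proj₁ ine)) w)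

    S5-new : ∀ u v → E T u v → ∀ {x} → InE u v x → StartPath u v x
    S5-new u v uv {x} ine@(free , (z₀ , at₀) , sub , _ , v⇒u) with any? (λ z → att? x z ×-dec inB? u z)
    ... | yes (z , (on , y , w , yz) , b) =
      start-path uv (B⇒ev uv (sub z (on , y , w , yz)) b) (snoc G (new-walk ine w) yz (inj₂ (inj₂ refl)))
    ... | no none with any? (λ z → att? x z ×-dec ¬? (inB? v z))
    ...   | no none' = ⊥-elim (none (z₀ , at₀ ,
              v⇒u (λ z at → decidable-stable (inB? v z) λ nb → none' (z , at , nb)) z₀ at₀))
    ...   | yes (z , at@(on , y , w , yz) , nb) with S5 u v uv z (sub z at)
    ...     | P , t , p , it , inside , interior =
      start-path uv it (_⊕_ G (new-walk ine w) (step (walk-end G (new-walk ine w)) yz (walk-map G inner (ip-walk G (PathFT⇒ip G p)))))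
      where
        inner : ∀ {s} → s ∈ₗ P → Inner u v t s
        inner {s} i with s ≟ t | s ≟ z
        ... | yes eq | _ = inj₂ (inj₂ eq)
        ... | no _ | yes refl = inj₂ (inj₁ (sub s at , (λ k → none (s , at , ev⇒B uv k)) , nb ∘ ev⇒B uv))
        ... | no ne | no ne' = inj₂ (inj₁ (interior s (i , ne' , ne)))

    S5-old : ∀ u v → E T u v → ∀ {x} → x ∈ ηe u v → StartPath u v x
    S5-old u v uv i with S5 u v uv _ i
    ... | P , t , p , it , inside , interior =
      P , t , p , it , (λ z → old-e ∘ inside z) , λ z j → let k , k' , k'' = interior z j in old-e k , k' , k''

    in-old : ∀ {z} → InηT⁺ G T a η z → a ~ z → InηT G T a η z
    in-old (inj₁ refl) az = ⊥-elim (E-irrefl G az)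
    in-old (inj₂ i) _ = i

    half : ∀ {u v} → E T u v → ζe u v ⊆ ζe v u
    half e i with e⁻ i
    ... | inj₁ j = old-e (subst (_ ∈_) (ηe-sym _ _ e) j)
    ... | inj₂ j = new-e (inE-swap e j)

    disjoint : ∀ u v u' v' → E T u v → E T u' v' → ¬ SameEdge T u v u' v' → ∀ x → x ∈ ζe u v → x ∉ ζe u' v'
    disjoint u v u' v' e e' ns x i i' with e⁻ i | e⁻ i'
    ... | inj₁ j | inj₁ j' = S1-ee u v u' v' e e' ns x j j'
    ... | inj₁ j | inj₂ (fr , _) = free∌ fr (u , v , e , j)
    ... | inj₂ (fr , _) | inj₁ j' = free∌ fr (u' , v' , e' , j')
    ... | inj₂ (_ , (z , at) , sub , _) | inj₂ (_ , _ , sub' , _) = ns (same-edge e e' (sub z at) (sub' z at))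

    other : ∀ u v u' v' → E T u v → E T u' v' → ¬ SameEdge T u v u' v' →
      ∀ x y → x ∈ ζe u v → y ∈ ζe u' v' → x ~ y → ∃[ w ] x ∈ ηev u v w × y ∈ ηev u' v' w
    other u v u' v' e e' ns x y i i' xy with e⁻ i | e⁻ i'
    ... | inj₁ j | inj₁ j' = S4-other u v u' v' e e' ns x y j j' xy
    ... | inj₁ j | inj₂ (fr , _ , sub , _) =
      ⊥-elim (ns (same-edge e e' j (sub x (sees⇒att fr (E-sym G xy) (u , v , e , j)))))
    ... | inj₂ (fr , _ , sub , _) | inj₁ j' =
      ⊥-elim (ns (same-edge e e' (sub y (sees⇒att fr xy (u' , v' , e' , j'))) j'))
    ... | inj₂ j@(fr , (z , at) , sub , _) | inj₂ j'@(fr' , _ , sub' , _) =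
      ⊥-elim (ns (same-edge e e' (sub z at) (sub' z (att-move (edge-walk fr' fr (E-sym G xy)) at))))

    vertex-edge : ∀ w u v → E T u v → ∀ x → x ∈ ζv w → x ∉ ζe u v
    vertex-edge w u v e x i i' with e⁻ i'
    ... | inj₁ j = free∌ (proj₁ (v⁻ i)) (u , v , e , j)
    ... | inj₂ j = inV-inE⊥ e (v⁻ i) j

    anticomplete : ∀ w u v → E T u v → ∀ x y → x ∈ ζv w → y ∈ ζe u v → y ∉ ηev u v w → ¬ x ~ y
    anticomplete w u v e x y i i' ni xy with v⁻ i | e⁻ i'
    ... | inv@(fr , _ , base , _) | inj₁ j = ni (B⇒ev e j (base y (sees⇒att fr xy (u , v , e , j))))
    ... | inv@(fr , _ , base , _) | inj₂ j = inV-inE⊥ e (inV-move (edge-walk fr (proj₁ j) xy) inv) j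

    no-leaf : ∀ l → Leaf T l → ∀ x → x ∉ ζv l
    no-leaf l leaf x i with v⁻ i
    ... | fr , (z , at@(on , y , w , yz)) , base , _ with base z at
    ...   | t , lt , k = proj₁ (walk-end G w) (N²[a]⊆ rich (S8-comp l t leaf lt z k) (E-sym G yz))

    component : ∀ v x → x ∈ ζv v → ∃[ P ] ∃[ y ] PathFT G P x y × (∀ z → z ∈ₗ P → z ∈ ζv v) × (∃[ z ] B v z × y ~ z)
    component v x i with v⁻ i
    ... | inv@(fr , (z , at@(on , y , w , yz)) , base , _) with walk⇒ip G (walk-reach G (stop fr) w)
    ...   | P , p , reach = P , y , ip⇒PathFT G p , (λ t j → v⁺ (inV-move (reach j) inv)) , z , base z at , yz

  strip : IsStrip G T a ζ
  strip = record
    { ηe-sym = λ u v e → ⊆-antisym (half e) (half (E-sym T e))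
    ; ηev-sym = ηev-sym
    ; a∉v = λ v i → free∌a (proj₁ (v⁻ i))
    ; a∉e = λ u v e i → [ a∉e u v e , free∌a ∘ proj₁ ]′ (e⁻ i)
    ; a∉ev = a∉ev
    ; S1-vv = λ u v ne x i i' → proj₂ (proj₂ (proj₂ (v⁻ i))) v (ne ∘ sym) (proj₁ (proj₂ (proj₂ (v⁻ i'))))
    ; S1-ve = vertex-edge
    ; S1-ee = disjoint
    ; S2 = no-leaf
    ; S3-sub = λ u v t e x → old-e ∘ ev⇒e e
    ; S3-ne = S3-ne
    ; S4-comp = S4-comp
    ; S4-other = other
    ; S5 = λ u v e x i → [ S5-old u v e , S5-new u v e ]′ (e⁻ i)
    ; S6 = anticomplete
    ; S7 = component
    ; S8-comp = S8-comp
    ; S8-other = λ x _ ax → S8-other x (in-old (N[a]⊆ rich ax) ax) ax }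

  private
    η⊆ζ : ∀ {x} → InηT⁺ G T a η x → InηT⁺ G T a ζ x
    η⊆ζ (inj₁ eq) = inj₁ eq
    η⊆ζ (inj₂ (inj₁ (v , i))) = ⊥-elim (proj₁ tame v _ i)
    η⊆ζ (inj₂ (inj₂ (u , v , e , i))) = inj₂ (inj₂ (u , v , e , old-e i))

    ζ-ends : ∀ {u v P} →
      ( (∃[ x ] P ≡ [ x ] × x ∈ ηev u v u × x ∈ ηev u v v)
      ⊎ (∃[ x ] ∃[ y ] PathFT G P x y × x ∈ ηev u v u × x ∉ ηev u v v × y ∈ ηev u v v × y ∉ ηev u v u
           × (∀ z → Interior G P x y z → InCirc G T a η u v z))) →
      ( (∃[ x ] P ≡ [ x ] × x ∈ ηev u v u × x ∈ ηev u v v)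
      ⊎ (∃[ x ] ∃[ y ] PathFT G P x y × x ∈ ηev u v u × x ∉ ηev u v v × y ∈ ηev u v v × y ∉ ηev u v u
           × (∀ z → Interior G P x y z → InCirc G T a ζ u v z)))
    ζ-ends (inj₁ s) = inj₁ s
    ζ-ends (inj₂ (x , y , p , xu , xv , yv , yu , int)) =
      inj₂ (x , y , p , xu , xv , yv , yu , λ z i → let k , k' , k'' = int z i in old-e k , k' , k'')

    ζ-rung : ∀ {u v} {X Y : Fin n → Set} → (∀ z → Y z ⇔ X z) → IsRung G T a η u v X → IsRung G T a ζ u v Y
    ζ-rung h (P , X⇔ , inside , ends) =
      P , (λ z → mk⇔ (Equivalence.to (X⇔ z) ∘ Equivalence.to (h z)) (Equivalence.from (h z) ∘ Equivalence.from (X⇔ z)))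
      , (λ z → old-e ∘ inside z) , ζ-ends ends

    ζ-long : ∀ {u v} {X Y : Fin n → Set} → (∀ z → Y z ⇔ X z) → IsLongRung G T a η u v X → IsLongRung G T a ζ u v Y
    ζ-long h (P , X⇔ , long , inside , ends) =
      P , (λ z → mk⇔ (Equivalence.to (X⇔ z) ∘ Equivalence.to (h z)) (Equivalence.from (h z) ∘ Equivalence.from (X⇔ z)))
      , long , (λ z → old-e ∘ inside z) , ζ-ends ends

    consec⇒edge : ∀ {s t Λ x y} → IP T s t Λ → Consec T Λ x y → E T x y
    consec⇒edge (more e _ p) (inj₁ (refl , refl)) = e
    consec⇒edge (more e _ p) (inj₂ con) = consec⇒edge p con

    ζ-arm : ∀ {v w b P} → PyramidArm v w b P → Strips.PyramidArm G a T smooth ζ v w b P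
    ζ-arm {v} {w} (bi , l , leaf , na , Λ , pΛ , Γ , eq , path , content , long , rungs) =
      bi , l , leaf , na , Λ , pΛ , Γ , eq , path
      , (λ z j → let x , y , con , k = content z j in x , y , con , old-e k)
      , ζ-long (restrict v w) long
      , λ x y con ns → ζ-rung (restrict x y) (rungs x y con ns)
      where
        on : ∀ {z} → z ∈ₗ Γ → OnEdge z
        on j with content _ j
        ... | x , y , con , k = x , y , consec⇒edge (PathFT⇒ip T pΛ) con , k
        restrict : ∀ x y z → (z ∈ₗ Γ × z ∈ ζe x y) ⇔ (z ∈ₗ Γ × z ∈ ηe x y)
        restrict x y z = mk⇔ (λ (j , k) → j , [ id , (λ ine → ⊥-elim (free∌ (proj₁ ine) (on j))) ]′ (e⁻ k))
                             (λ (j , k) → j , old-e k)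

    ζ-jewel : ∀ {p} → ¬ InηT⁺ G T a ζ p → InJ G T a η p → InJ G T a ζ p
    ζ-jewel nζ (_ , v , br , w , ew , inj , b , P , (pyr , arms) , jewel) =
      nζ , v , br , w , ew , inj , b , P , (pyr , λ i → ζ-arm (arms i)) , jewel

  substantial-ζ : Substantial G T a ζ
  substantial-ζ u v e = let X , long = substantial u v e in X , ζ-long (λ _ → mk⇔ id id) long

  rich-ζ : Rich G T a ζ
  rich-ζ =
    ( inj₁ refl , (λ x ax → η⊆ζ (N[a]⊆ rich ax)) , (λ x y ax xy → η⊆ζ (N²[a]⊆ rich ax xy))
    , λ x ax → let y , z , ne , hy , hz , xy , xz , only = proj₂ (proj₂ (proj₂ (proj₁ rich))) x ax in
        y , z , ne , η⊆ζ hy , η⊆ζ hz , xy , xz , λ w _ xw → only w (N²[a]⊆ rich ax xw) xw)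
    , proj₂ rich

  isolated : ∀ x y → ¬ InηT⁺ G T a ζ x → ¬ InJ G T a ζ x → InηT⁺ G T a ζ y → ¬ x ~ y
  isolated x y nζ nj iny xy with local? (sees? x)
  ... | no nl = nonlocal⇒jewel (nζ ∘ η⊆ζ) nl (nj ∘ ζ-jewel nζ)
  ... | yes loc = bad iny
    where
      fx : Free x
      fx = nζ ∘ η⊆ζ , loc
      absorbed : ∀ {z} → ¬ Att x z
      absorbed at with classified fx at
      ... | inj₁ (v , i) = nζ (inj₂ (inj₁ (v , v⁺ i)))
      ... | inj₂ (u , v , e , i) = nζ (inj₂ (inj₂ (u , v , e , new-e i)))
      bad : ¬ InηT⁺ G T a ζ y
      bad (inj₁ refl) = nζ (η⊆ζ (N[a]⊆ rich (E-sym G xy)))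
      bad (inj₂ (inj₁ (v , i))) with v⁻ i
      ... | fy , (z , at) , _ = absorbed (att-move (edge-walk fx fy xy) at)
      bad (inj₂ (inj₂ (u , v , e , i))) with e⁻ i
      ... | inj₁ j = absorbed (sees⇒att fx xy (u , v , e , j))
      ... | inj₂ (fy , (z , at) , _) = absorbed (att-move (edge-walk fx fy xy) at)

theorem4p2 : {n m : ℕ} (G : Graph n) → ThetaFree G → PrismFree G →
    (a : Fin n) (T : Graph m) → Smooth T →
    Σ (StripData n m) (λ η → IsStrip G T a η × Tame G T a η × Substantial G T a η × Rich G T a η) →
    Σ (StripData n m) (λ ζ → IsStrip G T a ζ × Substantial G T a ζ × Rich G T a ζ ×
    ((x y : Fin n) → ¬ InηT⁺ G T a ζ x → ¬ InJ G T a ζ x → InηT⁺ G T a ζ y → ¬ E G x y))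
theorem4p2 {n} {m} G tf pf a T smooth (η , S , tame , substantial , rich) =
  complete η S tame substantial rich (⊃-wellFounded _)
  where
    complete : ∀ (η : StripData n m) → IsStrip G T a η → Tame G T a η → Substantial G T a η → Rich G T a η →
      Acc _⊃_ (set (Strips.inηT? G a T smooth η)) →
      Σ (StripData n m) (λ ζ → IsStrip G T a ζ × Substantial G T a ζ × Rich G T a ζ ×
        ((x y : Fin n) → ¬ InηT⁺ G T a ζ x → ¬ InJ G T a ζ x → InηT⁺ G T a ζ y → ¬ E G x y))
    complete η S tame substantial rich (acc rs) with Expandability.expandable? G a T smooth η
    ... | no rigid = ζ , strip , substantial-ζ , rich-ζ , isolated
      where open Completion G tf pf a T smooth η S tame substantial rich rigid
    ... | yes ex with Extension.expand G a T smooth η S tame substantial rich ex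
    ...   | η' , S' , tame' , substantial' , rich' , ⊆' , d , d∉ , d∈ =
      complete η' S' tame' substantial' rich' (rs
        ( (λ i → ∈set⁺ (Strips.inηT? G a T smooth η') (⊆' (∈set⁻ (Strips.inηT? G a T smooth η) i)))
        , d , ∈set⁺ (Strips.inηT? G a T smooth η') d∈ , d∉ ∘ ∈set⁻ (Strips.inηT? G a T smooth η)))
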